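{- Let $b, c$ be integers satisfying $-3 \le b \le 0$ and $c \le -b-3$. Then $\mathbb{Q}(\alpha) \neq \mathbb{Q}(\beta)$ holds for all $\alpha, \beta \in I_{b,c}^{3,tr}$ with $\alpha \neq \beta$. Moreover, let $\delta_b, \epsilon_b$ ($b \in \{0,-1,-2,-3\}$) be the integers defined by $\delta_0 = \delta_{ -1} = 1$, $\delta_{ -2} = \delta_{ -3} = 0$, $\epsilon_0 = 1$, $\epsilon_{ -1} = \epsilon_{ -2} = \epsilon_{ -3} = 0$. Then all the elements of $I_{b,c}^{3,tr}$ are totally real cubic if $c$ is of the form $-n^2+(b-1)n-1$ with $n \in \mathbb{Z}$, $n \ge \delta_b$, or of the form $-n^2+bn$ with $n \in \mathbb{Z}$, $n \ge 1+\epsilon_b-\epsilon_{ -3-b}$. Otherwise all the elements of $I_{b,c}^{3,tr}$, except exactly one, are totally real cubic, and the exceptional element is real quadratic. Specifically, for $c$ satisfying $-n^2+(b-1)n-1 < c < -n^2+bn$ with $n \in \mathbb{Z}$, $n \ge 1+\epsilon_b$, the unique quadratic element is a root of the polynomial $x^3+bx^2+cx-(n-b)(c+n^2-bn)$, and its minimal polynomial over $\mathbb{Q}$ is $x^2+nx+c+n^2-bn$. The same is true (with the same polynomials) for $c$ satisfying $-n^2+bn < c < -n^2+(b-1)n-1$ with $n \in \mathbb{Z}$, $n \le -3-\epsilon_{ -3-b}$.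
   Context: For integers $m, n$ satisfying $n \le -m-3$, define $$I_{m,n}^{3,tr} := \{\alpha \in (0,1) \mid \alpha^3+m\alpha^2+n\alpha+d=0 \text{ for some } d \in \mathbb{Z},\ 1 \le d \le -m-n-2\}.$$ An algebraic number is totally real cubic if it has degree three over $\mathbb{Q}$ and all its conjugates are real; it is real quadratic if it is real and has degree two over $\mathbb{Q}$. $\mathbb{Q}(\alpha)$ denotes the subfield of $\mathbb{C}$ generated by $\alpha$. -}

module Defs where

open import Level using (0ℓ)
open import Data.Integer using (ℤ; +_; -[1+_])
import Data.Integer as ℤ
open import Data.Nat using (ℕ; _⊔_)
import Data.Nat as ℕ
import Data.Nat.Properties as ℕₚ
open import Data.Product using (Σ-syntax; ∃-syntax; _×_; _,_)
open import Data.Rational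
  using (ℚ; 0ℚ; 1ℚ; ½; _/_; 1/_; _+_; _-_; _*_; -_; ∣_∣; _<_; _≤_; Positive; positive; NonZero; nonNegative)
open import Data.Rational.Properties
open import Data.Rational.Solver using (module +-*-Solver)
open import Data.Vec using (Vec; []; _∷_)
import Data.Vec as Vec
open import Relation.Binary.PropositionalEquality
  using (_≡_; refl; sym; cong; cong₂; subst; module ≡-Reasoning)
open import Relation.Nullary using (¬_)
open import Relation.Unary using (Pred; _∈_)

-- A real number is a Cauchy sequence of rationals together with a modulus of
-- convergence; _≈ᴿ_ is equality of real numbers.

Cauchy : (ℕ → ℚ) → Set
Cauchy x = ∀ ε → 0ℚ < ε →
  ∃[ N ] (∀ m n → N ℕ.≤ m → N ℕ.≤ n → ∣ x m - x n ∣ < ε)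

record ℝ : Set where
  constructor mkℝ
  field
    seq    : ℕ → ℚ
    cauchy : Cauchy seq

open ℝ public

infix 4 _≈ᴿ_ _<ᴿ_

record _≈ᴿ_ (x y : ℝ) : Set where
  constructor mk≈
  field
    close : ∀ ε → 0ℚ < ε → ∃[ N ] (∀ n → N ℕ.≤ n → ∣ seq x n - seq y n ∣ < ε)

record _<ᴿ_ (x y : ℝ) : Set where
  constructor mk<
  field
    gap   : ℚ
    0<gap : 0ℚ < gap
    apart : ∃[ N ] (∀ n → N ℕ.≤ n → seq x n + gap < seq y n)

open _≈ᴿ_ public
open _<ᴿ_ public

open +-*-Solver using (solve; con; _:+_; _:*_; _:-_; :-_; _:=_)

private abstract

  0<½ε : ∀ {ε} → 0ℚ < ε → 0ℚ < ½ * ε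
  0<½ε {ε} 0<ε = subst (_< ½ * ε) (*-zeroʳ ½) (*-monoʳ-<-pos ½ 0<ε)

  ½+½ : ∀ ε → ½ * ε + ½ * ε ≡ ε
  ½+½ = solve 1 (λ e → con ½ :* e :+ con ½ :* e := e) refl

  const-cauchy : ∀ q → Cauchy (λ _ → q)
  const-cauchy q ε 0<ε = 0 , λ _ _ _ _ →
    subst (_< ε) (sym (cong ∣_∣ (+-inverseʳ q))) 0<ε

  +-cauchy : ∀ {x y} → Cauchy x → Cauchy y → Cauchy (λ n → x n + y n)
  +-cauchy {x} {y} cx cy ε 0<ε
    with M , hx ← cx (½ * ε) (0<½ε 0<ε) | N , hy ← cy (½ * ε) (0<½ε 0<ε)
    = M ⊔ N , λ m n p q → begin-strict
      ∣ (x m + y m) - (x n + y n) ∣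
        ≡⟨ cong ∣_∣ (rearrange (x m) (y m) (x n) (y n)) ⟩
      ∣ (x m - x n) + (y m - y n) ∣
        ≤⟨ ∣p+q∣≤∣p∣+∣q∣ (x m - x n) (y m - y n) ⟩
      ∣ x m - x n ∣ + ∣ y m - y n ∣
        <⟨ +-mono-< (hx m n (ℕₚ.m⊔n≤o⇒m≤o M N p) (ℕₚ.m⊔n≤o⇒m≤o M N q))
                    (hy m n (ℕₚ.m⊔n≤o⇒n≤o M N p) (ℕₚ.m⊔n≤o⇒n≤o M N q)) ⟩
      ½ * ε + ½ * ε
        ≡⟨ ½+½ ε ⟩
      ε ∎
    where
    open ≤-Reasoning
    rearrange : ∀ a b c d → (a + b) - (c + d) ≡ (a - c) + (b - d)
    rearrange = solve 4 (λ a b c d → (a :+ b) :- (c :+ d) := (a :- c) :+ (b :- d)) refl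

  neg-cauchy : ∀ {x} → Cauchy x → Cauchy (λ n → - x n)
  neg-cauchy {x} cx ε 0<ε with N , h ← cx ε 0<ε = N , λ m n p q →
    subst (_< ε) (sym (begin
      ∣ - x m - - x n ∣    ≡⟨ cong ∣_∣ (rearrange (x m) (x n)) ⟩
      ∣ - (x m - x n) ∣    ≡⟨ ∣-p∣≡∣p∣ (x m - x n) ⟩
      ∣ x m - x n ∣        ∎)) (h m n p q)
    where
    open ≡-Reasoning
    rearrange : ∀ a b → - a - - b ≡ - (a - b)
    rearrange = solve 2 (λ a b → :- a :- (:- b) := :- (a :- b)) refl

  EventuallyBounded : (ℕ → ℚ) → Set
  EventuallyBounded x = ∃[ B ] 0ℚ < B × (∃[ N ] (∀ n → N ℕ.≤ n → ∣ x n ∣ ≤ B))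

  bounded : ∀ {x} → Cauchy x → EventuallyBounded x
  bounded {x} cx with N , h ← cx 1ℚ (positive⁻¹ 1ℚ)
    = 1ℚ + ∣ x N ∣ , +-mono-<-≤ (positive⁻¹ 1ℚ) (0≤∣p∣ (x N)) , N , λ n p → begin
      ∣ x n ∣                   ≡⟨ cong ∣_∣ (rearrange (x n) (x N)) ⟩
      ∣ (x n - x N) + x N ∣     ≤⟨ ∣p+q∣≤∣p∣+∣q∣ (x n - x N) (x N) ⟩
      ∣ x n - x N ∣ + ∣ x N ∣   ≤⟨ +-monoˡ-≤ ∣ x N ∣ (<⇒≤ (h n N p ℕₚ.≤-refl)) ⟩
      1ℚ + ∣ x N ∣              ∎
    where
    open ≤-Reasoning
    rearrange : ∀ a b → a ≡ (a - b) + b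
    rearrange = solve 2 (λ a b → a := (a :- b) :+ b) refl

  fraction : ∀ {B ε} → 0ℚ < B → 0ℚ < ε → ∃[ δ ] 0ℚ < δ × B * δ ≡ ε
  fraction {B} {ε} 0<B 0<ε = 1/ B * ε , 0<δ , (begin
      B * (1/ B * ε)  ≡⟨ *-assoc B (1/ B) ε ⟨
      B * 1/ B * ε    ≡⟨ cong (_* ε) (*-inverseʳ B) ⟩
      1ℚ * ε          ≡⟨ *-identityˡ ε ⟩
      ε               ∎)
    where
    open ≡-Reasoning
    instance
      B-pos : Positive B
      B-pos = positive 0<B
      B-nz : NonZero B
      B-nz = pos⇒nonZero B
      1/B-pos : Positive (1/ B)
      1/B-pos = 1/pos⇒pos B
    0<δ : 0ℚ < 1/ B * ε
    0<δ = subst (_< 1/ B * ε) (*-zeroʳ (1/ B)) (*-monoʳ-<-pos (1/ B) 0<ε)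

  ∣*∣-bound : ∀ {B} p q {δ} → 0ℚ < B → ∣ p ∣ ≤ B → ∣ q ∣ < δ → ∣ p * q ∣ < B * δ
  ∣*∣-bound {B} p q {δ} 0<B p≤B q<δ = begin-strict
      ∣ p * q ∣       ≡⟨ ∣p*q∣≡∣p∣*∣q∣ p q ⟩
      ∣ p ∣ * ∣ q ∣   ≤⟨ *-monoʳ-≤-nonNeg ∣ q ∣ {{nonNegative (0≤∣p∣ q)}} p≤B ⟩
      B * ∣ q ∣       <⟨ *-monoʳ-<-pos B {{positive 0<B}} q<δ ⟩
      B * δ           ∎
    where open ≤-Reasoning

  product-estimate : ∀ {A B δ η ε} a b c d →
    0ℚ < A → 0ℚ < B → A * δ ≡ ½ * ε → B * η ≡ ½ * ε →
    ∣ d ∣ ≤ A → ∣ a ∣ ≤ B → ∣ a - c ∣ < δ → ∣ b - d ∣ < η →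
    ∣ a * b - c * d ∣ < ε
  product-estimate {A} {B} {δ} {η} {ε} a b c d 0<A 0<B Aδ Bη d≤A a≤B ac<δ bd<η =
    begin-strict
      ∣ a * b - c * d ∣
        ≡⟨ cong ∣_∣ (rearrange a b c d) ⟩
      ∣ d * (a - c) + a * (b - d) ∣
        ≤⟨ ∣p+q∣≤∣p∣+∣q∣ (d * (a - c)) (a * (b - d)) ⟩
      ∣ d * (a - c) ∣ + ∣ a * (b - d) ∣
        <⟨ +-mono-< (∣*∣-bound d (a - c) 0<A d≤A ac<δ) (∣*∣-bound a (b - d) 0<B a≤B bd<η) ⟩
      A * δ + B * η
        ≡⟨ cong₂ _+_ Aδ Bη ⟩
      ½ * ε + ½ * ε
        ≡⟨ ½+½ ε ⟩
      ε ∎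
    where
    open ≤-Reasoning
    rearrange : ∀ a b c d → a * b - c * d ≡ d * (a - c) + a * (b - d)
    rearrange = solve 4 (λ a b c d →
      a :* b :- c :* d := d :* (a :- c) :+ a :* (b :- d)) refl

  *-cauchy : ∀ {x y} → Cauchy x → Cauchy y → Cauchy (λ n → x n * y n)
  *-cauchy {x} {y} cx cy ε 0<ε =
    let B , 0<B , Nx , x≤B = bounded cx
        A , 0<A , Ny , y≤A = bounded cy
        δ , 0<δ , Aδ = fraction 0<A (0<½ε 0<ε)
        η , 0<η , Bη = fraction 0<B (0<½ε 0<ε)
        Mx , hx = cx δ 0<δ
        My , hy = cy η 0<η
        N = Nx ⊔ Ny
        M = Mx ⊔ My
    in N ⊔ M , λ m n p q →
      let N≤m = ℕₚ.m⊔n≤o⇒m≤o N M p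
          M≤m = ℕₚ.m⊔n≤o⇒n≤o N M p
          N≤n = ℕₚ.m⊔n≤o⇒m≤o N M q
          M≤n = ℕₚ.m⊔n≤o⇒n≤o N M q
      in product-estimate (x m) (y m) (x n) (y n) 0<A 0<B Aδ Bη
           (y≤A n (ℕₚ.m⊔n≤o⇒n≤o Nx Ny N≤n))
           (x≤B m (ℕₚ.m⊔n≤o⇒m≤o Nx Ny N≤m))
           (hx m n (ℕₚ.m⊔n≤o⇒m≤o Mx My M≤m) (ℕₚ.m⊔n≤o⇒m≤o Mx My M≤n))
           (hy m n (ℕₚ.m⊔n≤o⇒n≤o Mx My M≤m) (ℕₚ.m⊔n≤o⇒n≤o Mx My M≤n))

fromℚᴿ : ℚ → ℝ
fromℚᴿ q = mkℝ (λ _ → q) (const-cauchy q)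

0ᴿ 1ᴿ : ℝ
0ᴿ = fromℚᴿ 0ℚ
1ᴿ = fromℚᴿ 1ℚ

infixl 6 _+ᴿ_ _+ᶜ_
infixl 7 _*ᴿ_ _*ᶜ_
infix  8 -ᴿ_ -ᶜ_

_+ᴿ_ : ℝ → ℝ → ℝ
x +ᴿ y = mkℝ (λ n → seq x n + seq y n) (+-cauchy {seq x} {seq y} (cauchy x) (cauchy y))

_*ᴿ_ : ℝ → ℝ → ℝ
x *ᴿ y = mkℝ (λ n → seq x n * seq y n) (*-cauchy {seq x} {seq y} (cauchy x) (cauchy y))

-ᴿ_ : ℝ → ℝ
-ᴿ x = mkℝ (λ n → - seq x n) (neg-cauchy {seq x} (cauchy x))

record ℂ : Set where
  constructor _+i_
  field
    re im : ℝ

open ℂ public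

infix 4 _≈ᶜ_

record _≈ᶜ_ (z w : ℂ) : Set where
  constructor _+i≈_
  field
    re≈ : re z ≈ᴿ re w
    im≈ : im z ≈ᴿ im w

open _≈ᶜ_ public

_+ᶜ_ _*ᶜ_ : ℂ → ℂ → ℂ
z +ᶜ w = (re z +ᴿ re w) +i (im z +ᴿ im w)
z *ᶜ w = (re z *ᴿ re w +ᴿ -ᴿ (im z *ᴿ im w)) +i (re z *ᴿ im w +ᴿ im z *ᴿ re w)

-ᶜ_ : ℂ → ℂ
-ᶜ z = (-ᴿ re z) +i (-ᴿ im z)

ι : ℝ → ℂ
ι x = x +i 0ᴿ

fromℚᶜ : ℚ → ℂ
fromℚᶜ q = ι (fromℚᴿ q)

0ᶜ 1ᶜ : ℂ
0ᶜ = fromℚᶜ 0ℚ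
1ᶜ = fromℚᶜ 1ℚ

IsReal : ℂ → Set
IsReal z = im z ≈ᴿ 0ᴿ

-- ℚ⟮ z ⟯ is the smallest subset of ℂ that contains z and is a subfield.
data ℚ⟮_⟯ (z : ℂ) : Pred ℂ 0ℓ where
  gen   : z ∈ ℚ⟮ z ⟯
  one   : 1ᶜ ∈ ℚ⟮ z ⟯
  add   : ∀ {u v} → u ∈ ℚ⟮ z ⟯ → v ∈ ℚ⟮ z ⟯ → u +ᶜ v ∈ ℚ⟮ z ⟯
  neg   : ∀ {u} → u ∈ ℚ⟮ z ⟯ → -ᶜ u ∈ ℚ⟮ z ⟯
  mul   : ∀ {u v} → u ∈ ℚ⟮ z ⟯ → v ∈ ℚ⟮ z ⟯ → u *ᶜ v ∈ ℚ⟮ z ⟯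
  inv   : ∀ {u v} → u ∈ ℚ⟮ z ⟯ → u *ᶜ v ≈ᶜ 1ᶜ → v ∈ ℚ⟮ z ⟯
  resp≈ : ∀ {u v} → u ∈ ℚ⟮ z ⟯ → u ≈ᶜ v → v ∈ ℚ⟮ z ⟯

-- a₀ ∷ a₁ ∷ … ∷ aₙ₋₁ ∷ [] stands for xⁿ + aₙ₋₁xⁿ⁻¹ + … + a₁x + a₀.
Monic : ℕ → Set
Monic n = Vec ℚ n

eval : ∀ {n} → Monic n → ℂ → ℂ
eval []      z = 1ᶜ
eval (a ∷ p) z = fromℚᶜ a +ᶜ z *ᶜ eval p z

_IsRootOf_ : ∀ {n} → ℂ → Monic n → Set
z IsRootOf p = eval p z ≈ᶜ 0ᶜ

ofℤ : ∀ {n} → Vec ℤ n → Monic n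
ofℤ = Vec.map (_/ 1)

IsMinPoly : ∀ {n} → Monic n → ℂ → Set
IsMinPoly {n} p z = z IsRootOf p × (∀ {m} (q : Monic m) → z IsRootOf q → n ℕ.≤ m)

HasDegree : ℕ → ℂ → Set
HasDegree n z = Σ[ p ∈ Monic n ] IsMinPoly p z

_IsConjugateOf_ : ℂ → ℂ → Set
w IsConjugateOf z = ∃[ n ] Σ[ p ∈ Monic n ] IsMinPoly p z × w IsRootOf p

TotallyRealCubic : ℂ → Set
TotallyRealCubic z = HasDegree 3 z × (∀ w → w IsConjugateOf z → IsReal w)

RealQuadratic : ℂ → Set
RealQuadratic z = IsReal z × HasDegree 2 z

cubic : ℤ → ℤ → ℤ → Monic 3
cubic b c d = ofℤ (d ∷ c ∷ b ∷ [])

quadratic : ℤ → ℤ → Monic 2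
quadratic p q = ofℤ (q ∷ p ∷ [])

I³ʳ : ℤ → ℤ → Pred ℝ 0ℓ
I³ʳ m n α = 0ᴿ <ᴿ α × α <ᴿ 1ᴿ ×
  (∃[ d ] ℤ.1ℤ ℤ.≤ d × d ℤ.≤ ℤ.- m ℤ.- n ℤ.- + 2 × ι α IsRootOf cubic m n d)

-- α is the only element of I³ʳ b c that is not totally real cubic, and it is
-- real quadratic.
IsSoleException : ℤ → ℤ → ℝ → Set
IsSoleException b c α =
  α ∈ I³ʳ b c × ¬ TotallyRealCubic (ι α) × RealQuadratic (ι α) ×
  (∀ β → β ∈ I³ʳ b c → ¬ (β ≈ᴿ α) → TotallyRealCubic (ι β))

-- Only the values at 0, -1, -2, -3 matter.
δ ε : ℤ → ℤ
δ (+ 0)    = + 1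
δ -[1+ 0 ] = + 1
δ _        = + 0
ε (+ 0)    = + 1
ε _        = + 0

{-# OPTIONS --safe #-}
module Submission where

-- Write f = x³ + bx² + cx + d.  The inequalities say f(0) > 0 > f(1), so α is the
-- root of f in (0, 1), and α′ < 0, α″ > 1 for the other two.
--
-- Distinct fields.  Let f be irreducible, and let β = p + qα + rα² be the root in
-- (0, 1) of another polynomial g of the family, with conjugates β′, β″.  As f and g
-- share b and c, |α′ - α″| and |β′ - β″| differ little.  If α′ - α″ and β′ - β″
-- have the same sign, β - α and its conjugates are so small that its norm, an
-- integer, vanishes, and β = α.  If the signs are opposite, the same happens to
-- the norm of α + β + k with k = -1 for b = -1, -2, and to the norm of
-- (α + β + k)(α + β + k′) with {k, k′} = {0, 1} for b = 0 and {-2, -3} for b = -3.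
-- No splitting field is needed: the norm is γ · adj γ, where adj γ (the product
-- of the two other conjugates of γ) lies in ℚ(γ), and only the ratio
-- ρ = (β′ - β″) / (α′ - α″) = q - r(b + α) enters the estimates.  Norms are integers
-- because multiplication by γ preserves ℤ[α, β], which lies in D⁻¹(ℤ + ℤα + ℤα²).
--
-- Reducible members.  If f has an integer root m = n - b, then
-- f = (x - m)(x² + nx + e) with e = c + n² - bn, and f(0) > 0 > f(1) says that
-- c = e - n² + bn lies strictly between the two values of the statement.  These
-- intervals are disjoint and omit only the special forms, so at most one d is
-- reducible; otherwise f is irreducible with three real roots.

open import Defs
open import Data.Integer using (ℤ; +_; -[1+_])
import Data.Integer as ℤ
import Data.Integer.Properties as ℤₚ
open import Data.Nat using (ℕ; zero; suc; z≤n; s≤s)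
import Data.Nat as ℕ
import Data.Nat.Properties as ℕₚ
open import Data.Product using (∃-syntax; Σ-syntax; _×_; _,_; proj₁; proj₂)
open import Data.Sum using (_⊎_; inj₁; inj₂)
open import Data.Vec using ([]; _∷_)
open import Function using (_∘_)
open import Relation.Binary.Definitions using (tri<; tri≈; tri>)
open import Relation.Binary.PropositionalEquality
open import Relation.Nullary using (¬_; yes; no; contradiction)
open import Relation.Nullary.Decidable using (decidable-stable; toWitness)
open import Relation.Unary using (_∈_; _≐_)

-- Write `u = α + β`, so `0 < u < 2`. The trace of `α + β + k` is `3k - 2b`, so its other two
-- conjugates sum to `2k - 2b - u`; the shifts considered make this `-u` or `2 - u`. For b = -1 and
-- b = -2 the shift -1 does so and also puts `u - 1` in (-1, 1), and one norm suffices. For b = 0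
-- and b = -3 no shift achieves both, and one norm may be estimated only by about 2; but `-u` is
-- small where `2 - u` is large and conversely, so the product of the two norms is small. The
-- reflection x ↦ 1 - x exchanges b with -3 - b, which pairs the cases and puts `2 - u` in place of
-- `u`. The estimates rest on `disc α - disc β = (β - α)(2b + 3(α + β))`, whose last factor has
-- absolute value at most 6 when -3 ≤ b ≤ 0. The order on Cauchy reals is undecidable, which shapes
-- the proof: equality of reals is stable under double negation, so sign distinctions are made only
-- below an equality or a refutation. Only the exceptional root is constructed, by bisection with
-- rational comparisons.

module RationalArithmetic where
  open import Data.Rational public hiding (_⊔_)
  open import Data.Rational.Properties public hiding (pos⇒nonNeg; +-rawMonoid; *-rawMonoid)
  open import Data.Rational.Solver using (module +-*-Solver)
  open +-*-Solver public using (Polynomial; solve; con; _:+_; _:*_; _:-_; :-_; _:=_)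

-- Integers among the rationals and the rational root theorem.

module Integrality where
  open import Data.Integer.Coprimality using (coprime-divisor)
  open import Data.Integer.Divisibility.Signed using (_∣_; divides; ∣ᵤ⇒∣; ∣⇒∣ᵤ)
  import Data.Nat.Coprimality as Coprimality
  open import Data.Nat.Induction using (<-wellFounded)
  open import Data.Rational.Unnormalised using (ℚᵘ; mkℚᵘ; *≡*; *<*) renaming (_≃_ to _≃ᵘ_)
  import Data.Rational.Unnormalised as ℚᵘ
  import Data.Rational.Unnormalised.Properties as ℚᵘₚ
  open import Induction.WellFounded using (Acc; acc)
  open RationalArithmetic

  fromℤ : ℤ → ℚ
  fromℤ z = z / 1

  toℚᵘ-fromℤ : ∀ z → toℚᵘ (fromℤ z) ≃ᵘ mkℚᵘ z 0
  toℚᵘ-fromℤ z = toℚᵘ-fromℚᵘ (mkℚᵘ z 0)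

  fromℤ-+ : ∀ x y → fromℤ (x ℤ.+ y) ≡ fromℤ x + fromℤ y
  fromℤ-+ x y = toℚᵘ-injective (begin
      toℚᵘ (fromℤ (x ℤ.+ y))              ≈⟨ toℚᵘ-fromℤ (x ℤ.+ y) ⟩
      mkℚᵘ (x ℤ.+ y) 0                    ≈⟨ *≡* (cong (ℤ._* + 1) (sym (cong₂ ℤ._+_ (ℤₚ.*-identityʳ x) (ℤₚ.*-identityʳ y)))) ⟩
      mkℚᵘ x 0 ℚᵘ.+ mkℚᵘ y 0              ≈⟨ ℚᵘₚ.+-cong (toℚᵘ-fromℤ x) (toℚᵘ-fromℤ y) ⟨
      toℚᵘ (fromℤ x) ℚᵘ.+ toℚᵘ (fromℤ y)  ≈⟨ toℚᵘ-homo-+ (fromℤ x) (fromℤ y) ⟨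
      toℚᵘ (fromℤ x + fromℤ y)            ∎)
    where open ℚᵘₚ.≃-Reasoning

  fromℤ-* : ∀ x y → fromℤ (x ℤ.* y) ≡ fromℤ x * fromℤ y
  fromℤ-* x y = toℚᵘ-injective (begin
      toℚᵘ (fromℤ (x ℤ.* y))              ≈⟨ toℚᵘ-fromℤ (x ℤ.* y) ⟩
      mkℚᵘ x 0 ℚᵘ.* mkℚᵘ y 0              ≈⟨ ℚᵘₚ.*-cong (toℚᵘ-fromℤ x) (toℚᵘ-fromℤ y) ⟨
      toℚᵘ (fromℤ x) ℚᵘ.* toℚᵘ (fromℤ y)  ≈⟨ toℚᵘ-homo-* (fromℤ x) (fromℤ y) ⟨
      toℚᵘ (fromℤ x * fromℤ y)            ∎)
    where open ℚᵘₚ.≃-Reasoning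

  fromℤ-neg : ∀ x → fromℤ (ℤ.- x) ≡ - fromℤ x
  fromℤ-neg x = toℚᵘ-injective (begin
      toℚᵘ (fromℤ (ℤ.- x))  ≈⟨ toℚᵘ-fromℤ (ℤ.- x) ⟩
      ℚᵘ.- mkℚᵘ x 0         ≈⟨ ℚᵘₚ.-‿cong (toℚᵘ-fromℤ x) ⟨
      ℚᵘ.- toℚᵘ (fromℤ x)   ≈⟨ toℚᵘ-homo‿- (fromℤ x) ⟨
      toℚᵘ (- fromℤ x)      ∎)
    where open ℚᵘₚ.≃-Reasoning

  fromℤ-injective : ∀ {x y} → fromℤ x ≡ fromℤ y → x ≡ y
  fromℤ-injective {x} {y} eq
    with *≡* h ← ℚᵘₚ.≃-trans (ℚᵘₚ.≃-sym (toℚᵘ-fromℤ x)) (ℚᵘₚ.≃-trans (ℚᵘₚ.≃-reflexive (cong toℚᵘ eq)) (toℚᵘ-fromℤ y))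
    = trans (sym (ℤₚ.*-identityʳ x)) (trans h (ℤₚ.*-identityʳ y))

  fromℤ-mono-≤ : ∀ {x y} → x ℤ.≤ y → fromℤ x ≤ fromℤ y
  fromℤ-mono-≤ {x} {y} x≤y = toℚᵘ-cancel-≤
    (ℚᵘₚ.≤-respʳ-≃ (ℚᵘₚ.≃-sym (toℚᵘ-fromℤ y))
      (ℚᵘₚ.≤-respˡ-≃ (ℚᵘₚ.≃-sym (toℚᵘ-fromℤ x))
        (ℚᵘ.*≤* (subst₂ ℤ._≤_ (sym (ℤₚ.*-identityʳ x)) (sym (ℤₚ.*-identityʳ y)) x≤y))))

  fromℤ-cancel-< : ∀ {x y} → fromℤ x < fromℤ y → x ℤ.< y
  fromℤ-cancel-< {x} {y} x<y = ℤₚ.≰⇒> λ y≤x → <-irrefl refl (<-≤-trans x<y (fromℤ-mono-≤ y≤x))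

  fromℤ-mono-< : ∀ {x y} → x ℤ.< y → fromℤ x < fromℤ y
  fromℤ-mono-< {x} {y} x<y = toℚᵘ-cancel-<
    (ℚᵘₚ.<-respʳ-≃ (ℚᵘₚ.≃-sym (toℚᵘ-fromℤ y))
      (ℚᵘₚ.<-respˡ-≃ (ℚᵘₚ.≃-sym (toℚᵘ-fromℤ x))
        (*<* (subst₂ ℤ._<_ (sym (ℤₚ.*-identityʳ x)) (sym (ℤₚ.*-identityʳ y)) x<y))))

  IsInteger : ℚ → Set
  IsInteger x = ∃[ z ] x ≡ fromℤ z

  integer : ∀ z → IsInteger (fromℤ z)
  integer z = z , refl

  integer-+ : ∀ {x y} → IsInteger x → IsInteger y → IsInteger (x + y)
  integer-+ (a , p) (b , q) = a ℤ.+ b , trans (cong₂ _+_ p q) (sym (fromℤ-+ a b))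

  integer-* : ∀ {x y} → IsInteger x → IsInteger y → IsInteger (x * y)
  integer-* (a , p) (b , q) = a ℤ.* b , trans (cong₂ _*_ p q) (sym (fromℤ-* a b))

  integer-neg : ∀ {x} → IsInteger x → IsInteger (- x)
  integer-neg (a , p) = ℤ.- a , trans (cong -_ p) (sym (fromℤ-neg a))

  integer-- : ∀ {x y} → IsInteger x → IsInteger y → IsInteger (x - y)
  integer-- p q = integer-+ p (integer-neg q)

  denominator-clears : ∀ x → fromℤ (↧ x) * x ≡ fromℤ (↥ x)
  denominator-clears x = toℚᵘ-injective (begin
      toℚᵘ (fromℤ (↧ x) * x)          ≈⟨ toℚᵘ-homo-* (fromℤ (↧ x)) x ⟩
      toℚᵘ (fromℤ (↧ x)) ℚᵘ.* toℚᵘ x  ≈⟨ ℚᵘₚ.*-congʳ (toℚᵘ-fromℤ (↧ x)) ⟩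
      mkℚᵘ (↧ x) 0 ℚᵘ.* toℚᵘ x        ≈⟨ lemma x ⟩
      mkℚᵘ (↥ x) 0                    ≈⟨ toℚᵘ-fromℤ (↥ x) ⟨
      toℚᵘ (fromℤ (↥ x))              ∎)
    where
    open ℚᵘₚ.≃-Reasoning
    lemma : ∀ x → mkℚᵘ (↧ x) 0 ℚᵘ.* toℚᵘ x ≃ᵘ mkℚᵘ (↥ x) 0
    lemma (mkℚ n d-1 _) = *≡* (trans (ℤₚ.*-identityʳ _)
      (trans (ℤₚ.*-comm (+ suc d-1) n) (cong (λ k → n ℤ.* + k) (sym (ℕₚ.+-identityʳ (suc d-1))))))

  -- Each term of the sequence is divisible by the denominator of x, and the
  -- quotients again form a geometric sequence of ratio x: infinite descent.
  geometric-integer-ratio : ∀ x (a : ℕ → ℤ) → a 0 ≢ + 0 →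
    (∀ m → fromℤ (a (suc m)) ≡ x * fromℤ (a m)) → IsInteger x
  geometric-integer-ratio (mkℚ n zero cop) _ _ _ =
    n , trans (sym (*-identityˡ (mkℚ n zero cop))) (denominator-clears (mkℚ n zero cop))
  geometric-integer-ratio x@(mkℚ n (suc k) cop) a a≢0 h = contradiction 0ℚ (descent a (<-wellFounded _) a≢0 cross)
    where
    v = + suc (suc k)

    cross : ∀ m → v ℤ.* a (suc m) ≡ n ℤ.* a m
    cross m = fromℤ-injective (begin
      fromℤ (v ℤ.* a (suc m))           ≡⟨ fromℤ-* v (a (suc m)) ⟩
      fromℤ v * fromℤ (a (suc m))       ≡⟨ cong (fromℤ v *_) (h m) ⟩
      fromℤ v * (x * fromℤ (a m))       ≡⟨ *-assoc (fromℤ v) x (fromℤ (a m)) ⟨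
      fromℤ v * x * fromℤ (a m)         ≡⟨ cong (_* fromℤ (a m)) (denominator-clears x) ⟩
      fromℤ n * fromℤ (a m)             ≡⟨ fromℤ-* n (a m) ⟨
      fromℤ (n ℤ.* a m)                 ∎)
      where open ≡-Reasoning

    -- The codomain `¬ ℚ` encodes absurdity, as ℚ is inhabited by `0ℚ`.
    descent : ∀ (a : ℕ → ℤ) → Acc ℕ._<_ ℤ.∣ a 0 ∣ → a 0 ≢ + 0 →
      (∀ m → v ℤ.* a (suc m) ≡ n ℤ.* a m) → ¬ ℚ
    descent a (acc rec) a≢0 cross _ = descent a′ (rec smaller) a′≢0 cross′ 0ℚ
      where
      v∣a : ∀ m → v ∣ a m
      -- By `cross`, `v` divides `n * a m`; it is coprime to the numerator `n`.
      v∣a m = ∣ᵤ⇒∣ (coprime-divisor v n (a m) (Coprimality.sym (Coprimality.recompute cop))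
        (∣⇒∣ᵤ (divides (a (suc m)) (trans (sym (cross m)) (ℤₚ.*-comm v (a (suc m)))))))
      a′ : ℕ → ℤ
      a′ m = _∣_.quotient (v∣a m)
      a≡ : ∀ m → a m ≡ a′ m ℤ.* v
      a≡ m = _∣_.equality (v∣a m)
      a′≢0 : a′ 0 ≢ + 0
      a′≢0 eq = a≢0 (trans (a≡ 0) (cong (ℤ._* v) eq))
      cross′ : ∀ m → v ℤ.* a′ (suc m) ≡ n ℤ.* a′ m
      cross′ m = ℤₚ.*-cancelʳ-≡ (v ℤ.* a′ (suc m)) (n ℤ.* a′ m) v (begin
        v ℤ.* a′ (suc m) ℤ.* v    ≡⟨ ℤₚ.*-assoc v (a′ (suc m)) v ⟩
        v ℤ.* (a′ (suc m) ℤ.* v)  ≡⟨ cong (v ℤ.*_) (a≡ (suc m)) ⟨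
        v ℤ.* a (suc m)           ≡⟨ cross m ⟩
        n ℤ.* a m                 ≡⟨ cong (n ℤ.*_) (a≡ m) ⟩
        n ℤ.* (a′ m ℤ.* v)        ≡⟨ ℤₚ.*-assoc n (a′ m) v ⟨
        n ℤ.* a′ m ℤ.* v          ∎)
        where open ≡-Reasoning
      -- The denominator is at least 2 in this case, so division by it strictly shrinks a nonzero
      -- integer.
      smaller : ℤ.∣ a′ 0 ∣ ℕ.< ℤ.∣ a 0 ∣
      smaller = subst (ℤ.∣ a′ 0 ∣ ℕ.<_) (sym (trans (cong ℤ.∣_∣ (a≡ 0)) (ℤₚ.abs-* (a′ 0) v)))
        (ℕₚ.m<m*n ℤ.∣ a′ 0 ∣ (suc (suc k)) {{ℕ.≢-nonZero (a′≢0 ∘ ℤₚ.∣i∣≡0⇒i≡0)}} (ℕ.s≤s (ℕ.s≤s ℕ.z≤n)))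

  -- Multiplied by the square of the denominator of x, all powers of x are integers.
  rational-root : ∀ (b c d : ℤ) x → x * x * x + fromℤ b * (x * x) + fromℤ c * x + fromℤ d ≡ 0ℚ → IsInteger x
  rational-root b c d x root = geometric-integer-ratio x (λ m → proj₁ (scaled m)) base
      (λ m → trans (sym (proj₂ (scaled (suc m)))) (trans (rearrange m) (cong (x *_) (proj₂ (scaled m)))))
    where
    v = fromℤ (↧ x)
    power : ℕ → ℚ
    power zero = 1ℚ
    power (suc m) = x * power m

    -- The square of the denominator clears `x` and `x²`; the monic equation expresses every later
    -- power through the three preceding ones with integer coefficients.
    scaled : ∀ m → IsInteger (v * v * power m)
    scaled 0 = integer-* (integer-* (integer (↧ x)) (integer (↧ x))) (integer (+ 1))
    scaled 1 = subst IsInteger (solve 2 (λ v x → v :* (v :* x) := v :* v :* (x :* con 1ℚ)) refl v x)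
      (integer-* (integer (↧ x)) (↥ x , denominator-clears x))
    scaled 2 = subst IsInteger (solve 2 (λ v x → v :* x :* (v :* x) := v :* v :* (x :* (x :* con 1ℚ))) refl v x)
      (integer-* (↥ x , denominator-clears x) (↥ x , denominator-clears x))
    scaled (suc (suc (suc m))) = subst IsInteger eq
      (integer-neg (integer-+ (integer-+ (integer-* (integer b) (scaled (suc (suc m))))
        (integer-* (integer c) (scaled (suc m)))) (integer-* (integer d) (scaled m))))
      where
      open ≡-Reasoning
      B = fromℤ b
      C = fromℤ c
      D = fromℤ d
      p = power m
      eq = begin
        - (B * (v * v * (x * (x * p))) + C * (v * v * (x * p)) + D * (v * v * p))
          ≡⟨ solve 6 (λ B C D v x p →
               :- (B :* (v :* v :* (x :* (x :* p))) :+ C :* (v :* v :* (x :* p)) :+ D :* (v :* v :* p))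
               := v :* v :* (x :* (x :* (x :* p))) :- v :* v :* p :* (x :* x :* x :+ B :* (x :* x) :+ C :* x :+ D))
               refl B C D v x p ⟩
        v * v * (x * (x * (x * p))) - v * v * p * (x * x * x + B * (x * x) + C * x + D)
          ≡⟨ cong (λ z → v * v * (x * (x * (x * p))) - v * v * p * z) root ⟩
        v * v * (x * (x * (x * p))) - v * v * p * 0ℚ
          ≡⟨ solve 3 (λ v x p → v :* v :* (x :* (x :* (x :* p))) :- v :* v :* p :* con 0ℚ
               := v :* v :* (x :* (x :* (x :* p)))) refl v x p ⟩
        v * v * (x * (x * (x * p))) ∎

    rearrange : ∀ m → v * v * (x * power m) ≡ x * (v * v * power m)
    rearrange m = solve 3 (λ v x p → v :* v :* (x :* p) := x :* (v :* v :* p)) refl v x (power m)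
    base : ↧ x ℤ.* ↧ x ℤ.* + 1 ≢ + 0
    base ()

-- Constructive order and algebra of Cauchy reals.

module Reals where
  open import Data.Nat using (_⊔_)
  open RationalArithmetic

  p<q⇒0<q-p : ∀ {p q} → p < q → 0ℚ < q - p
  p<q⇒0<q-p {p} {q} lt = subst (_< q - p) (+-inverseʳ p) (+-monoˡ-< (- p) lt)

  0<q-p⇒p<q : ∀ {p q} → 0ℚ < q - p → p < q
  0<q-p⇒p<q {p} {q} h = subst₂ _<_ (+-identityˡ p) (solve 2 (λ p q → q :- p :+ p := q) refl p q) (+-monoˡ-< p h)

  p≤q⇒0≤q-p : ∀ {p q} → p ≤ q → 0ℚ ≤ q - p
  p≤q⇒0≤q-p {p} {q} le = subst (_≤ q - p) (+-inverseʳ p) (+-monoˡ-≤ (- p) le)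

  0≤q-p⇒p≤q : ∀ {p q} → 0ℚ ≤ q - p → p ≤ q
  0≤q-p⇒p≤q {p} {q} h = subst₂ _≤_ (+-identityˡ p) (solve 2 (λ p q → q :- p :+ p := q) refl p q) (+-monoˡ-≤ p h)

  0<-+ : ∀ {p q} → 0ℚ < p → 0ℚ < q → 0ℚ < p + q
  0<-+ = +-mono-<

  0<-* : ∀ {p q} → 0ℚ < p → 0ℚ < q → 0ℚ < p * q
  0<-* {p} {q} hp hq = positive⁻¹ (p * q) {{pos*pos⇒pos p {{positive hp}} q {{positive hq}}}}

  0<½* : ∀ {p} → 0ℚ < p → 0ℚ < ½ * p
  0<½* = 0<-* (positive⁻¹ ½)

  ∣p∣<-intro : ∀ {p r} → - r < p → p < r → ∣ p ∣ < r
  ∣p∣<-intro {p} {r} lo hi with ∣p∣≡p∨∣p∣≡-p p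
  ... | inj₁ eq = subst (_< r) (sym eq) hi
  ... | inj₂ eq = subst₂ _<_ (sym eq) (solve 1 (λ r → :- (:- r) := r) refl r) (neg-antimono-< lo)

  p≤∣p∣ : ∀ p → p ≤ ∣ p ∣
  p≤∣p∣ p with ∣p∣≡p∨∣p∣≡-p p
  ... | inj₁ eq = ≤-reflexive (sym eq)
  ... | inj₂ eq with ≤-total 0ℚ p
  ...   | inj₁ 0≤p = ≤-reflexive (sym (0≤p⇒∣p∣≡p 0≤p))
  ...   | inj₂ p≤0 = ≤-trans p≤0 (0≤∣p∣ p)

  ∣p∣<-upper : ∀ {p r} → ∣ p ∣ < r → p < r
  ∣p∣<-upper {p} = ≤-<-trans (p≤∣p∣ p)

  Null : (ℕ → ℚ) → Set
  Null x = ∀ ε → 0ℚ < ε → ∃[ N ] (∀ n → N ℕ.≤ n → ∣ x n ∣ < ε)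

  null-resp : ∀ {x y} → (∀ n → x n ≡ y n) → Null x → Null y
  null-resp eq h ε 0<ε with N , g ← h ε 0<ε = N , λ n p → subst (λ z → ∣ z ∣ < ε) (eq n) (g n p)

  null-+ : ∀ {x y} → Null x → Null y → Null (λ n → x n + y n)
  null-+ {x} {y} hx hy ε 0<ε with M , gx ← hx (½ * ε) (0<½* 0<ε) | N , gy ← hy (½ * ε) (0<½* 0<ε) =
    M ⊔ N , λ n p → ≤-<-trans (∣p+q∣≤∣p∣+∣q∣ (x n) (y n))
      (subst (∣ x n ∣ + ∣ y n ∣ <_) (solve 1 (λ e → con ½ :* e :+ con ½ :* e := e) refl ε)
        (+-mono-< (gx n (ℕₚ.m⊔n≤o⇒m≤o M N p)) (gy n (ℕₚ.m⊔n≤o⇒n≤o M N p))))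

  null-neg : ∀ {x} → Null x → Null (λ n → - x n)
  null-neg {x} hx ε 0<ε with N , g ← hx ε 0<ε = N , λ n p → subst (_< ε) (sym (∣-p∣≡∣p∣ (x n))) (g n p)

  eventually-bounded : ∀ (x : ℝ) → ∃[ B ] 0ℚ < B × ∃[ N ] (∀ n → N ℕ.≤ n → ∣ seq x n ∣ < B)
  eventually-bounded x with N , h ← cauchy x 1ℚ (positive⁻¹ 1ℚ) =
    1ℚ + ∣ seq x N ∣ , +-mono-<-≤ (positive⁻¹ 1ℚ) (0≤∣p∣ (seq x N)) , N , λ n p →
      subst (λ z → ∣ z ∣ < 1ℚ + ∣ seq x N ∣)
        (solve 2 (λ a b → (a :- b) :+ b := a) refl (seq x n) (seq x N))
        (≤-<-trans (∣p+q∣≤∣p∣+∣q∣ (seq x n - seq x N) (seq x N))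
          (+-monoˡ-< ∣ seq x N ∣ (h n N p ℕₚ.≤-refl)))

  fraction : ∀ {B ε} → 0ℚ < B → 0ℚ < ε → ∃[ δ ] 0ℚ < δ × B * δ ≡ ε
  fraction {B} {ε} 0<B 0<ε = 1/ B * ε , 0<-* (positive⁻¹ (1/ B) {{1/pos⇒pos B}}) 0<ε ,
      trans (sym (*-assoc B (1/ B) ε)) (trans (cong (_* ε) (*-inverseʳ B)) (*-identityˡ ε))
    where
    instance
      B-positive : Positive B
      B-positive = positive 0<B
      B-nonZero : NonZero B
      B-nonZero = pos⇒nonZero B

  ∣p*q∣< : ∀ {B δ} p q → 0ℚ < B → ∣ p ∣ < B → ∣ q ∣ < δ → ∣ p * q ∣ < B * δ
  ∣p*q∣< {B} {δ} p q 0<B p<B q<δ = begin-strict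
      ∣ p * q ∣      ≡⟨ ∣p*q∣≡∣p∣*∣q∣ p q ⟩
      ∣ p ∣ * ∣ q ∣  ≤⟨ *-monoʳ-≤-nonNeg ∣ q ∣ {{nonNegative (0≤∣p∣ q)}} (<⇒≤ p<B) ⟩
      B * ∣ q ∣      <⟨ *-monoʳ-<-pos B {{positive 0<B}} q<δ ⟩
      B * δ          ∎
    where open ≤-Reasoning

  null-* : ∀ (x : ℝ) {y} → Null y → Null (λ n → seq x n * y n)
  null-* x {y} hy ε 0<ε =
    let B , 0<B , M , x<B = eventually-bounded x
        δ , 0<δ , Bδ≡ε = fraction 0<B 0<ε
        N , g = hy δ 0<δ
    in M ⊔ N , λ n p → subst (∣ seq x n * y n ∣ <_) Bδ≡ε
      (∣p*q∣< (seq x n) (y n) 0<B (x<B n (ℕₚ.m⊔n≤o⇒m≤o M N p)) (g n (ℕₚ.m⊔n≤o⇒n≤o M N p)))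

  null⇒≈ : ∀ {x y} → Null (λ n → seq x n - seq y n) → x ≈ᴿ y
  null⇒≈ h = mk≈ h

  ≈⇒null : ∀ {x y} → x ≈ᴿ y → Null (λ n → seq x n - seq y n)
  ≈⇒null = close

  null-0 : Null (λ _ → 0ℚ)
  null-0 ε 0<ε = 0 , λ _ _ → 0<ε

  pointwise : ∀ {x y} → (∀ n → seq x n ≡ seq y n) → x ≈ᴿ y
  pointwise {x} {y} eq = null⇒≈ (null-resp (λ n → sym (trans (cong (_- seq y n) (eq n)) (+-inverseʳ (seq y n)))) null-0)

  ≈-refl : ∀ {x} → x ≈ᴿ x
  ≈-refl = pointwise λ _ → refl

  ≈-sym : ∀ {x y} → x ≈ᴿ y → y ≈ᴿ x
  ≈-sym {x} {y} h = null⇒≈ (null-resp (λ n → solve 2 (λ a b → :- (a :- b) := b :- a) refl (seq x n) (seq y n)) (null-neg (≈⇒null h)))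

  ≈-trans : ∀ {x y z} → x ≈ᴿ y → y ≈ᴿ z → x ≈ᴿ z
  ≈-trans {x} {y} {z} h k = null⇒≈ (null-resp
    (λ n → solve 3 (λ a b c → (a :- b) :+ (b :- c) := a :- c) refl (seq x n) (seq y n) (seq z n))
    (null-+ (≈⇒null h) (≈⇒null k)))

  -- Congruences modulo the ideal generated by null sequences: q is the cofactor
  -- of the vanishing real h.
  modulo : ∀ {x y h} → h ≈ᴿ 0ᴿ → (q : ℝ) → (∀ n → seq x n ≡ seq y n + seq q n * seq h n) → x ≈ᴿ y
  modulo {x} {y} {h} h≈0 q eq = null⇒≈ (null-resp
    (λ n → sym (trans (cong (_- seq y n) (eq n))
      (solve 3 (λ y q h → y :+ q :* h :- y := q :* (h :- con 0ℚ)) refl (seq y n) (seq q n) (seq h n))))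
    (null-* q (≈⇒null h≈0)))

  modulo₂ : ∀ {x y h k} → h ≈ᴿ 0ᴿ → (q : ℝ) → k ≈ᴿ 0ᴿ → (r : ℝ) →
    (∀ n → seq x n ≡ seq y n + seq q n * seq h n + seq r n * seq k n) → x ≈ᴿ y
  modulo₂ {y = y} {h = h} h≈0 q k≈0 r eq = ≈-trans (modulo {y = y +ᴿ q *ᴿ h} k≈0 r eq) (modulo h≈0 q λ _ → refl)

  -≈0 : ∀ {x y} → x ≈ᴿ y → x +ᴿ -ᴿ y ≈ᴿ 0ᴿ
  -≈0 {x} {y} h = null⇒≈ (null-resp (λ n → sym (+-identityʳ (seq x n - seq y n))) (≈⇒null h))

  +-cong : ∀ {x y u v} → x ≈ᴿ y → u ≈ᴿ v → x +ᴿ u ≈ᴿ y +ᴿ v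
  +-cong {x} {y} {u} {v} p q = modulo₂ (-≈0 p) 1ᴿ (-≈0 q) 1ᴿ λ n →
    solve 4 (λ x y u v → x :+ u := y :+ v :+ con 1ℚ :* (x :- y) :+ con 1ℚ :* (u :- v)) refl (seq x n) (seq y n) (seq u n) (seq v n)

  neg-cong : ∀ {x y} → x ≈ᴿ y → -ᴿ x ≈ᴿ -ᴿ y
  neg-cong {x} {y} p = modulo (-≈0 p) (-ᴿ 1ᴿ) λ n →
    solve 2 (λ x y → :- x := :- y :+ :- con 1ℚ :* (x :- y)) refl (seq x n) (seq y n)

  *-cong : ∀ {x y u v} → x ≈ᴿ y → u ≈ᴿ v → x *ᴿ u ≈ᴿ y *ᴿ v
  *-cong {x} {y} {u} {v} p q = modulo₂ (-≈0 p) u (-≈0 q) y λ n →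
    solve 4 (λ x y u v → x :* u := y :* v :+ u :* (x :- y) :+ y :* (u :- v)) refl (seq x n) (seq y n) (seq u n) (seq v n)

  *-vanishes : ∀ {x} y → x ≈ᴿ 0ᴿ → y *ᴿ x ≈ᴿ 0ᴿ
  *-vanishes {x} y p = modulo p y λ n → solve 2 (λ y x → y :* x := con 0ℚ :+ y :* x) refl (seq y n) (seq x n)

  record Pos (x : ℝ) : Set where
    constructor mkPos
    field
      bound   : ℚ
      0<bound : 0ℚ < bound
      above   : ∃[ N ] (∀ n → N ℕ.≤ n → bound < seq x n)

  -- A refutation rather than a witness: squares and products of nonnegative reals then qualify
  -- although signs cannot be decided.
  record NonNeg (x : ℝ) : Set where
    constructor mkNonNeg
    field not-neg : ¬ Pos (-ᴿ x)

  open NonNeg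

  <⇒Pos : ∀ {x y} → x <ᴿ y → Pos (y +ᴿ -ᴿ x)
  <⇒Pos {x} {y} (mk< q 0<q (N , h)) = mkPos q 0<q (N , λ n p → 0<q-p⇒p<q (subst (0ℚ <_)
    (solve 3 (λ x y q → y :- (x :+ q) := y :- x :- q) refl (seq x n) (seq y n) q) (p<q⇒0<q-p (h n p))))

  Pos⇒< : ∀ {x y} → Pos (y +ᴿ -ᴿ x) → x <ᴿ y
  Pos⇒< {x} {y} (mkPos q 0<q (N , h)) = mk< q 0<q (N , λ n p → 0<q-p⇒p<q (subst (0ℚ <_)
    (solve 3 (λ x y q → y :- x :- q := y :- (x :+ q)) refl (seq x n) (seq y n) q) (p<q⇒0<q-p (h n p))))

  pos-resp : ∀ {x y} → x ≈ᴿ y → Pos x → Pos y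
  pos-resp {x} {y} x≈y (mkPos q 0<q (M , h)) with N , g ← close x≈y (½ * q) (0<½* 0<q) =
    mkPos (½ * q) (0<½* 0<q) (M ⊔ N , λ n p → 0<q-p⇒p<q (subst (0ℚ <_)
      (solve 3 (λ x y q → (x :- q) :+ (con ½ :* q :- (x :- y)) := y :- con ½ :* q) refl (seq x n) (seq y n) q)
      (0<-+ (p<q⇒0<q-p (h n (ℕₚ.m⊔n≤o⇒m≤o M N p))) (p<q⇒0<q-p (∣p∣<-upper (g n (ℕₚ.m⊔n≤o⇒n≤o M N p)))))))

  nonNeg-resp : ∀ {x y} → x ≈ᴿ y → NonNeg x → NonNeg y
  nonNeg-resp x≈y h = mkNonNeg λ p → not-neg h (pos-resp (neg-cong (≈-sym x≈y)) p)

  pos-* : ∀ {x y} → Pos x → Pos y → Pos (x *ᴿ y)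
  pos-* {x} {y} (mkPos q 0<q (M , h)) (mkPos r 0<r (N , g)) = mkPos (q * r) (0<-* 0<q 0<r) (M ⊔ N , λ n p →
    let q<x = h n (ℕₚ.m⊔n≤o⇒m≤o M N p)
        r<y = g n (ℕₚ.m⊔n≤o⇒n≤o M N p)
    in 0<q-p⇒p<q (subst (0ℚ <_)
      (solve 4 (λ x y q r → (x :- q) :* (y :- r) :+ q :* (y :- r) :+ (x :- q) :* r := x :* y :- q :* r) refl (seq x n) (seq y n) q r)
      (0<-+ (0<-+ (0<-* (p<q⇒0<q-p q<x) (p<q⇒0<q-p r<y)) (0<-* 0<q (p<q⇒0<q-p r<y))) (0<-* (p<q⇒0<q-p q<x) 0<r))))

  -- From `N` on, `y` stays within `q/4` of `seq y N`. If that rational were below `-q/4`, then `-y`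
  -- would be positive; otherwise `y` exceeds `-q/2` eventually, which leaves `q/2` for the sum.
  pos-nonNeg-+ : ∀ {x y} → Pos x → NonNeg y → Pos (x +ᴿ y)
  pos-nonNeg-+ {x} {y} (mkPos q 0<q (M , h)) y≥0
    with N , g ← cauchy y (½ * (½ * q)) (0<½* (0<½* 0<q)) with seq y N <? - (½ * (½ * q))
  ... | yes y<0 = contradiction
    (mkPos (- (½ * (½ * q)) - seq y N) (p<q⇒0<q-p y<0) (N , λ n p → 0<q-p⇒p<q (subst (0ℚ <_)
      (solve 3 (λ y z q → con ½ :* (con ½ :* q) :- (y :- z) := :- y :- (:- (con ½ :* (con ½ :* q)) :- z)) refl (seq y n) (seq y N) q)
      (p<q⇒0<q-p (∣p∣<-upper (g n N p ℕₚ.≤-refl))))))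
    (not-neg y≥0)
  ... | no y≮0 = mkPos (½ * q) (0<½* 0<q) (M ⊔ N , λ n p → 0<q-p⇒p<q (subst (0ℚ <_)
      (solve 4 (λ x y z q → (x :- q) :+ ((con ½ :* (con ½ :* q) :- (z :- y)) :+ (z :- :- (con ½ :* (con ½ :* q)))) := x :+ y :- con ½ :* q)
        refl (seq x n) (seq y n) (seq y N) q)
      (0<-+ (p<q⇒0<q-p (h n (ℕₚ.m⊔n≤o⇒m≤o M N p)))
        (+-mono-<-≤ (p<q⇒0<q-p (∣p∣<-upper (g N n ℕₚ.≤-refl (ℕₚ.m⊔n≤o⇒n≤o M N p)))) (p≤q⇒0≤q-p (≮⇒≥ y≮0))))))
  -- The decidable comparison of the rational `seq x N` with `±ε/2` replaces that of `x` with 0: if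
  -- it lies outside, one of `x` and `-x` has a positive lower bound, and if inside, the tail of `x`
  -- is smaller than `ε`.
  trichotomy : ∀ {x} → ¬ Pos x → ¬ Pos (-ᴿ x) → x ≈ᴿ 0ᴿ
  trichotomy {x} x≯0 x≮0 = null⇒≈ (null-resp (λ n → sym (+-identityʳ (seq x n))) null)
    where
    null : Null (seq x)
    null ε 0<ε with N , g ← cauchy x (½ * ε) (0<½* 0<ε) with ½ * ε <? seq x N | ½ * ε <? - seq x N
    ... | yes hi | _ = contradiction
      (mkPos (seq x N - ½ * ε) (p<q⇒0<q-p hi) (N , λ n p → 0<q-p⇒p<q (subst (0ℚ <_)
        (solve 3 (λ x y e → con ½ :* e :- (y :- x) := x :- (y :- con ½ :* e)) refl (seq x n) (seq x N) ε)
        (p<q⇒0<q-p (∣p∣<-upper (g N n ℕₚ.≤-refl p))))))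
      x≯0
    ... | no _ | yes lo = contradiction
      (mkPos (- seq x N - ½ * ε) (p<q⇒0<q-p lo) (N , λ n p → 0<q-p⇒p<q (subst (0ℚ <_)
        (solve 3 (λ x y e → con ½ :* e :- (x :- y) := :- x :- (:- y :- con ½ :* e)) refl (seq x n) (seq x N) ε)
        (p<q⇒0<q-p (∣p∣<-upper (g n N p ℕₚ.≤-refl))))))
      x≮0
    ... | no ≯ | no ≮ = N , λ n p → subst₂ _<_
        (cong ∣_∣ (solve 2 (λ a b → (a :- b) :+ b := a) refl (seq x n) (seq x N)))
        (solve 1 (λ e → con ½ :* e :+ con ½ :* e := e) refl ε)
        (≤-<-trans (∣p+q∣≤∣p∣+∣q∣ (seq x n - seq x N) (seq x N))
          (+-mono-<-≤ (g n N p ℕₚ.≤-refl) (∣p∣≤ (seq x N) (≮⇒≥ ≯) (≮⇒≥ ≮))))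
      where
      ∣p∣≤ : ∀ p {r} → p ≤ r → - p ≤ r → ∣ p ∣ ≤ r
      ∣p∣≤ p {r} hi lo with ∣p∣≡p∨∣p∣≡-p p
      ... | inj₁ eq = subst (_≤ r) (sym eq) hi
      ... | inj₂ eq = subst (_≤ r) (sym eq) lo

  pos-fromℚ : ∀ {q} → 0ℚ < q → Pos (fromℚᴿ q)
  pos-fromℚ {q} 0<q = mkPos (½ * q) (0<½* 0<q) (0 , λ _ _ → 0<q-p⇒p<q
    (subst (0ℚ <_) (solve 1 (λ q → con ½ :* q := q :- con ½ :* q) refl q) (0<½* 0<q)))

  pos-fromℚ⁻¹ : ∀ {q} → Pos (fromℚᴿ q) → 0ℚ < q
  pos-fromℚ⁻¹ (mkPos r 0<r (N , h)) = <-trans 0<r (h N ℕₚ.≤-refl)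

  fromℚ-injective : ∀ {p q} → fromℚᴿ p ≈ᴿ fromℚᴿ q → p ≡ q
  fromℚ-injective {p} {q} h with <-cmp p q
  ... | tri< lt _ _ = contradiction (pos-fromℚ⁻¹ (pos-resp (≈-trans (pointwise λ _ → refl) (-≈0 (≈-sym h))) (pos-fromℚ (p<q⇒0<q-p lt)))) (<-irrefl refl)
  ... | tri≈ _ p≡q _ = p≡q
  ... | tri> _ _ gt = contradiction (pos-fromℚ⁻¹ (pos-resp (≈-trans (pointwise λ _ → refl) (-≈0 h)) (pos-fromℚ (p<q⇒0<q-p gt)))) (<-irrefl refl)

  ¬pos-0 : ∀ {x} → x ≈ᴿ 0ᴿ → ¬ Pos x
  ¬pos-0 x≈0 p = <-irrefl refl (pos-fromℚ⁻¹ (pos-resp x≈0 p))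

  pos-+ : ∀ {x y} → Pos x → Pos y → Pos (x +ᴿ y)
  pos-+ {x} {y} (mkPos q 0<q (M , h)) (mkPos r 0<r (N , g)) = mkPos (q + r) (0<-+ 0<q 0<r) (M ⊔ N , λ n p →
    +-mono-< (h n (ℕₚ.m⊔n≤o⇒m≤o M N p)) (g n (ℕₚ.m⊔n≤o⇒n≤o M N p)))

  pos-neg-⊥ : ∀ {x} → Pos x → ¬ Pos (-ᴿ x)
  pos-neg-⊥ {x} p q = ¬pos-0 (pointwise λ n → +-inverseʳ (seq x n)) (pos-+ p q)

  pos⇒nonNeg : ∀ {x} → Pos x → NonNeg x
  pos⇒nonNeg p = mkNonNeg (pos-neg-⊥ p)

  pos⇒≉0 : ∀ {x} → Pos x → ¬ x ≈ᴿ 0ᴿ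
  pos⇒≉0 p h = ¬pos-0 h p

  neg-neg : ∀ x → -ᴿ (-ᴿ x) ≈ᴿ x
  neg-neg x = pointwise λ n → solve 1 (λ x → :- (:- x) := x) refl (seq x n)

  nonNeg-+ : ∀ {x y} → NonNeg x → NonNeg y → NonNeg (x +ᴿ y)
  nonNeg-+ {x} {y} hx hy = mkNonNeg λ p → not-neg hy (pos-resp
    (pointwise λ n → solve 2 (λ x y → :- (x :+ y) :+ x := :- y) refl (seq x n) (seq y n)) (pos-nonNeg-+ p hx))

  nonNeg-0 : ∀ {x} → x ≈ᴿ 0ᴿ → NonNeg x
  nonNeg-0 {x} h = mkNonNeg (¬pos-0 (≈-trans (neg-cong h) (pointwise λ _ → refl)))

  nonNeg-* : ∀ {x y} → NonNeg x → NonNeg y → NonNeg (x *ᴿ y)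
  nonNeg-* {x} {y} hx hy = mkNonNeg λ p → x≯0⇒⊥ p λ x>0 → y≯0⇒⊥ p λ y>0 → pos-neg-⊥ (pos-* x>0 y>0) p
    where
    x≯0⇒⊥ : Pos (-ᴿ (x *ᴿ y)) → ¬ ¬ Pos x
    x≯0⇒⊥ p x≯0 = ¬pos-0 (modulo (trichotomy x≯0 (not-neg hx)) (-ᴿ y) λ n →
      solve 2 (λ x y → :- (x :* y) := con 0ℚ :+ :- y :* x) refl (seq x n) (seq y n)) p
    y≯0⇒⊥ : Pos (-ᴿ (x *ᴿ y)) → ¬ ¬ Pos y
    y≯0⇒⊥ p y≯0 = ¬pos-0 (modulo (trichotomy y≯0 (not-neg hy)) (-ᴿ x) λ n →
      solve 2 (λ x y → :- (x :* y) := con 0ℚ :+ :- x :* y) refl (seq x n) (seq y n)) p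

  nonNeg-fromℚ : ∀ {q} → 0ℚ ≤ q → NonNeg (fromℚᴿ q)
  nonNeg-fromℚ 0≤q = mkNonNeg λ p → <-irrefl refl (<-≤-trans (below-0 p) (neg-antimono-≤ 0≤q))
    where
    below-0 : ∀ {q} → Pos (-ᴿ (fromℚᴿ q)) → 0ℚ < - q
    below-0 (mkPos r 0<r (N , h)) = <-trans 0<r (h N ℕₚ.≤-refl)

  nonNeg-square : ∀ x → NonNeg (x *ᴿ x)
  nonNeg-square x = mkNonNeg λ p → x≉0 p (trichotomy
      (λ x>0 → pos-neg-⊥ (pos-* x>0 x>0) p)
      (λ x<0 → pos-neg-⊥ (pos-resp (pointwise λ n → solve 1 (λ x → :- x :* :- x := x :* x) refl (seq x n)) (pos-* x<0 x<0)) p))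
    where
    x≉0 : Pos (-ᴿ (x *ᴿ x)) → ¬ x ≈ᴿ 0ᴿ
    x≉0 p x≈0 = not-neg (nonNeg-0 (*-vanishes x x≈0)) p

  -- By `trichotomy`, vanishing is the conjunction of two refutations. Classical case distinctions
  -- are therefore available whenever the goal is an equality of reals.
  ≈0-stable : ∀ {x} → ¬ ¬ x ≈ᴿ 0ᴿ → x ≈ᴿ 0ᴿ
  ≈0-stable h = trichotomy (λ p → h (pos⇒≉0 p)) (λ p → h λ x≈0 → ¬pos-0 (≈-trans (neg-cong x≈0) (pointwise λ _ → refl)) p)

  ≈-stable : ∀ {x y} → ¬ ¬ x ≈ᴿ y → x ≈ᴿ y
  ≈-stable {x} {y} h = modulo (≈0-stable λ ne → h (ne ∘ -≈0)) 1ᴿ λ n →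
    solve 2 (λ x y → x := y :+ con 1ℚ :* (x :- y)) refl (seq x n) (seq y n)

  integral-domain : ∀ {x y} → x *ᴿ y ≈ᴿ 0ᴿ → ¬ x ≈ᴿ 0ᴿ → y ≈ᴿ 0ᴿ
  integral-domain {x} {y} xy≈0 x≉0 = ≈0-stable λ y≉0 → x≉0 (trichotomy
      (λ x>0 → y≉0 (trichotomy
        (λ y>0 → pos⇒≉0 (pos-* x>0 y>0) xy≈0)
        (λ y<0 → pos⇒≉0 (pos-* x>0 y<0) (zero₁ λ n → solve 2 (λ x y → x :* :- y := con 0ℚ :+ :- con 1ℚ :* (x :* y)) refl (seq x n) (seq y n)))))
      (λ x<0 → y≉0 (trichotomy
        (λ y>0 → pos⇒≉0 (pos-* x<0 y>0) (zero₁ λ n → solve 2 (λ x y → :- x :* y := con 0ℚ :+ :- con 1ℚ :* (x :* y)) refl (seq x n) (seq y n)))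
        (λ y<0 → pos⇒≉0 (pos-* x<0 y<0) (modulo xy≈0 1ᴿ λ n → solve 2 (λ x y → :- x :* :- y := con 0ℚ :+ con 1ℚ :* (x :* y)) refl (seq x n) (seq y n))))))
    where
    zero₁ : ∀ {z} → (∀ n → seq z n ≡ 0ℚ + - 1ℚ * (seq x n * seq y n)) → z ≈ᴿ 0ᴿ
    zero₁ = modulo xy≈0 (-ᴿ 1ᴿ)

-- Polynomial identities in a cubic algebra.

module CubicForms where
  open RationalArithmetic

  cubicℚ : (b c d x : ℚ) → ℚ
  cubicℚ b c d x = x * x * x + b * (x * x) + c * x + d

  -- In ℚ[t]/(t³ + bt² + ct + d), the product of the conjugates of x + yt + zt²
  -- is adj₀ + adj₁t + adj₂t² and its trace, second symmetric function and norm
  -- are tr, e₂ and norm.  The determinant of 1, γ, γ² with respect to 1, t, t²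
  -- is the index form of γ.

  adj₀ adj₁ adj₂ norm tr e₂ : (b c d x y z : ℚ) → ℚ
  adj₀ b c d x y z = x * x - b * x * y + (b * b - c - c) * x * z + c * y * y - (b * c - d) * y * z + (c * c - b * d) * z * z
  adj₁ b c d x y z = b * y * y - x * y - b * b * y * z + (b * c - d) * z * z
  adj₂ b c d x y z = y * y - x * z - b * y * z + c * z * z
  norm b c d x y z = x * adj₀ b c d x y z
    + d * (b * z * adj₂ b c d x y z - z * adj₁ b c d x y z - y * adj₂ b c d x y z)
  tr b c d x y z = x + x + x - b * y + (b * b - c - c) * z
  e₂ b c d x y z = adj₀ b c d x y z + x * (tr b c d x y z - x) + d * (z * y + z * y - b * (z * z))

  indexForm : (b c d y z : ℚ) → ℚ
  indexForm b c d y z = y * y * y - (b + b) * (y * y * z) + (b * b + c) * (y * z * z) - (b * c - d) * (z * z * z)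

  -- Coordinates of a product, reduced by `t³ = -bt² - ct - d` and
  -- `t⁴ = (b² - c)t² + (bc - d)t + bd`.
  prod₀ prod₁ prod₂ : (b c d x y z x′ y′ z′ : ℚ) → ℚ
  prod₀ b c d x y z x′ y′ z′ = x * x′ - d * (y * z′ + z * y′) + b * d * (z * z′)
  prod₁ b c d x y z x′ y′ z′ = x * y′ + y * x′ - c * (y * z′ + z * y′) + (b * c - d) * (z * z′)
  prod₂ b c d x y z x′ y′ z′ = x * z′ + y * y′ + z * x′ - b * (y * z′ + z * y′) + (b * b - c) * (z * z′)

  -- The same forms once more, as syntax for the ring solver.
  module _ {n : ℕ} where
    :cubic : (b c d x : Polynomial n) → Polynomial n
    :cubic b c d x = x :* x :* x :+ b :* (x :* x) :+ c :* x :+ d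

    :adj₀ :adj₁ :adj₂ :norm :tr :e₂ : (b c d x y z : Polynomial n) → Polynomial n
    :adj₀ b c d x y z = x :* x :- b :* x :* y :+ (b :* b :- c :- c) :* x :* z :+ c :* y :* y :- (b :* c :- d) :* y :* z :+ (c :* c :- b :* d) :* z :* z
    :adj₁ b c d x y z = b :* y :* y :- x :* y :- b :* b :* y :* z :+ (b :* c :- d) :* z :* z
    :adj₂ b c d x y z = y :* y :- x :* z :- b :* y :* z :+ c :* z :* z
    :norm b c d x y z = x :* :adj₀ b c d x y z
      :+ d :* (b :* z :* :adj₂ b c d x y z :- z :* :adj₁ b c d x y z :- y :* :adj₂ b c d x y z)
    :tr b c d x y z = x :+ x :+ x :- b :* y :+ (b :* b :- c :- c) :* z
    :e₂ b c d x y z = :adj₀ b c d x y z :+ x :* (:tr b c d x y z :- x) :+ d :* (z :* y :+ z :* y :- b :* (z :* z))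

    :indexForm : (b c d y z : Polynomial n) → Polynomial n
    :indexForm b c d y z = y :* y :* y :- (b :+ b) :* (y :* y :* z) :+ (b :* b :+ c) :* (y :* z :* z) :- (b :* c :- d) :* (z :* z :* z)

    :prod₀ :prod₁ :prod₂ : (b c d x y z x′ y′ z′ : Polynomial n) → Polynomial n
    :prod₀ b c d x y z x′ y′ z′ = x :* x′ :- d :* (y :* z′ :+ z :* y′) :+ b :* d :* (z :* z′)
    :prod₁ b c d x y z x′ y′ z′ = x :* y′ :+ y :* x′ :- c :* (y :* z′ :+ z :* y′) :+ (b :* c :- d) :* (z :* z′)
    :prod₂ b c d x y z x′ y′ z′ = x :* z′ :+ y :* y′ :+ z :* x′ :- b :* (y :* z′ :+ z :* y′) :+ (b :* b :- c) :* (z :* z′)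

    :ev : (x y z a : Polynomial n) → Polynomial n
    :ev x y z a = x :+ y :* a :+ z :* (a :* a)

  evℚ : (x y z a : ℚ) → ℚ
  evℚ x y z a = x + y * a + z * (a * a)

  ev-prod : ∀ b c d x y z x′ y′ z′ a →
    evℚ x y z a * evℚ x′ y′ z′ a ≡
    evℚ (prod₀ b c d x y z x′ y′ z′) (prod₁ b c d x y z x′ y′ z′) (prod₂ b c d x y z x′ y′ z′) a
    + (z * z′ * a + (y * z′ + z * y′ - b * (z * z′))) * cubicℚ b c d a
  ev-prod = solve 10 (λ b c d x y z x′ y′ z′ a →
    :ev x y z a :* :ev x′ y′ z′ a :=
    :ev (:prod₀ b c d x y z x′ y′ z′) (:prod₁ b c d x y z x′ y′ z′) (:prod₂ b c d x y z x′ y′ z′) a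
    :+ (z :* z′ :* a :+ (y :* z′ :+ z :* y′ :- b :* (z :* z′))) :* :cubic b c d a) refl

  prod-adj₀ : ∀ b c d x y z →
    prod₀ b c d x y z (adj₀ b c d x y z) (adj₁ b c d x y z) (adj₂ b c d x y z) ≡ norm b c d x y z
  prod-adj₀ = solve 6 (λ b c d x y z →
    :prod₀ b c d x y z (:adj₀ b c d x y z) (:adj₁ b c d x y z) (:adj₂ b c d x y z) := :norm b c d x y z) refl

  prod-adj₁ : ∀ b c d x y z →
    prod₁ b c d x y z (adj₀ b c d x y z) (adj₁ b c d x y z) (adj₂ b c d x y z) ≡ 0ℚ
  prod-adj₁ = solve 6 (λ b c d x y z →
    :prod₁ b c d x y z (:adj₀ b c d x y z) (:adj₁ b c d x y z) (:adj₂ b c d x y z) := con 0ℚ) refl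

  prod-adj₂ : ∀ b c d x y z →
    prod₂ b c d x y z (adj₀ b c d x y z) (adj₁ b c d x y z) (adj₂ b c d x y z) ≡ 0ℚ
  prod-adj₂ = solve 6 (λ b c d x y z →
    :prod₂ b c d x y z (:adj₀ b c d x y z) (:adj₁ b c d x y z) (:adj₂ b c d x y z) := con 0ℚ) refl

  ev-e₂ : ∀ b c d x y z a →
    evℚ (adj₀ b c d x y z) (adj₁ b c d x y z) (adj₂ b c d x y z) a + evℚ x y z a * (tr b c d x y z - evℚ x y z a)
    ≡ e₂ b c d x y z + (z * z * (b - a) - (y * z + y * z)) * cubicℚ b c d a
  ev-e₂ = solve 7 (λ b c d x y z a →
    :ev (:adj₀ b c d x y z) (:adj₁ b c d x y z) (:adj₂ b c d x y z) a :+ :ev x y z a :* (:tr b c d x y z :- :ev x y z a)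
    := :e₂ b c d x y z :+ (z :* z :* (b :- a) :- (y :* z :+ y :* z)) :* :cubic b c d a) refl

  four : ℚ
  four = 1ℚ + 1ℚ + (1ℚ + 1ℚ)

  0<four : 0ℚ < four
  0<four = toWitness {a? = 0ℚ <? four} _

  disc : (b c a : ℚ) → ℚ
  disc b c a = b * b - four * c - (b + b) * a - (1ℚ + 1ℚ + 1ℚ) * (a * a)

  -- If α′, α″ are the other two roots, then disc = (α′ - α″)² and the conjugates
  -- of ω = x + yα + zα² differ by (α′ - α″)(y - z(b + α)).
  ev-disc : ∀ b c d x y z a → let t = tr b c d x y z - evℚ x y z a in
    four * evℚ (adj₀ b c d x y z) (adj₁ b c d x y z) (adj₂ b c d x y z) a ≡
    t * t - disc b c a * ((y - z * (b + a)) * (y - z * (b + a))) + four * (z * y - z * (z * (a + b))) * cubicℚ b c d a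
  ev-disc = solve 7 (λ b c d x y z a → let t = :tr b c d x y z :- :ev x y z a in
    con four :* :ev (:adj₀ b c d x y z) (:adj₁ b c d x y z) (:adj₂ b c d x y z) a :=
    t :* t :- (b :* b :- con four :* c :- (b :+ b) :* a :- con (1ℚ + 1ℚ + 1ℚ) :* (a :* a)) :* ((y :- z :* (b :+ a)) :* (y :- z :* (b :+ a)))
    :+ con four :* (z :* y :- z :* (z :* (a :+ b))) :* :cubic b c d a) refl

  -- Since `adj γ = γ² - tr γ · γ + e₂`, replacing γ² by `adj γ` does not change the determinant
  -- with the rows of 1 and γ.
  adj-indexForm : ∀ b c d x y z → indexForm b c d y z ≡ y * adj₂ b c d x y z - z * adj₁ b c d x y z
  adj-indexForm = solve 6 (λ b c d x y z →
    :indexForm b c d y z := y :* :adj₂ b c d x y z :- z :* :adj₁ b c d x y z) refl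

  square-indexForm : ∀ b c d x y z →
    indexForm b c d y z ≡ y * prod₂ b c d x y z x y z - z * prod₁ b c d x y z x y z
  square-indexForm = solve 6 (λ b c d x y z →
    :indexForm b c d y z := y :* :prod₂ b c d x y z x y z :- z :* :prod₁ b c d x y z x y z) refl

-- Arithmetic of the field generated by a root of an irreducible cubic.

module CubicField where
  open RationalArithmetic
  open CubicForms
  open Reals

  cubicᴿ : (b c d : ℚ) → ℝ → ℝ
  cubicᴿ b c d x = x *ᴿ x *ᴿ x +ᴿ fromℚᴿ b *ᴿ (x *ᴿ x) +ᴿ fromℚᴿ c *ᴿ x +ᴿ fromℚᴿ d

  ev : (x y z : ℚ) → ℝ → ℝ
  ev x y z a = fromℚᴿ x +ᴿ fromℚᴿ y *ᴿ a +ᴿ fromℚᴿ z *ᴿ (a *ᴿ a)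

  ℚ-zero-product : ∀ {p q} → p * q ≡ 0ℚ → ¬ p ≡ 0ℚ → q ≡ 0ℚ
  ℚ-zero-product {p} {q} pq≡0 p≢0 = begin
      q             ≡⟨ *-identityˡ q ⟨
      1ℚ * q        ≡⟨ cong (_* q) (*-inverseˡ p) ⟨
      1/ p * p * q  ≡⟨ *-assoc (1/ p) p q ⟩
      1/ p * (p * q) ≡⟨ cong (1/ p *_) pq≡0 ⟩
      1/ p * 0ℚ     ≡⟨ *-zeroʳ (1/ p) ⟩
      0ℚ            ∎
    where
    open ≡-Reasoning
    instance _ = ≢-nonZero p≢0

  quotient : ∀ p {q} → ¬ q ≡ 0ℚ → Σ[ r ∈ ℚ ] r * q ≡ p
  quotient p {q} q≢0 = p * 1/ q , trans (*-assoc p (1/ q) q) (trans (cong (p *_) (*-inverseˡ q)) (*-identityʳ p))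
    where instance _ = ≢-nonZero q≢0

  square-zero : ∀ {p} → p * p ≡ 0ℚ → p ≡ 0ℚ
  square-zero {p} h = decidable-stable (p ≟ 0ℚ) λ p≢0 → p≢0 (ℚ-zero-product h p≢0)

  module Rootless (b c d : ℚ) (no-root : ∀ x → ¬ cubicℚ b c d x ≡ 0ℚ) where

    -- For `z ≠ 0` the form is `z³` times the cubic at `y/z - b`, so a nontrivial zero would be a
    -- rational root.
    indexForm≡0 : ∀ y z → indexForm b c d y z ≡ 0ℚ → y ≡ 0ℚ × z ≡ 0ℚ
    indexForm≡0 y z h with z ≟ 0ℚ
    ... | yes refl = decidable-stable (y ≟ 0ℚ) (λ y≢0 → y≢0 (square-zero (ℚ-zero-product
          (trans (solve 4 (λ b c d y → y :* (y :* y) := :indexForm b c d y (con 0ℚ)) refl b c d y) h) y≢0))) , refl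
    ... | no z≢0 with t , refl ← quotient y z≢0 = contradiction
          (ℚ-zero-product (trans (solve 5 (λ b c d t z → z :* z :* z :* :cubic b c d (t :- b) := :indexForm b c d (t :* z) z) refl b c d t z) h)
            (λ z³≡0 → z≢0 (square-zero (ℚ-zero-product (trans (sym (*-assoc z z z)) z³≡0) z≢0))))
          (no-root (t - b))

    adj≡0 : ∀ x y z → adj₀ b c d x y z ≡ 0ℚ → adj₁ b c d x y z ≡ 0ℚ → adj₂ b c d x y z ≡ 0ℚ →
      x ≡ 0ℚ × y ≡ 0ℚ × z ≡ 0ℚ
    adj≡0 x y z a₀≡0 a₁≡0 a₂≡0 = square-zero x²≡0 , y≡0 , z≡0
      where
      yz≡0 : y ≡ 0ℚ × z ≡ 0ℚ
      yz≡0 = indexForm≡0 y z (trans (adj-indexForm b c d x y z)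
        (trans (cong₂ (λ u v → y * u - z * v) a₂≡0 a₁≡0)
          (solve 2 (λ y z → y :* con 0ℚ :- z :* con 0ℚ := con 0ℚ) refl y z)))
      y≡0 = proj₁ yz≡0
      z≡0 = proj₂ yz≡0
      x²≡0 : x * x ≡ 0ℚ
      x²≡0 = trans (solve 4 (λ b c d x → x :* x := :adj₀ b c d x (con 0ℚ) (con 0ℚ)) refl b c d x)
        (trans (sym (cong₂ (adj₀ b c d x) y≡0 z≡0)) a₀≡0)

    module _ (α : ℝ) (root : cubicᴿ b c d α ≈ᴿ 0ᴿ) where

      irrational : ∀ t → ¬ α ≈ᴿ fromℚᴿ t
      irrational t h = no-root t (fromℚ-injective (≈-trans
        (modulo {y = cubicᴿ b c d α} {h = α +ᴿ -ᴿ fromℚᴿ t} (-≈0 h)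
          (-ᴿ (α *ᴿ α +ᴿ fromℚᴿ t *ᴿ α +ᴿ fromℚᴿ t *ᴿ fromℚᴿ t +ᴿ fromℚᴿ b *ᴿ (α +ᴿ fromℚᴿ t) +ᴿ fromℚᴿ c))
          (λ n → solve 5 (λ b c d t a → :cubic b c d t := :cubic b c d a
              :+ :- (a :* a :+ t :* a :+ t :* t :+ b :* (a :+ t) :+ c) :* (a :- t)) refl b c d t (seq α n)))
        root))

      independent₁ : ∀ x y → fromℚᴿ x +ᴿ fromℚᴿ y *ᴿ α ≈ᴿ 0ᴿ → x ≡ 0ℚ × y ≡ 0ℚ
      independent₁ x y h with y ≟ 0ℚ
      ... | yes refl = fromℚ-injective (≈-trans
              (pointwise λ n → solve 2 (λ x a → x := x :+ con 0ℚ :* a) refl x (seq α n)) h) , refl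
      ... | no y≢0 with t , refl ← quotient x y≢0 with i , iy≡1 ← quotient 1ℚ y≢0 = contradiction
              (modulo h (fromℚᴿ i) λ n → begin
                seq α n                              ≡⟨ solve 2 (λ a t → a := :- t :+ con 1ℚ :* (t :+ a)) refl (seq α n) t ⟩
                - t + 1ℚ * (t + seq α n)             ≡⟨ cong (λ u → - t + u * (t + seq α n)) iy≡1 ⟨
                - t + i * y * (t + seq α n)          ≡⟨ solve 4 (λ i y t a → :- t :+ i :* y :* (t :+ a) := :- t :+ i :* (t :* y :+ y :* a)) refl i y t (seq α n) ⟩
                - t + i * (t * y + y * seq α n)      ∎)
              (irrational (- t))
        where open ≡-Reasoning

      -- A quadratic that kills α divides the cubic: the remainder is a linear relation and vanishes
      -- by `independent₁`, and the linear quotient then has the rational root `v - b`.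
      independent : ∀ x y z → ev x y z α ≈ᴿ 0ᴿ → x ≡ 0ℚ × y ≡ 0ℚ × z ≡ 0ℚ
      independent x y z h with z ≟ 0ℚ
      ... | yes refl = let x≡0 , y≡0 = independent₁ x y (≈-trans
                            (pointwise λ n → solve 3 (λ x y a → x :+ y :* a := x :+ y :* a :+ con 0ℚ :* (a :* a)) refl x y (seq α n)) h)
                       in x≡0 , y≡0 , refl
      ... | no z≢0 with u , refl ← quotient x z≢0 with v , refl ← quotient y z≢0 with i , iz≡1 ← quotient 1ℚ z≢0 =
        contradiction (root-v-b (independent₁ (d - u * (b - v)) (c - u - v * (b - v)) linear)) (no-root (v - b))
        where
        -- t³ + bt² + ct + d = (t² + vt + u)(t + b - v) + (c - u - v(b - v))t + (d - u(b - v))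
        linear : fromℚᴿ (d - u * (b - v)) +ᴿ fromℚᴿ (c - u - v * (b - v)) *ᴿ α ≈ᴿ 0ᴿ
        linear = modulo₂ root 1ᴿ h (-ᴿ (fromℚᴿ i *ᴿ (α +ᴿ fromℚᴿ (b - v)))) λ n → let a = seq α n in begin
          d - u * (b - v) + (c - u - v * (b - v)) * a
            ≡⟨ solve 6 (λ b c d u v a → d :- u :* (b :- v) :+ (c :- u :- v :* (b :- v)) :* a
                 := con 0ℚ :+ con 1ℚ :* :cubic b c d a :+ :- (con 1ℚ :* (a :+ (b :- v))) :* (u :+ v :* a :+ a :* a)) refl b c d u v a ⟩
          0ℚ + 1ℚ * cubicℚ b c d a + - (1ℚ * (a + (b - v))) * (u + v * a + a * a)
            ≡⟨ cong (λ k → 0ℚ + 1ℚ * cubicℚ b c d a + - (k * (a + (b - v))) * (u + v * a + a * a)) iz≡1 ⟨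
          0ℚ + 1ℚ * cubicℚ b c d a + - (i * z * (a + (b - v))) * (u + v * a + a * a)
            ≡⟨ solve 7 (λ b i z f u v a → con 0ℚ :+ con 1ℚ :* f :+ :- (i :* z :* (a :+ (b :- v))) :* (u :+ v :* a :+ a :* a)
                 := con 0ℚ :+ con 1ℚ :* f :+ :- (i :* (a :+ (b :- v))) :* (:ev (u :* z) (v :* z) z a)) refl b i z (cubicℚ b c d a) u v a ⟩
          0ℚ + 1ℚ * cubicℚ b c d a + - (i * (a + (b - v))) * evℚ (u * z) (v * z) z a ∎
          where open ≡-Reasoning
        root-v-b : d - u * (b - v) ≡ 0ℚ × c - u - v * (b - v) ≡ 0ℚ → cubicℚ b c d (v - b) ≡ 0ℚ
        root-v-b (p , q) = begin
          cubicℚ b c d (v - b)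
            ≡⟨ solve 5 (λ b c d u v → :cubic b c d (v :- b) := (d :- u :* (b :- v)) :+ (c :- u :- v :* (b :- v)) :* (v :- b)) refl b c d u v ⟩
          (d - u * (b - v)) + (c - u - v * (b - v)) * (v - b)
            ≡⟨ cong₂ (λ p q → p + q * (v - b)) p q ⟩
          0ℚ + 0ℚ * (v - b)
            ≡⟨ solve 1 (λ w → con 0ℚ :+ con 0ℚ :* w := con 0ℚ) refl (v - b) ⟩
          0ℚ ∎
          where open ≡-Reasoning

      coordinates-unique : ∀ {x y z x′ y′ z′} → ev x y z α ≈ᴿ ev x′ y′ z′ α → x ≡ x′ × y ≡ y′ × z ≡ z′
      coordinates-unique {x} {y} {z} {x′} {y′} {z′} h =
        let p , q , r = independent (x - x′) (y - y′) (z - z′) (≈-trans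
              (pointwise λ n → solve 7 (λ x y z x′ y′ z′ a →
                :ev (x :- x′) (y :- y′) (z :- z′) a := :ev x y z a :- :ev x′ y′ z′ a) refl x y z x′ y′ z′ (seq α n))
              (-≈0 h))
        in difference p , difference q , difference r
        where
        difference : ∀ {p q} → p - q ≡ 0ℚ → p ≡ q
        difference {p} {q} h = trans (solve 2 (λ p q → p := p :- q :+ q) refl p q) (trans (cong (_+ q) h) (+-identityˡ q))

      adjugate : ∀ x y z → ℝ
      adjugate x y z = ev (adj₀ b c d x y z) (adj₁ b c d x y z) (adj₂ b c d x y z) α

      ev-* : ∀ x y z x′ y′ z′ → ev x y z α *ᴿ ev x′ y′ z′ α ≈ᴿ
        ev (prod₀ b c d x y z x′ y′ z′) (prod₁ b c d x y z x′ y′ z′) (prod₂ b c d x y z x′ y′ z′) α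
      ev-* x y z x′ y′ z′ = modulo root
        (fromℚᴿ z *ᴿ fromℚᴿ z′ *ᴿ α +ᴿ (fromℚᴿ y *ᴿ fromℚᴿ z′ +ᴿ fromℚᴿ z *ᴿ fromℚᴿ y′ +ᴿ -ᴿ (fromℚᴿ b *ᴿ (fromℚᴿ z *ᴿ fromℚᴿ z′))))
        λ n → ev-prod b c d x y z x′ y′ z′ (seq α n)

      ev-adjugate : ∀ x y z → ev x y z α *ᴿ adjugate x y z ≈ᴿ fromℚᴿ (norm b c d x y z)
      ev-adjugate x y z = ≈-trans (ev-* x y z (adj₀ b c d x y z) (adj₁ b c d x y z) (adj₂ b c d x y z)) (pointwise λ n → begin
          evℚ (prod₀ b c d x y z (adj₀ b c d x y z) (adj₁ b c d x y z) (adj₂ b c d x y z))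
              (prod₁ b c d x y z (adj₀ b c d x y z) (adj₁ b c d x y z) (adj₂ b c d x y z))
              (prod₂ b c d x y z (adj₀ b c d x y z) (adj₁ b c d x y z) (adj₂ b c d x y z)) (seq α n)
            ≡⟨ cong₂ (λ u v → u + v * (seq α n * seq α n))
                 (cong₂ (λ u v → u + v * seq α n) (prod-adj₀ b c d x y z) (prod-adj₁ b c d x y z)) (prod-adj₂ b c d x y z) ⟩
          evℚ (norm b c d x y z) 0ℚ 0ℚ (seq α n)
            ≡⟨ solve 2 (λ w a → :ev w (con 0ℚ) (con 0ℚ) a := w) refl (norm b c d x y z) (seq α n) ⟩
          norm b c d x y z ∎)
        where open ≡-Reasoning

      norm≡0 : ∀ x y z → norm b c d x y z ≡ 0ℚ → x ≡ 0ℚ × y ≡ 0ℚ × z ≡ 0ℚ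
      norm≡0 x y z h = stable λ nonzero → nonzero (adj-zero (independent _ _ _ (integral-domain
          (≈-trans (ev-adjugate x y z) (pointwise λ _ → h))
          (nonzero ∘ independent x y z))))
        where
        adj-zero : adj₀ b c d x y z ≡ 0ℚ × adj₁ b c d x y z ≡ 0ℚ × adj₂ b c d x y z ≡ 0ℚ → x ≡ 0ℚ × y ≡ 0ℚ × z ≡ 0ℚ
        adj-zero (p , q , r) = adj≡0 x y z p q r
        stable : ¬ ¬ (x ≡ 0ℚ × y ≡ 0ℚ × z ≡ 0ℚ) → x ≡ 0ℚ × y ≡ 0ℚ × z ≡ 0ℚ
        stable ne = decidable-stable (x ≟ 0ℚ) (λ k → ne (k ∘ proj₁)) ,
          decidable-stable (y ≟ 0ℚ) (λ k → ne (k ∘ proj₁ ∘ proj₂)) ,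
          decidable-stable (z ≟ 0ℚ) (λ k → ne (k ∘ proj₂ ∘ proj₂))

      InField : ℝ → Set
      InField u = ∃[ x ] ∃[ y ] ∃[ z ] u ≈ᴿ ev x y z α

      inField-* : ∀ {u v} → InField u → InField v → InField (u *ᴿ v)
      inField-* (x , y , z , p) (x′ , y′ , z′ , q) = _ , _ , _ , ≈-trans (*-cong p q) (ev-* x y z x′ y′ z′)

      -- The inverse of γ is `adj γ / norm γ`, and the norm vanishes only at 0.
      inField-inverse : ∀ {u v} → InField u → u *ᴿ v ≈ᴿ 1ᴿ → InField v
      inField-inverse {u} {v} (x , y , z , u≈) uv≈1 with norm b c d x y z ≟ 0ℚ
      ... | yes N≡0 = contradiction (fromℚ-injective (≈-trans (≈-sym uv≈1) (≈-trans
              (pointwise λ n → *-comm (seq u n) (seq v n)) (*-vanishes v (≈-trans u≈ (ev-zero (norm≡0 x y z N≡0))))))) λ ()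
        where
        ev-zero : x ≡ 0ℚ × y ≡ 0ℚ × z ≡ 0ℚ → ev x y z α ≈ᴿ 0ᴿ
        ev-zero (refl , refl , refl) = pointwise λ n → solve 1 (λ a → :ev (con 0ℚ) (con 0ℚ) (con 0ℚ) a := con 0ℚ) refl (seq α n)
      ... | no N≢0 with i , iN≡1 ← quotient 1ℚ N≢0 = i * A₀ , i * A₁ , i * A₂ ,
              modulo₂ (-≈0 uv≈1) (fromℚᴿ i *ᴿ adjugate x y z) (-≈0 uA≈N) (-ᴿ (fromℚᴿ i *ᴿ v)) λ n → begin
                seq v n                                      ≡⟨ *-identityˡ (seq v n) ⟨
                1ℚ * seq v n                                 ≡⟨ cong (_* seq v n) iN≡1 ⟨
                i * N * seq v n
                  ≡⟨ solve 8 (λ i N u v A₀ A₁ A₂ a → i :* N :* v :=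
                       :ev (i :* A₀) (i :* A₁) (i :* A₂) a :+ i :* :ev A₀ A₁ A₂ a :* (u :* v :- con 1ℚ)
                       :+ :- (i :* v) :* (u :* :ev A₀ A₁ A₂ a :- N)) refl i N (seq u n) (seq v n) A₀ A₁ A₂ (seq α n) ⟩
                evℚ (i * A₀) (i * A₁) (i * A₂) (seq α n) + i * evℚ A₀ A₁ A₂ (seq α n) * (seq u n * seq v n - 1ℚ)
                  + - (i * seq v n) * (seq u n * evℚ A₀ A₁ A₂ (seq α n) - N) ∎
        where
        open ≡-Reasoning
        N = norm b c d x y z
        A₀ = adj₀ b c d x y z
        A₁ = adj₁ b c d x y z
        A₂ = adj₂ b c d x y z
        uA≈N : u *ᴿ adjugate x y z ≈ᴿ fromℚᴿ N
        uA≈N = ≈-trans (*-cong u≈ ≈-refl) (ev-adjugate x y z)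

      -- Induction on the generation of the field. Vanishing of the imaginary part belongs to the
      -- invariant because complex multiplication mixes the two parts.
      field-element : ∀ {u} → u ∈ ℚ⟮ ι α ⟯ → InField (re u) × im u ≈ᴿ 0ᴿ
      field-element gen = (0ℚ , 1ℚ , 0ℚ , pointwise λ n →
          solve 1 (λ a → a := :ev (con 0ℚ) (con 1ℚ) (con 0ℚ) a) refl (seq α n)) , ≈-refl
      field-element one = (1ℚ , 0ℚ , 0ℚ , pointwise λ n →
          solve 1 (λ a → con 1ℚ := :ev (con 1ℚ) (con 0ℚ) (con 0ℚ) a) refl (seq α n)) , ≈-refl
      field-element (add {u} {v} p q) with (x , y , z , u≈) , u0 ← field-element p | (x′ , y′ , z′ , v≈) , v0 ← field-element q =
          (x + x′ , y + y′ , z + z′ , ≈-trans (+-cong u≈ v≈) (pointwise λ n →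
            solve 7 (λ x y z x′ y′ z′ a → :ev x y z a :+ :ev x′ y′ z′ a := :ev (x :+ x′) (y :+ y′) (z :+ z′) a) refl x y z x′ y′ z′ (seq α n))) ,
          ≈-trans (+-cong u0 v0) (pointwise λ _ → refl)
      field-element (neg {u} p) with (x , y , z , u≈) , u0 ← field-element p =
          (- x , - y , - z , ≈-trans (neg-cong u≈) (pointwise λ n →
            solve 4 (λ x y z a → :- :ev x y z a := :ev (:- x) (:- y) (:- z) a) refl x y z (seq α n))) ,
          ≈-trans (neg-cong u0) (pointwise λ _ → refl)
      field-element (mul {u} {v} p q) with u∈ , u0 ← field-element p | v∈ , v0 ← field-element q =
          ( let x , y , z , uv≈ = inField-* u∈ v∈
            in x , y , z , ≈-trans (modulo {h = im u} u0 (-ᴿ im v) λ n →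
                 solve 4 (λ a b c d → a :* c :+ :- (b :* d) := a :* c :+ :- d :* b) refl (seq (re u) n) (seq (im u) n) (seq (re v) n) (seq (im v) n)) uv≈ ) ,
          modulo₂ {h = im v} {k = im u} v0 (re u) u0 (re v) λ n →
            solve 4 (λ a b c d → a :* d :+ b :* c := con 0ℚ :+ a :* d :+ c :* b) refl (seq (re u) n) (seq (im u) n) (seq (re v) n) (seq (im v) n)
      field-element (inv {u} {v} p uv≈1) with u∈ , u0 ← field-element p =
          inField-inverse u∈ real ,
          -- That `v` is real follows from `im v = -im v (re u re v - 1) + re v (re u im v)`.
          modulo₂ {h = re u *ᴿ re v +ᴿ -ᴿ 1ᴿ} {k = re u *ᴿ im v} (-≈0 real) (-ᴿ im v) imag (re v) λ n →
            solve 3 (λ a c d → d := con 0ℚ :+ :- d :* (a :* c :- con 1ℚ) :+ c :* (a :* d)) refl (seq (re u) n) (seq (re v) n) (seq (im v) n)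
        where
        real : re u *ᴿ re v ≈ᴿ 1ᴿ
        real = ≈-trans (modulo {h = im u} u0 (im v) λ n →
          solve 4 (λ a b c d → a :* c := a :* c :+ :- (b :* d) :+ d :* b) refl (seq (re u) n) (seq (im u) n) (seq (re v) n) (seq (im v) n)) (re≈ uv≈1)
        imag : re u *ᴿ im v ≈ᴿ 0ᴿ
        imag = ≈-trans (modulo {h = im u} u0 (-ᴿ re v) λ n →
          solve 4 (λ a b c d → a :* d := a :* d :+ b :* c :+ :- c :* b) refl (seq (re u) n) (seq (im u) n) (seq (re v) n) (seq (im v) n)) (im≈ uv≈1)
      field-element (resp≈ {u} {v} p u≈v) with (x , y , z , u≈) , u0 ← field-element p =
          (x , y , z , ≈-trans (≈-sym (re≈ u≈v)) u≈) , ≈-trans (≈-sym (im≈ u≈v)) u0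

-- Characteristic polynomials and integrality of norms.

module FieldElements where
  open RationalArithmetic
  open CubicField
  open CubicForms
  open Integrality
  open Reals

  determinant : (x y z x′ y′ z′ x″ y″ z″ : ℚ) → ℚ
  determinant x y z x′ y′ z′ x″ y″ z″ =
    x * (y′ * z″ - z′ * y″) - y * (x′ * z″ - z′ * x″) + z * (x′ * y″ - y′ * x″)

  :determinant : ∀ {n} (x y z x′ y′ z′ x″ y″ z″ : Polynomial n) → Polynomial n
  :determinant x y z x′ y′ z′ x″ y″ z″ =
    x :* (y′ :* z″ :- z′ :* y″) :- y :* (x′ :* z″ :- z′ :* x″) :+ z :* (x′ :* y″ :- y′ :* x″)

  determinant-cong : ∀ {x y z x′ y′ z′ x″ y″ z″ u v w u′ v′ w′ u″ v″ w″} →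
    x ≡ u × y ≡ v × z ≡ w → x′ ≡ u′ × y′ ≡ v′ × z′ ≡ w′ → x″ ≡ u″ × y″ ≡ v″ × z″ ≡ w″ →
    determinant x y z x′ y′ z′ x″ y″ z″ ≡ determinant u v w u′ v′ w′ u″ v″ w″
  determinant-cong (refl , refl , refl) (refl , refl , refl) (refl , refl , refl) = refl

  determinant-integer : ∀ {x y z x′ y′ z′ x″ y″ z″} →
    IsInteger x × IsInteger y × IsInteger z → IsInteger x′ × IsInteger y′ × IsInteger z′ →
    IsInteger x″ × IsInteger y″ × IsInteger z″ → IsInteger (determinant x y z x′ y′ z′ x″ y″ z″)
  determinant-integer (i , j , k) (i′ , j′ , k′) (i″ , j″ , k″) =
    integer-+ (integer-- (integer-* i (minor j′ k″ k′ j″)) (integer-* j (minor i′ k″ k′ i″)))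
      (integer-* k (minor i′ j″ j′ i″))
    where
    minor : ∀ {u v w s} → IsInteger u → IsInteger v → IsInteger w → IsInteger s → IsInteger (u * v - w * s)
    minor u v w s = integer-- (integer-* u v) (integer-* w s)

  module _ (b c d : ℚ) (no-root : ∀ x → ¬ cubicℚ b c d x ≡ 0ℚ) (α : ℝ) (root : cubicᴿ b c d α ≈ᴿ 0ᴿ) where

    open Rootless b c d no-root

    module _ (x y z : ℚ) where

      private
        γ A : ℝ
        γ = ev x y z α
        A = adjugate α root x y z
        t e N : ℚ
        t = tr b c d x y z
        e = e₂ b c d x y z
        N = norm b c d x y z

      -- This is `γ′γ″ + γ(γ′ + γ″) = e₂`, where the product of the other conjugates is `A` and
      -- their sum is `t - γ`.
      e₂-adjugate : A +ᴿ γ *ᴿ (fromℚᴿ t +ᴿ -ᴿ γ) ≈ᴿ fromℚᴿ e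
      e₂-adjugate = modulo root
        (fromℚᴿ z *ᴿ fromℚᴿ z *ᴿ (fromℚᴿ b +ᴿ -ᴿ α) +ᴿ -ᴿ (fromℚᴿ y *ᴿ fromℚᴿ z +ᴿ fromℚᴿ y *ᴿ fromℚᴿ z))
        λ n → ev-e₂ b c d x y z (seq α n)

      -- Eliminate `A` between `γ A = N` and `A + γ(t - γ) = e`.
      characteristic : cubicᴿ (- t) e (- N) γ ≈ᴿ 0ᴿ
      characteristic = modulo₂ (-≈0 (ev-adjugate α root x y z)) 1ᴿ (-≈0 e₂-adjugate) (-ᴿ γ) λ n →
        solve 5 (λ γ A t e N → :cubic (:- t) e (:- N) γ := con 0ℚ :+ con 1ℚ :* (γ :* A :- N)
          :+ :- γ :* (A :+ γ :* (t :- γ) :- e)) refl (seq γ n) (seq A n) t e N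

      module _ (irrational : ¬ (y ≡ 0ℚ × z ≡ 0ℚ)) where

        indexForm≢0 : ¬ indexForm b c d y z ≡ 0ℚ
        indexForm≢0 = irrational ∘ indexForm≡0 y z

        -- The determinant of 1, γ, γ² over 1, α, α² is the index form, which is nonzero for
        -- irrational γ.
        independent-powers : ∀ p q r → ev p q r γ ≈ᴿ 0ᴿ → p ≡ 0ℚ × q ≡ 0ℚ × r ≡ 0ℚ
        independent-powers p q r h = p≡0 , q≡0 , r≡0
          where
          open ≡-Reasoning
          s₀ = prod₀ b c d x y z x y z
          s₁ = prod₁ b c d x y z x y z
          s₂ = prod₂ b c d x y z x y z
          coordinates : p + q * x + r * s₀ ≡ 0ℚ × q * y + r * s₁ ≡ 0ℚ × q * z + r * s₂ ≡ 0ℚ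
          coordinates = independent α root (p + q * x + r * s₀) (q * y + r * s₁) (q * z + r * s₂)
            (≈-trans (modulo (-≈0 (ev-* α root x y z x y z)) (-ᴿ fromℚᴿ r) λ n →
              solve 10 (λ p q r s₀ s₁ s₂ x y z a → :ev (p :+ q :* x :+ r :* s₀) (q :* y :+ r :* s₁) (q :* z :+ r :* s₂) a
                := :ev p q r (:ev x y z a) :+ :- r :* (:ev x y z a :* :ev x y z a :- :ev s₀ s₁ s₂ a))
                refl p q r s₀ s₁ s₂ x y z (seq α n)) h)
          r≡0 : r ≡ 0ℚ
          r≡0 = ℚ-zero-product (begin
              indexForm b c d y z * r
                ≡⟨ cong (_* r) (square-indexForm b c d x y z) ⟩
              (y * s₂ - z * s₁) * r
                ≡⟨ solve 6 (λ y z q r s₁ s₂ → (y :* s₂ :- z :* s₁) :* r := y :* (q :* z :+ r :* s₂) :- z :* (q :* y :+ r :* s₁)) refl y z q r s₁ s₂ ⟩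
              y * (q * z + r * s₂) - z * (q * y + r * s₁)
                ≡⟨ cong₂ (λ u v → y * u - z * v) (proj₂ (proj₂ coordinates)) (proj₁ (proj₂ coordinates)) ⟩
              y * 0ℚ - z * 0ℚ
                ≡⟨ solve 2 (λ y z → y :* con 0ℚ :- z :* con 0ℚ := con 0ℚ) refl y z ⟩
              0ℚ ∎)
            indexForm≢0
          drop-r : ∀ u s → u + r * s ≡ 0ℚ → u ≡ 0ℚ
          drop-r u s k = trans (solve 2 (λ u s → u := u :+ con 0ℚ :* s) refl u s) (trans (cong (λ r → u + r * s) (sym r≡0)) k)
          q≡0 : q ≡ 0ℚ
          q≡0 = decidable-stable (q ≟ 0ℚ) λ q≢0 → irrational
            ( ℚ-zero-product (drop-r (q * y) s₁ (proj₁ (proj₂ coordinates))) q≢0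
            , ℚ-zero-product (drop-r (q * z) s₂ (proj₂ (proj₂ coordinates))) q≢0 )
          p≡0 : p ≡ 0ℚ
          p≡0 = trans (solve 2 (λ p x → p := p :+ con 0ℚ :* x) refl p x)
            (trans (cong (λ q → p + q * x) (sym q≡0)) (drop-r (p + q * x) s₀ (proj₁ coordinates)))

        -- Two monic cubics with the root γ differ by a relation of degree at most 2. The trace and
        -- the second symmetric function of β are thereby read off its integer equation.
        characteristic-unique : ∀ p q s → cubicᴿ p q s γ ≈ᴿ 0ᴿ → t ≡ - p × e ≡ q × N ≡ - s
        characteristic-unique p q s h =
          let s+N , q-e , p+t = independent-powers (s + N) (q - e) (p + t)
                (modulo₂ h 1ᴿ characteristic (-ᴿ 1ᴿ) λ n →
                  solve 7 (λ p q s t e N γ → :ev (s :+ N) (q :- e) (p :+ t) γ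
                    := con 0ℚ :+ con 1ℚ :* :cubic p q s γ :+ :- con 1ℚ :* :cubic (:- t) e (:- N) γ) refl p q s t e N (seq γ n))
          in opposite p+t , difference q-e , opposite s+N
          where
          opposite : ∀ {u v} → u + v ≡ 0ℚ → v ≡ - u
          opposite {u} {v} k = trans (solve 2 (λ u v → v := :- u :+ (u :+ v)) refl u v)
            (trans (cong (λ w → - u + w) k) (+-identityʳ (- u)))
          difference : ∀ {u v} → u - v ≡ 0ℚ → v ≡ u
          difference {u} {v} k = trans (solve 2 (λ u v → v := u :- (u :- v)) refl u v)
            (trans (cong (λ w → u - w) k) (solve 1 (λ u → u :- con 0ℚ := u) refl u))

  -- The ring ℤ[α, β] is contained in D⁻¹(ℤ + ℤα + ℤα²) for some D ≠ 0.
  module Lattice (b c d d′ : ℤ) (α β : ℝ)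
    (no-root : ∀ x → ¬ cubicℚ (fromℤ b) (fromℤ c) (fromℤ d) x ≡ 0ℚ)
    (root : cubicᴿ (fromℤ b) (fromℤ c) (fromℤ d) α ≈ᴿ 0ᴿ)
    (root′ : cubicᴿ (fromℤ b) (fromℤ c) (fromℤ d′) β ≈ᴿ 0ᴿ)
    (p q r : ℚ) (β≈ : β ≈ᴿ ev p q r α) where

    open Rootless (fromℤ b) (fromℤ c) (fromℤ d) no-root

    private
      B C E E′ : ℚ
      B = fromℤ b
      C = fromℤ c
      E = fromℤ d
      E′ = fromℤ d′

    Integral : ℝ → Set
    Integral u = ∃[ x ] ∃[ y ] ∃[ z ] (IsInteger x × IsInteger y × IsInteger z) × u ≈ᴿ ev x y z α

    integral-resp : ∀ {u v} → v ≈ᴿ u → Integral u → Integral v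
    integral-resp h (x , y , z , i , u≈) = x , y , z , i , ≈-trans h u≈

    integral-+ : ∀ {u v} → Integral u → Integral v → Integral (u +ᴿ v)
    integral-+ (x , y , z , (i , j , k) , u≈) (x′ , y′ , z′ , (i′ , j′ , k′) , v≈) =
      x + x′ , y + y′ , z + z′ , (integer-+ i i′ , integer-+ j j′ , integer-+ k k′) ,
      ≈-trans (+-cong u≈ v≈) (pointwise λ n →
        solve 7 (λ x y z x′ y′ z′ a → :ev x y z a :+ :ev x′ y′ z′ a := :ev (x :+ x′) (y :+ y′) (z :+ z′) a) refl x y z x′ y′ z′ (seq α n))

    integral-* : ∀ {u v} → Integral u → Integral v → Integral (u *ᴿ v)
    integral-* (x , y , z , (i , j , k) , u≈) (x′ , y′ , z′ , (i′ , j′ , k′) , v≈) =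
      prod₀ B C E x y z x′ y′ z′ , prod₁ B C E x y z x′ y′ z′ , prod₂ B C E x y z x′ y′ z′ ,
      ( integer-+ (integer-- (integer-* i i′) (integer-* (integer d) yz)) (integer-* (integer-* (integer b) (integer d)) (integer-* k k′))
      , integer-+ (integer-- (integer-+ (integer-* i j′) (integer-* j i′)) (integer-* (integer c) yz))
          (integer-* (integer-- (integer-* (integer b) (integer c)) (integer d)) (integer-* k k′))
      , integer-+ (integer-- (integer-+ (integer-+ (integer-* i k′) (integer-* j j′)) (integer-* k i′)) (integer-* (integer b) yz))
          (integer-* (integer-- (integer-* (integer b) (integer b)) (integer c)) (integer-* k k′)) ) ,
      ≈-trans (*-cong u≈ v≈) (ev-* α root x y z x′ y′ z′)
      where yz = integer-+ (integer-* j k′) (integer-* k j′)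

    integral-fromℤ : ∀ m → Integral (fromℚᴿ (fromℤ m))
    integral-fromℤ m = fromℤ m , 0ℚ , 0ℚ , (integer m , integer (+ 0) , integer (+ 0)) , pointwise λ n →
      solve 2 (λ m a → m := :ev m (con 0ℚ) (con 0ℚ) a) refl (fromℤ m) (seq α n)

    integral-α : Integral α
    integral-α = 0ℚ , 1ℚ , 0ℚ , (integer (+ 0) , integer (+ 1) , integer (+ 0)) , pointwise λ n →
      solve 1 (λ a → a := :ev (con 0ℚ) (con 1ℚ) (con 0ℚ) a) refl (seq α n)

    -- Degree 2 in β suffices: β satisfies a monic cubic over ℤ, by which `order-β*` reduces β³.
    InOrder : ℝ → Set
    InOrder u = ∃[ u₀ ] ∃[ u₁ ] ∃[ u₂ ] (Integral u₀ × Integral u₁ × Integral u₂) × u ≈ᴿ u₀ +ᴿ u₁ *ᴿ β +ᴿ u₂ *ᴿ (β *ᴿ β)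

    order-resp : ∀ {u v} → v ≈ᴿ u → InOrder u → InOrder v
    order-resp h (u₀ , u₁ , u₂ , i , u≈) = u₀ , u₁ , u₂ , i , ≈-trans h u≈

    order-+ : ∀ {u v} → InOrder u → InOrder v → InOrder (u +ᴿ v)
    order-+ (u₀ , u₁ , u₂ , (i , j , k) , u≈) (v₀ , v₁ , v₂ , (i′ , j′ , k′) , v≈) =
      u₀ +ᴿ v₀ , u₁ +ᴿ v₁ , u₂ +ᴿ v₂ , (integral-+ i i′ , integral-+ j j′ , integral-+ k k′) ,
      ≈-trans (+-cong u≈ v≈) (pointwise λ n →
        solve 7 (λ x y z x′ y′ z′ a → :ev x y z a :+ :ev x′ y′ z′ a := :ev (x :+ x′) (y :+ y′) (z :+ z′) a)
          refl (seq u₀ n) (seq u₁ n) (seq u₂ n) (seq v₀ n) (seq v₁ n) (seq v₂ n) (seq β n))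

    order-integral* : ∀ {v u} → Integral v → InOrder u → InOrder (v *ᴿ u)
    order-integral* {v} v∈ (u₀ , u₁ , u₂ , (i , j , k) , u≈) =
      v *ᴿ u₀ , v *ᴿ u₁ , v *ᴿ u₂ , (integral-* v∈ i , integral-* v∈ j , integral-* v∈ k) ,
      ≈-trans (*-cong ≈-refl u≈) (pointwise λ n →
        solve 5 (λ v x y z a → v :* :ev x y z a := :ev (v :* x) (v :* y) (v :* z) a)
          refl (seq v n) (seq u₀ n) (seq u₁ n) (seq u₂ n) (seq β n))

    order-β* : ∀ {u} → InOrder u → InOrder (β *ᴿ u)
    order-β* (u₀ , u₁ , u₂ , (i , j , k) , u≈) =
      fromℚᴿ (fromℤ (ℤ.- d′)) *ᴿ u₂ , u₀ +ᴿ fromℚᴿ (fromℤ (ℤ.- c)) *ᴿ u₂ , u₁ +ᴿ fromℚᴿ (fromℤ (ℤ.- b)) *ᴿ u₂ ,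
      (integral-* (integral-fromℤ (ℤ.- d′)) k , integral-+ i (integral-* (integral-fromℤ (ℤ.- c)) k) ,
        integral-+ j (integral-* (integral-fromℤ (ℤ.- b)) k)) ,
      ≈-trans (*-cong ≈-refl u≈) (modulo root′ u₂ λ n →
        trans (solve 7 (λ b c d x y z a → a :* :ev x y z a :=
            :ev (:- d :* z) (x :+ :- c :* z) (y :+ :- b :* z) a :+ z :* :cubic b c d a)
            refl B C E′ (seq u₀ n) (seq u₁ n) (seq u₂ n) (seq β n))
          (cong (_+ seq u₂ n * cubicℚ B C E′ (seq β n))
            (negated (seq u₀ n) (seq u₁ n) (seq u₂ n) (seq β n))))
      where
      negated : ∀ x y z a → evℚ (- E′ * z) (x + - C * z) (y + - B * z) a
        ≡ evℚ (fromℤ (ℤ.- d′) * z) (x + fromℤ (ℤ.- c) * z) (y + fromℤ (ℤ.- b) * z) a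
      negated x y z a = cong₂ (λ v w → v + w * (a * a))
        (cong₂ (λ v w → v * z + (x + w * z) * a) (sym (fromℤ-neg d′)) (sym (fromℤ-neg c)))
        (cong (λ w → y + w * z) (sym (fromℤ-neg b)))

    order-1 : InOrder 1ᴿ
    order-1 = 1ᴿ , 0ᴿ , 0ᴿ , (integral-fromℤ (+ 1) , integral-fromℤ (+ 0) , integral-fromℤ (+ 0)) , pointwise λ n →
      solve 1 (λ a → con 1ℚ := :ev (con 1ℚ) (con 0ℚ) (con 0ℚ) a) refl (seq β n)

    private
      scale : ℤ
      scale = ↧ p ℤ.* ↧ q ℤ.* ↧ r
      D : ℚ
      D = fromℤ scale

      D≡ : D ≡ fromℤ (↧ p) * fromℤ (↧ q) * fromℤ (↧ r)
      D≡ = trans (fromℤ-* (↧ p ℤ.* ↧ q) (↧ r)) (cong (_* fromℤ (↧ r)) (fromℤ-* (↧ p) (↧ q)))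

      scaled-p : IsInteger (D * p)
      scaled-p = subst IsInteger (trans (solve 4 (λ u v w p → v :* w :* (u :* p) := u :* v :* w :* p) refl
          (fromℤ (↧ p)) (fromℤ (↧ q)) (fromℤ (↧ r)) p) (cong (_* p) (sym D≡)))
        (integer-* (integer-* (integer (↧ q)) (integer (↧ r))) (↥ p , denominator-clears p))

      scaled-q : IsInteger (D * q)
      scaled-q = subst IsInteger (trans (solve 4 (λ u v w q → u :* w :* (v :* q) := u :* v :* w :* q) refl
          (fromℤ (↧ p)) (fromℤ (↧ q)) (fromℤ (↧ r)) q) (cong (_* q) (sym D≡)))
        (integer-* (integer-* (integer (↧ p)) (integer (↧ r))) (↥ q , denominator-clears q))

      scaled-r : IsInteger (D * r)
      scaled-r = subst IsInteger (trans (solve 4 (λ u v w r → u :* v :* (w :* r) := u :* v :* w :* r) refl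
          (fromℤ (↧ p)) (fromℤ (↧ q)) (fromℤ (↧ r)) r) (cong (_* r) (sym D≡)))
        (integer-* (integer-* (integer (↧ p)) (integer (↧ q))) (↥ r , denominator-clears r))

      D≢0 : ¬ D ≡ 0ℚ
      D≢0 h with () ← fromℤ-injective {scale} {+ 0} h

      integral-Dβ : Integral (fromℚᴿ D *ᴿ β)
      integral-Dβ = D * p , D * q , D * r , (scaled-p , scaled-q , scaled-r) ,
        ≈-trans (*-cong ≈-refl β≈) (pointwise λ n →
          solve 5 (λ D x y z a → D :* :ev x y z a := :ev (D :* x) (D :* y) (D :* z) a) refl D p q r (seq α n))

      -- One factor `D` clears the denominators of β, and β² takes two.
      integral-order : ∀ {u} → InOrder u → Integral (fromℚᴿ (D * D) *ᴿ u)
      integral-order {u} (u₀ , u₁ , u₂ , (i , j , k) , u≈) = integral-resp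
        (≈-trans (*-cong ≈-refl u≈) (pointwise λ n →
          solve 5 (λ D x y z a → D :* D :* :ev x y z a := D :* D :* x :+ y :* (D :* (D :* a)) :+ z :* (D :* a :* (D :* a)))
            refl D (seq u₀ n) (seq u₁ n) (seq u₂ n) (seq β n)))
        (integral-+ (integral-+ (integral-* (integral-* (integral-fromℤ scale) (integral-fromℤ scale)) i)
          (integral-* j (integral-* (integral-fromℤ scale) integral-Dβ)))
          (integral-* k (integral-* integral-Dβ integral-Dβ)))

    -- The determinants of the coordinates of D²γᵐ, D²γᵐ⁺¹, D²γᵐ⁺² are integers
    -- and form a geometric sequence whose ratio is the norm of γ.
    norm-integer : ∀ x y z → (∀ {u} → InOrder u → InOrder (ev x y z α *ᴿ u)) → ¬ (y ≡ 0ℚ × z ≡ 0ℚ) →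
      IsInteger (norm B C E x y z)
    norm-integer x y z order-γ* irrational =
      geometric-integer-ratio N (λ m → proj₁ (det-integer m)) base
        (λ m → trans (sym (proj₂ (det-integer (suc m)))) (trans (det-suc m) (cong (N *_) (proj₂ (det-integer m)))))
      where
      open ≡-Reasoning
      γ : ℝ
      γ = ev x y z α
      t e N : ℚ
      t = tr B C E x y z
      e = e₂ B C E x y z
      N = norm B C E x y z

      power : ℕ → ℝ
      power zero = 1ᴿ
      power (suc m) = γ *ᴿ power m

      order-power : ∀ m → InOrder (power m)
      order-power zero = order-1
      order-power (suc m) = order-γ* (order-power m)

      -- Opaque, so that the coordinates stay atoms: only their integrality and the equation
      -- `coordinates` matter.
      abstract
        integral-power : ∀ m → Integral (fromℚᴿ (D * D) *ᴿ power m)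
        integral-power m = integral-order (order-power m)

      X Y Z : ℕ → ℚ
      X m = proj₁ (integral-power m)
      Y m = proj₁ (proj₂ (integral-power m))
      Z m = proj₁ (proj₂ (proj₂ (integral-power m)))

      coordinates-integer : ∀ m → IsInteger (X m) × IsInteger (Y m) × IsInteger (Z m)
      coordinates-integer m = proj₁ (proj₂ (proj₂ (proj₂ (integral-power m))))

      coordinates : ∀ m → fromℚᴿ (D * D) *ᴿ power m ≈ᴿ ev (X m) (Y m) (Z m) α
      coordinates m = proj₂ (proj₂ (proj₂ (proj₂ (integral-power m))))

      det : ℕ → ℚ
      det m = determinant (X m) (Y m) (Z m) (X (1 ℕ.+ m)) (Y (1 ℕ.+ m)) (Z (1 ℕ.+ m)) (X (2 ℕ.+ m)) (Y (2 ℕ.+ m)) (Z (2 ℕ.+ m))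

      det-integer : ∀ m → IsInteger (det m)
      det-integer m = determinant-integer (coordinates-integer m) (coordinates-integer (1 ℕ.+ m)) (coordinates-integer (2 ℕ.+ m))

      -- The characteristic equation of γ, multiplied by `D²γᵐ` and compared in the basis 1, α, α².
      recurrence : ∀ m → let m₁ = 1 ℕ.+ m; m₂ = 2 ℕ.+ m; m₃ = 3 ℕ.+ m in
        X m₃ ≡ t * X m₂ - e * X m₁ + N * X m ×
        Y m₃ ≡ t * Y m₂ - e * Y m₁ + N * Y m ×
        Z m₃ ≡ t * Z m₂ - e * Z m₁ + N * Z m
      recurrence m = coordinates-unique α root (≈-trans (≈-sym (coordinates (3 ℕ.+ m)))
        (≈-trans (modulo (characteristic B C E no-root α root x y z) (fromℚᴿ (D * D) *ᴿ power m) λ n →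
            solve 6 (λ D γ u t e N → D :* D :* (γ :* (γ :* (γ :* u))) :=
              t :* (D :* D :* (γ :* (γ :* u))) :- e :* (D :* D :* (γ :* u)) :+ N :* (D :* D :* u)
              :+ D :* D :* u :* :cubic (:- t) e (:- N) γ) refl D (seq γ n) (seq (power m) n) t e N)
          (≈-trans (+-cong (+-cong (*-cong (≈-refl {fromℚᴿ t}) (coordinates (2 ℕ.+ m)))
              (neg-cong (*-cong (≈-refl {fromℚᴿ e}) (coordinates (1 ℕ.+ m))))) (*-cong (≈-refl {fromℚᴿ N}) (coordinates m)))
            (pointwise λ n → combine t e N (X m) (Y m) (Z m) (X (1 ℕ.+ m)) (Y (1 ℕ.+ m)) (Z (1 ℕ.+ m)) (X (2 ℕ.+ m)) (Y (2 ℕ.+ m)) (Z (2 ℕ.+ m)) (seq α n)))))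
        where
        combine : ∀ t e N x y z x′ y′ z′ x″ y″ z″ a →
          t * evℚ x″ y″ z″ a + - (e * evℚ x′ y′ z′ a) + N * evℚ x y z a
          ≡ evℚ (t * x″ - e * x′ + N * x) (t * y″ - e * y′ + N * y) (t * z″ - e * z′ + N * z) a
        combine = solve 13 (λ t e N x y z x′ y′ z′ x″ y″ z″ a →
          t :* :ev x″ y″ z″ a :+ :- (e :* :ev x′ y′ z′ a) :+ N :* :ev x y z a
          := :ev (t :* x″ :- e :* x′ :+ N :* x) (t :* y″ :- e :* y′ :+ N :* y) (t :* z″ :- e :* z′ :+ N :* z) a) refl

      -- In the new row only the `N`-multiple of the dropped row survives the determinant, and
      -- moving it back to the front is a cyclic, hence even, permutation.
      det-suc : ∀ m → det (suc m) ≡ N * det m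
      det-suc m = trans
          (determinant-cong {X (1 ℕ.+ m)} {Y (1 ℕ.+ m)} {Z (1 ℕ.+ m)} {X (2 ℕ.+ m)} {Y (2 ℕ.+ m)} {Z (2 ℕ.+ m)}
            (refl , refl , refl) (refl , refl , refl) (recurrence m))
          (shift t e N (X m) (Y m) (Z m) (X (1 ℕ.+ m)) (Y (1 ℕ.+ m)) (Z (1 ℕ.+ m)) (X (2 ℕ.+ m)) (Y (2 ℕ.+ m)) (Z (2 ℕ.+ m)))
        where
        shift : ∀ t e N x y z x′ y′ z′ x″ y″ z″ →
          determinant x′ y′ z′ x″ y″ z″ (t * x″ - e * x′ + N * x) (t * y″ - e * y′ + N * y) (t * z″ - e * z′ + N * z)
          ≡ N * determinant x y z x′ y′ z′ x″ y″ z″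
        shift = solve 12 (λ t e N x y z x′ y′ z′ x″ y″ z″ →
          :determinant x′ y′ z′ x″ y″ z″ (t :* x″ :- e :* x′ :+ N :* x) (t :* y″ :- e :* y′ :+ N :* y) (t :* z″ :- e :* z′ :+ N :* z)
          := N :* :determinant x y z x′ y′ z′ x″ y″ z″) refl

      -- The rows are those of 1, γ, γ², each scaled by `D²`; the nonzero index form makes the
      -- geometric sequence start at a nonzero integer.
      det-0 : det 0 ≡ D * D * (D * D) * (D * D) * indexForm B C E y z
      det-0 = begin
          det 0
            ≡⟨ determinant-cong v₀ v₁ v₂ ⟨
          determinant (D * D) 0ℚ 0ℚ (D * D * x) (D * D * y) (D * D * z) (D * D * s₀) (D * D * s₁) (D * D * s₂)
            ≡⟨ solve 7 (λ D x y z s₀ s₁ s₂ →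
                 :determinant (D :* D) (con 0ℚ) (con 0ℚ) (D :* D :* x) (D :* D :* y) (D :* D :* z) (D :* D :* s₀) (D :* D :* s₁) (D :* D :* s₂)
                 := D :* D :* (D :* D) :* (D :* D) :* (y :* s₂ :- z :* s₁)) refl D x y z s₀ s₁ s₂ ⟩
          D * D * (D * D) * (D * D) * (y * s₂ - z * s₁)
            ≡⟨ cong (D * D * (D * D) * (D * D) *_) (square-indexForm B C E x y z) ⟨
          D * D * (D * D) * (D * D) * indexForm B C E y z ∎
        where
        s₀ = prod₀ B C E x y z x y z
        s₁ = prod₁ B C E x y z x y z
        s₂ = prod₂ B C E x y z x y z
        v₀ : D * D ≡ X 0 × 0ℚ ≡ Y 0 × 0ℚ ≡ Z 0
        v₀ = coordinates-unique α root (≈-trans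
          (pointwise λ n → solve 2 (λ D a → :ev (D :* D) (con 0ℚ) (con 0ℚ) a := D :* D :* con 1ℚ) refl D (seq α n))
          (coordinates 0))
        v₁ : D * D * x ≡ X 1 × D * D * y ≡ Y 1 × D * D * z ≡ Z 1
        v₁ = coordinates-unique α root (≈-trans
          (pointwise λ n → solve 5 (λ D x y z a → :ev (D :* D :* x) (D :* D :* y) (D :* D :* z) a := D :* D :* (:ev x y z a :* con 1ℚ))
            refl D x y z (seq α n))
          (coordinates 1))
        v₂ : D * D * s₀ ≡ X 2 × D * D * s₁ ≡ Y 2 × D * D * s₂ ≡ Z 2
        v₂ = coordinates-unique α root (≈-trans
          (modulo (-≈0 (ev-* α root x y z x y z)) (-ᴿ fromℚᴿ (D * D)) λ n →
            solve 8 (λ D s₀ s₁ s₂ x y z a → :ev (D :* D :* s₀) (D :* D :* s₁) (D :* D :* s₂) a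
                := D :* D :* (:ev x y z a :* (:ev x y z a :* con 1ℚ)) :+ :- (D :* D) :* (:ev x y z a :* :ev x y z a :- :ev s₀ s₁ s₂ a))
              refl D s₀ s₁ s₂ x y z (seq α n))
          (coordinates 2))

      base : ¬ proj₁ (det-integer 0) ≡ + 0
      base h = indexForm≢0 B C E no-root α root x y z irrational
        (ℚ-zero-product (trans (sym det-0) (trans (proj₂ (det-integer 0)) (cong fromℤ h))) D⁶≢0)
        where
        D²≢0 : ¬ D * D ≡ 0ℚ
        D²≢0 = D≢0 ∘ square-zero
        D⁶≢0 : ¬ D * D * (D * D) * (D * D) ≡ 0ℚ
        D⁶≢0 k = D²≢0 (ℚ-zero-product k (D²≢0 ∘ square-zero))

-- Real inequalities behind the norm bounds.

module Inequalities where
  open RationalArithmetic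
  open Reals

  infixl 6 _⊖_
  _⊖_ : ℝ → ℝ → ℝ
  x ⊖ y = x +ᴿ -ᴿ y

  times : ∀ q {x} → 0ℚ ≤ q → NonNeg x → NonNeg (fromℚᴿ q *ᴿ x)
  times q 0≤q = nonNeg-* (nonNeg-fromℚ 0≤q)

  mul-bound : ∀ {a A b B} → NonNeg A → NonNeg b → NonNeg (A ⊖ a) → NonNeg (B ⊖ b) → NonNeg (A *ᴿ B ⊖ a *ᴿ b)
  mul-bound {a} {A} {b} {B} hA hb a≤A b≤B = nonNeg-resp
    (pointwise λ n → solve 4 (λ a A b B → A :* (B :- b) :+ (A :- a) :* b := A :* B :- a :* b) refl (seq a n) (seq A n) (seq b n) (seq B n))
    (nonNeg-+ (nonNeg-* hA b≤B) (nonNeg-* a≤A hb))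

  nonNeg-const : ∀ n → NonNeg (fromℚᴿ (+ n / 1))
  nonNeg-const n = nonNeg-fromℚ (nonNegative⁻¹ (+ n / 1) {{normalize-nonNeg n 1}})

  1-x²>0 : ∀ γ → Pos (1ᴿ ⊖ γ) → Pos (1ᴿ +ᴿ γ) → Pos (1ᴿ ⊖ γ *ᴿ γ)
  1-x²>0 γ h k = pos-resp (pointwise λ n → solve 1 (λ γ → (con 1ℚ :- γ) :* (con 1ℚ :+ γ) := con 1ℚ :- γ :* γ) refl (seq γ n)) (pos-* h k)

  -- From `0 ≤ W ≤ (9/4)γ²` follows `|γ² - W| ≤ (5/4)γ²`, so the square is at most `(25/16)γ⁶`,
  -- below 25/16. The leading constant 231/16 is `16 - 25/16`.
  difference-bound : ∀ γ W → Pos (1ᴿ ⊖ γ) → Pos (1ᴿ +ᴿ γ) → NonNeg W →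
    NonNeg (fromℚᴿ (+ 9 / 1) *ᴿ (γ *ᴿ γ) ⊖ fromℚᴿ (+ 4 / 1) *ᴿ W) →
    Pos (fromℚᴿ (+ 16 / 1) ⊖ (γ *ᴿ (γ *ᴿ γ ⊖ W)) *ᴿ (γ *ᴿ (γ *ᴿ γ ⊖ W)))
  difference-bound γ W γ<1 -1<γ 0≤W H = pos-resp
    (pointwise λ n → solve 2 (λ γ W → let g = γ :* γ in
        con (+ 231 / 16) :+ (con (+ 25 / 16) :* ((con 1ℚ :- g) :* (con 1ℚ :+ g :+ g :* g))
          :+ con (+ 1 / 16) :* (g :* ((g :+ con (+ 4 / 1) :* W) :* (con (+ 9 / 1) :* g :- con (+ 4 / 1) :* W))))
        := con (+ 16 / 1) :- (γ :* (γ :* γ :- W)) :* (γ :* (γ :* γ :- W))) refl (seq γ n) (seq W n))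
    (pos-nonNeg-+ (pos-fromℚ {+ 231 / 16} (toWitness {a? = 0ℚ <? + 231 / 16} _))
      (nonNeg-+
        (times (+ 25 / 16) (toWitness {a? = 0ℚ ≤? + 25 / 16} _)
          (nonNeg-* (pos⇒nonNeg (1-x²>0 γ γ<1 -1<γ)) (nonNeg-+ (nonNeg-+ (nonNeg-const 1) 0≤g) (nonNeg-square g))))
        (times (+ 1 / 16) (toWitness {a? = 0ℚ ≤? + 1 / 16} _)
          (nonNeg-* 0≤g (nonNeg-* (nonNeg-+ 0≤g (nonNeg-* (nonNeg-const 4) 0≤W)) H)))))
    where
    g = γ *ᴿ γ
    0≤g = nonNeg-square γ

  -- Both `V` and `W` lie in [0, 4], so they differ by at most 4, and `|γ| < 1` makes the bound
  -- strict.
  sum-bound : ∀ γ V W → Pos (1ᴿ ⊖ γ) → Pos (1ᴿ +ᴿ γ) → NonNeg V → NonNeg W →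
    NonNeg (fromℚᴿ (+ 4 / 1) ⊖ V) → NonNeg (fromℚᴿ (+ 4 / 1) ⊖ W) →
    Pos (fromℚᴿ (+ 16 / 1) ⊖ (γ *ᴿ (V ⊖ W)) *ᴿ (γ *ᴿ (V ⊖ W)))
  sum-bound γ V W γ<1 -1<γ 0≤V 0≤W V≤4 W≤4 = pos-resp
    (pointwise λ n → solve 3 (λ γ V W →
        con (+ 16 / 1) :* (con 1ℚ :- γ :* γ) :+ γ :* γ :* ((con (+ 4 / 1) :- V :+ W) :* (con (+ 4 / 1) :- W :+ V))
        := con (+ 16 / 1) :- (γ :* (V :- W)) :* (γ :* (V :- W))) refl (seq γ n) (seq V n) (seq W n))
    (pos-nonNeg-+ (pos-* (pos-fromℚ {+ 16 / 1} (toWitness {a? = 0ℚ <? + 16 / 1} _)) (1-x²>0 γ γ<1 -1<γ))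
      (nonNeg-* (nonNeg-square γ) (nonNeg-* (nonNeg-+ V≤4 0≤W) (nonNeg-+ W≤4 0≤V))))

  two : ℝ
  two = fromℚᴿ (+ 2 / 1)

  -- With Q = v² - W and S = (2 - v)² - W: Q² ≤ v⁴ and S² ≤ (25/16)(2 - v)⁴, while
  -- v(2 - v) ≤ 1 and v(v + 1) ≤ 6.
  sum-product-bound : ∀ v x W → Pos v → Pos (two ⊖ v) → NonNeg W →
    NonNeg (fromℚᴿ (+ 9 / 1) *ᴿ (x *ᴿ x *ᴿ (v *ᴿ v)) ⊖ fromℚᴿ (+ 16 / 1) *ᴿ W) →
    NonNeg (1ᴿ ⊖ x *ᴿ x) → NonNeg ((two ⊖ v) *ᴿ (two ⊖ v) ⊖ x *ᴿ x) →
    let M = v *ᴿ (v *ᴿ v ⊖ W) *ᴿ ((v +ᴿ 1ᴿ) *ᴿ ((two ⊖ v) *ᴿ (two ⊖ v) ⊖ W)) in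
    Pos (fromℚᴿ (+ 256 / 1) ⊖ M *ᴿ M)
  sum-product-bound v x W 0<v v<2 0≤W H x²≤1 x²≤T = pos-resp
      (pointwise λ n → solve 2 (λ v W → let
          u = con (+ 2 / 1) :- v
          S = u :* u :- W
          Q = v :* v :- W
          M = v :* Q :* ((v :+ con 1ℚ) :* S)
        in con (+ 3196 / 16) :+ (con (+ 36 / 1) :* con (+ 25 / 16) :- (v :* (v :+ con 1ℚ)) :* (v :* (v :+ con 1ℚ)) :* (Q :* Q :* (S :* S)))
        := con (+ 256 / 1) :- M :* M) refl (seq v n) (seq W n))
      -- The constant is `256 - 36 · 25/16`.
      (pos-nonNeg-+ (pos-fromℚ {+ 3196 / 16} (toWitness {a? = 0ℚ <? + 3196 / 16} _))
        (mul-bound (nonNeg-const 36) 0≤Q²S² v²≤36 Q²S²≤25/16))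
    where
    T Q S : ℝ
    T = (two ⊖ v) *ᴿ (two ⊖ v)
    Q = v *ᴿ v ⊖ W
    S = T ⊖ W
    0≤Q²S² : NonNeg (Q *ᴿ Q *ᴿ (S *ᴿ S))
    0≤Q²S² = nonNeg-* (nonNeg-square Q) (nonNeg-square S)
    0≤v : NonNeg v
    0≤v = pos⇒nonNeg 0<v
    0≤2-v : NonNeg (two ⊖ v)
    0≤2-v = pos⇒nonNeg v<2
    0≤T : NonNeg T
    0≤T = nonNeg-square (two ⊖ v)
    -- 36 - w² = (6 - w)(6 + w) for w = v(v + 1), and 6 - w = (2 - v)(v + 3).
    v²≤36 : NonNeg (fromℚᴿ (+ 36 / 1) ⊖ (v *ᴿ (v +ᴿ 1ᴿ)) *ᴿ (v *ᴿ (v +ᴿ 1ᴿ)))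
    v²≤36 = nonNeg-resp (pointwise λ n → solve 1 (λ v →
        (con (+ 2 / 1) :- v) :* (v :+ con (+ 3 / 1)) :* (con (+ 6 / 1) :+ v :* (v :+ con 1ℚ))
        := con (+ 36 / 1) :- (v :* (v :+ con 1ℚ)) :* (v :* (v :+ con 1ℚ))) refl (seq v n))
      (nonNeg-* (nonNeg-* 0≤2-v (nonNeg-+ 0≤v (nonNeg-const 3)))
        (nonNeg-+ (nonNeg-const 6) (nonNeg-* 0≤v (nonNeg-+ 0≤v (nonNeg-const 1)))))
    16W≤9v² : NonNeg (fromℚᴿ (+ 9 / 1) *ᴿ (v *ᴿ v) ⊖ fromℚᴿ (+ 16 / 1) *ᴿ W)
    16W≤9v² = nonNeg-resp (pointwise λ n → solve 3 (λ v x W →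
        (con (+ 9 / 1) :* (x :* x :* (v :* v)) :- con (+ 16 / 1) :* W) :+ con (+ 9 / 1) :* (v :* v :* (con 1ℚ :- x :* x))
        := con (+ 9 / 1) :* (v :* v) :- con (+ 16 / 1) :* W) refl (seq v n) (seq x n) (seq W n))
      (nonNeg-+ H (nonNeg-* (nonNeg-const 9) (nonNeg-* (nonNeg-square v) x²≤1)))
    -- Here `x² ≤ T` is used where `16W≤9v²` uses `x² ≤ 1`; then `v² ≤ 4`.
    16W≤36T : NonNeg (fromℚᴿ (+ 36 / 1) *ᴿ T ⊖ fromℚᴿ (+ 16 / 1) *ᴿ W)
    16W≤36T = nonNeg-resp (pointwise λ n → solve 3 (λ v x W → let T = (con (+ 2 / 1) :- v) :* (con (+ 2 / 1) :- v) in
        (con (+ 9 / 1) :* (x :* x :* (v :* v)) :- con (+ 16 / 1) :* W)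
        :+ (con (+ 9 / 1) :* (v :* v :* (T :- x :* x)) :+ con (+ 9 / 1) :* (T :* ((con (+ 2 / 1) :- v) :* (con (+ 2 / 1) :+ v))))
        := con (+ 36 / 1) :* T :- con (+ 16 / 1) :* W) refl (seq v n) (seq x n) (seq W n))
      (nonNeg-+ H (nonNeg-+ (nonNeg-* (nonNeg-const 9) (nonNeg-* (nonNeg-square v) x²≤T))
        (nonNeg-* (nonNeg-const 9) (nonNeg-* 0≤T (nonNeg-* 0≤2-v (nonNeg-+ (nonNeg-const 2) 0≤v))))))
    -- The difference is `W(2v² - W)`.
    Q²≤v⁴ : NonNeg (v *ᴿ v *ᴿ (v *ᴿ v) ⊖ Q *ᴿ Q)
    Q²≤v⁴ = nonNeg-resp (pointwise λ n → solve 2 (λ v W →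
        W :* (con (+ 1 / 16) :* ((con (+ 9 / 1) :* (v :* v) :- con (+ 16 / 1) :* W) :+ con (+ 23 / 1) :* (v :* v)))
        := v :* v :* (v :* v) :- (v :* v :- W) :* (v :* v :- W)) refl (seq v n) (seq W n))
      (nonNeg-* 0≤W (times (+ 1 / 16) (toWitness {a? = 0ℚ ≤? + 1 / 16} _)
        (nonNeg-+ 16W≤9v² (nonNeg-* (nonNeg-const 23) (nonNeg-square v)))))
    S²≤T² : NonNeg (fromℚᴿ (+ 25 / 16) *ᴿ (T *ᴿ T) ⊖ S *ᴿ S)
    S²≤T² = nonNeg-resp (pointwise λ n → solve 2 (λ T W →
        (con (+ 1 / 4) :* T :+ W) :* (con (+ 1 / 16) :* (con (+ 36 / 1) :* T :- con (+ 16 / 1) :* W))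
        := con (+ 25 / 16) :* (T :* T) :- (T :- W) :* (T :- W)) refl (seq T n) (seq W n))
      (nonNeg-* (nonNeg-+ (times (+ 1 / 4) (toWitness {a? = 0ℚ ≤? + 1 / 4} _) 0≤T) 0≤W)
        (times (+ 1 / 16) (toWitness {a? = 0ℚ ≤? + 1 / 16} _) 16W≤36T))
    -- With P = v(2 - v), 1 - P = (1 - v)² and 1 - P⁴ = (1 - P)(1 + P)(1 + P²).
    Q²S²≤25/16 : NonNeg (fromℚᴿ (+ 25 / 16) ⊖ Q *ᴿ Q *ᴿ (S *ᴿ S))
    Q²S²≤25/16 = nonNeg-resp (pointwise λ n → solve 3 (λ v Q S → let
          P = v :* (con (+ 2 / 1) :- v)
          T = (con (+ 2 / 1) :- v) :* (con (+ 2 / 1) :- v)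
        in con (+ 25 / 16) :* ((con 1ℚ :- v) :* (con 1ℚ :- v) :* ((con 1ℚ :+ P) :* (con 1ℚ :+ P :* P)))
          :+ (v :* v :* (v :* v) :* (con (+ 25 / 16) :* (T :* T)) :- Q :* Q :* (S :* S))
        := con (+ 25 / 16) :- Q :* Q :* (S :* S)) refl (seq v n) (seq Q n) (seq S n))
      (nonNeg-+ (times (+ 25 / 16) (toWitness {a? = 0ℚ ≤? + 25 / 16} _)
          (nonNeg-* (nonNeg-square (1ᴿ ⊖ v)) (nonNeg-* (nonNeg-+ (nonNeg-const 1) 0≤P) (nonNeg-+ (nonNeg-const 1) (nonNeg-square P)))))
        (mul-bound (nonNeg-square (v *ᴿ v)) (nonNeg-square S) Q²≤v⁴ S²≤T²))
      where
      P : ℝ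
      P = v *ᴿ (two ⊖ v)
      0≤P : NonNeg P
      0≤P = nonNeg-* 0≤v 0≤2-v

-- Discriminants and differences of conjugates.

module Conjugates where
  open RationalArithmetic
  open CubicForms
  open FieldElements
  open Inequalities
  open Integrality
  open Reals

  m²<1⇒m≡0 : ∀ m → m ℤ.* m ℤ.< + 1 → m ≡ + 0
  m²<1⇒m≡0 (+ zero) _ = refl
  m²<1⇒m≡0 (+ suc n) (ℤ.+<+ (ℕ.s≤s ()))
  m²<1⇒m≡0 -[1+ n ] (ℤ.+<+ (ℕ.s≤s ()))

  -- The factor `k` is 4 for a single norm and 16 for a product of two: four times a norm has a
  -- formula free of denominators.
  small-integer : ∀ {n} k M → 0ℚ < k → IsInteger n → fromℚᴿ (k * n) ≈ᴿ M →
    Pos (fromℚᴿ (k * k) ⊖ M *ᴿ M) → n ≡ 0ℚ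
  small-integer {n} k M 0<k (m , n≡m) kn≈M M²<k² = trans n≡m (cong fromℤ (m²<1⇒m≡0 m (fromℤ-cancel-< m²<1)))
    where
    0<k²-k²n² : 0ℚ < k * k * (1ℚ - n * n)
    0<k²-k²n² = pos-fromℚ⁻¹ (pos-resp (modulo (-≈0 kn≈M) (fromℚᴿ (k * n) +ᴿ M) λ i →
      solve 3 (λ k n M → k :* k :- M :* M := k :* k :* (con 1ℚ :- n :* n) :+ (k :* n :+ M) :* (k :* n :- M)) refl k n (seq M i)) M²<k²)
    m²<1 : fromℤ (m ℤ.* m) < 1ℚ
    m²<1 = 0<q-p⇒p<q (subst (0ℚ <_) (cong (_-_ 1ℚ) (trans (cong₂ _*_ n≡m n≡m) (sym (fromℤ-* m m))))
      (*-cancelˡ-<-nonNeg (k * k) {{nonNegative (<⇒≤ (0<-* 0<k 0<k))}} (subst (_< k * k * (1ℚ - n * n)) (sym (*-zeroʳ (k * k))) 0<k²-k²n²)))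

  discᴿ : (b c : ℚ) → ℝ → ℝ
  discᴿ b c a = fromℚᴿ b *ᴿ fromℚᴿ b ⊖ fromℚᴿ four *ᴿ fromℚᴿ c ⊖ (fromℚᴿ b +ᴿ fromℚᴿ b) *ᴿ a ⊖ fromℚᴿ (1ℚ + 1ℚ + 1ℚ) *ᴿ (a *ᴿ a)

  :disc : ∀ {n} → (b c a : Polynomial n) → Polynomial n
  :disc b c a = b :* b :- con four :* c :- (b :+ b) :* a :- con (1ℚ + 1ℚ + 1ℚ) :* (a :* a)

  -- As a function of `a`, `disc` is concave. For `c ≤ -b - 3` it is at least `(b + 2)² + 8` at 0
  -- and `(b + 1)² + 8` at 1; the term `3a(1 - a)` is its excess over the chord.
  disc≥8 : ∀ b c a → 0ℚ ≤ - b - + 3 / 1 - c → Pos a → Pos (1ᴿ ⊖ a) → NonNeg (discᴿ b c a ⊖ fromℚᴿ (+ 8 / 1))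
  disc≥8 b c a 0≤e 0<a a<1 = nonNeg-resp
    (pointwise λ n → solve 3 (λ b c a →
        con four :* (:- b :- con (+ 3 / 1) :- c) :+ con (+ 3 / 1) :* (a :* (con 1ℚ :- a))
        :+ ((con 1ℚ :- a) :* ((b :+ con (+ 2 / 1)) :* (b :+ con (+ 2 / 1))) :+ a :* ((b :+ con 1ℚ) :* (b :+ con 1ℚ)))
        := :disc b c a :- con (+ 8 / 1)) refl b c (seq a n))
    (nonNeg-+ (nonNeg-+ (nonNeg-* (nonNeg-fromℚ (toWitness {a? = 0ℚ ≤? four} _)) (nonNeg-fromℚ 0≤e))
        (nonNeg-* (nonNeg-const 3) (nonNeg-* 0≤a 0≤1-a)))
      (nonNeg-+ (nonNeg-* 0≤1-a (nonNeg-square (fromℚᴿ b +ᴿ fromℚᴿ (+ 2 / 1)))) (nonNeg-* 0≤a (nonNeg-square (fromℚᴿ b +ᴿ 1ᴿ)))))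
    where
    0≤a = pos⇒nonNeg 0<a
    0≤1-a = pos⇒nonNeg a<1

  disc>0 : ∀ b c a → 0ℚ ≤ - b - + 3 / 1 - c → Pos a → Pos (1ᴿ ⊖ a) → Pos (discᴿ b c a)
  disc>0 b c a 0≤e 0<a a<1 = pos-resp
    (pointwise λ n → solve 1 (λ D → con (+ 8 / 1) :+ (D :- con (+ 8 / 1)) := D) refl (seq (discᴿ b c a) n))
    (pos-nonNeg-+ (pos-fromℚ {+ 8 / 1} (toWitness {a? = 0ℚ <? + 8 / 1} _)) (disc≥8 b c a 0≤e 0<a a<1))

  -- For roots α, β of cubics with the same b, c whose discriminants satisfy
  -- disc β = ρ² disc α, W is the square of the difference of the two conjugates
  -- of α ± β; a cancellation occurs because ρ < 0.
  module ConjugateDifference (b c : ℚ) (α β ρ : ℝ)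
    (0≤e : 0ℚ ≤ - b - + 3 / 1 - c) (0<α : Pos α) (α<1 : Pos (1ᴿ ⊖ α)) (0<β : Pos β) (β<1 : Pos (1ᴿ ⊖ β))
    (disc-β : discᴿ b c β ≈ᴿ discᴿ b c α *ᴿ (ρ *ᴿ ρ))
    (ρ<0 : Pos (-ᴿ (ρ *ᴿ discᴿ b c α))) where

    x K W : ℝ
    x = β ⊖ α
    K = fromℚᴿ b +ᴿ fromℚᴿ b +ᴿ fromℚᴿ (+ 3 / 1) *ᴿ (α +ᴿ β)
    W = discᴿ b c α *ᴿ ((ρ +ᴿ 1ᴿ) *ᴿ (ρ +ᴿ 1ᴿ))

    0≤W : NonNeg W
    0≤W = nonNeg-* (pos⇒nonNeg (disc>0 b c α 0≤e 0<α α<1)) (nonNeg-square (ρ +ᴿ 1ᴿ))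

    -- As `xK = disc α - disc β = (1 - ρ²) disc α`, the square `x²K²` equals `W (1 - ρ)² disc α = W
    -- (disc α + disc β - 2ρ disc α)`. Both discriminants are at least 8 and the last term is
    -- positive by the sign of ρ.
    16W≤x²K² : NonNeg (x *ᴿ x *ᴿ (K *ᴿ K) ⊖ fromℚᴿ (+ 16 / 1) *ᴿ W)
    16W≤x²K² = nonNeg-resp
      (modulo (-≈0 disc-β) (-ᴿ h +ᴿ W +ᴿ fromℚᴿ (+ 2 / 1) *ᴿ (Dα ⊖ Dα *ᴿ (ρ *ᴿ ρ))) λ n →
        solve 5 (λ b c α β ρ → let
            Dα = :disc b c α
            Dβ = :disc b c β
            h = Dβ :- Dα :* (ρ :* ρ)
            W = Dα :* ((ρ :+ con 1ℚ) :* (ρ :+ con 1ℚ))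
            K = b :+ b :+ con (+ 3 / 1) :* (α :+ β)
          in W :* (Dα :- con (+ 8 / 1) :+ (Dβ :- con (+ 8 / 1)) :+ con (+ 2 / 1) :* (:- (ρ :* Dα)))
          := (β :- α) :* (β :- α) :* (K :* K) :- con (+ 16 / 1) :* W
            :+ (:- h :+ W :+ con (+ 2 / 1) :* (Dα :- Dα :* (ρ :* ρ))) :* h) refl b c (seq α n) (seq β n) (seq ρ n))
      (nonNeg-* 0≤W (nonNeg-+ (nonNeg-+ (disc≥8 b c α 0≤e 0<α α<1) (disc≥8 b c β 0≤e 0<β β<1))
        (nonNeg-* (nonNeg-const 2) (pos⇒nonNeg ρ<0))))
      where
      Dα h : ℝ
      Dα = discᴿ b c α
      h = discᴿ b c β ⊖ Dα *ᴿ (ρ *ᴿ ρ)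

    x<1 : Pos (1ᴿ ⊖ x)
    x<1 = pos-resp (pointwise λ n → solve 2 (λ α β → con 1ℚ :- β :+ α := con 1ℚ :- (β :- α)) refl (seq α n) (seq β n)) (pos-+ β<1 0<α)

    -1<x : Pos (1ᴿ +ᴿ x)
    -1<x = pos-resp (pointwise λ n → solve 2 (λ α β → con 1ℚ :- α :+ β := con 1ℚ :+ (β :- α)) refl (seq α n) (seq β n)) (pos-+ α<1 0<β)

    x²≤1 : NonNeg (1ᴿ ⊖ x *ᴿ x)
    x²≤1 = pos⇒nonNeg (1-x²>0 x x<1 -1<x)

    0<α+β : Pos (α +ᴿ β)
    0<α+β = pos-+ 0<α 0<β

    α+β<2 : Pos (two ⊖ (α +ᴿ β))
    α+β<2 = pos-resp (pointwise λ n → solve 2 (λ α β → con 1ℚ :- α :+ (con 1ℚ :- β) := con (+ 2 / 1) :- (α :+ β)) refl (seq α n) (seq β n)) (pos-+ α<1 β<1)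

    α+β-1<1 : Pos (1ᴿ ⊖ (α +ᴿ β ⊖ 1ᴿ))
    α+β-1<1 = pos-resp (pointwise λ n → solve 2 (λ α β → con 1ℚ :- α :+ (con 1ℚ :- β) := con 1ℚ :- (α :+ β :- con 1ℚ)) refl (seq α n) (seq β n)) (pos-+ α<1 β<1)

    -1<α+β-1 : Pos (1ᴿ +ᴿ (α +ᴿ β ⊖ 1ᴿ))
    -1<α+β-1 = pos-resp (pointwise λ n → solve 2 (λ α β → α :+ β := con 1ℚ :+ (α :+ β :- con 1ℚ)) refl (seq α n) (seq β n)) 0<α+β

    -- The range of `b` and `0 < α + β < 2` make `6 - K` and `6 + K` nonnegative.
    K²≤36 : 0ℚ ≤ - b → 0ℚ ≤ + 3 / 1 + b → NonNeg (fromℚᴿ (+ 36 / 1) ⊖ K *ᴿ K)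
    K²≤36 b≤0 -3≤b = nonNeg-resp (pointwise λ n → solve 3 (λ b α β → let K = b :+ b :+ con (+ 3 / 1) :* (α :+ β) in
        (con (+ 2 / 1) :* (:- b) :+ con (+ 3 / 1) :* (con (+ 2 / 1) :- (α :+ β))) :* (con (+ 2 / 1) :* (con (+ 3 / 1) :+ b) :+ con (+ 3 / 1) :* (α :+ β))
        := con (+ 36 / 1) :- K :* K) refl b (seq α n) (seq β n))
      (nonNeg-* (nonNeg-+ (nonNeg-* (nonNeg-const 2) (nonNeg-fromℚ b≤0)) (nonNeg-* (nonNeg-const 3) (pos⇒nonNeg α+β<2)))
        (nonNeg-+ (nonNeg-* (nonNeg-const 2) (nonNeg-fromℚ -3≤b)) (nonNeg-* (nonNeg-const 3) (pos⇒nonNeg 0<α+β))))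

    4W≤9x² : 0ℚ ≤ - b → 0ℚ ≤ + 3 / 1 + b → NonNeg (fromℚᴿ (+ 9 / 1) *ᴿ (x *ᴿ x) ⊖ fromℚᴿ (+ 4 / 1) *ᴿ W)
    4W≤9x² b≤0 -3≤b = nonNeg-resp (pointwise λ n → solve 3 (λ x K W →
        con (+ 1 / 4) :* ((x :* x :* (K :* K) :- con (+ 16 / 1) :* W) :+ x :* x :* (con (+ 36 / 1) :- K :* K))
        := con (+ 9 / 1) :* (x :* x) :- con (+ 4 / 1) :* W) refl (seq x n) (seq K n) (seq W n))
      (nonNeg-* (nonNeg-fromℚ (toWitness {a? = 0ℚ ≤? + 1 / 4} _)) (nonNeg-+ 16W≤x²K² (nonNeg-* (nonNeg-square x) (K²≤36 b≤0 -3≤b))))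

    -- From `4W ≤ 9x² ≤ 9`; the 7 in the identity is the slack `16 - 9`.
    W≤4 : 0ℚ ≤ - b → 0ℚ ≤ + 3 / 1 + b → NonNeg (fromℚᴿ (+ 4 / 1) ⊖ W)
    W≤4 b≤0 -3≤b = nonNeg-resp (pointwise λ n → solve 2 (λ x W →
        con (+ 1 / 4) :* ((con (+ 9 / 1) :* (x :* x) :- con (+ 4 / 1) :* W) :+ (con (+ 7 / 1) :+ con (+ 9 / 1) :* (con 1ℚ :- x :* x)))
        := con (+ 4 / 1) :- W) refl (seq x n) (seq W n))
      (nonNeg-* (nonNeg-fromℚ (toWitness {a? = 0ℚ ≤? + 1 / 4} _)) (nonNeg-+ (4W≤9x² b≤0 -3≤b)
        (nonNeg-+ (nonNeg-const 7) (nonNeg-* (nonNeg-const 9) x²≤1))))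

-- A field contains at most one root in (0, 1) from the family.

module FieldRigidity where
  open RationalArithmetic
  open Conjugates
  open CubicField
  open CubicForms
  open FieldElements
  open Inequalities
  open Integrality
  open Reals

  no-integer-in-unit-interval : ∀ m → + 0 ℤ.< m → ¬ m ℤ.< + 1
  no-integer-in-unit-interval (+ suc n) _ (ℤ.+<+ (ℕ.s≤s ()))
  no-integer-in-unit-interval (+ zero) (ℤ.+<+ ()) _

  below-rational : ∀ {x p u} → x ≈ᴿ fromℚᴿ p → Pos (fromℚᴿ u ⊖ x) → p < u
  below-rational {x} {p} {u} x≈p x<u = 0<q-p⇒p<q (pos-fromℚ⁻¹ (pos-resp
    (≈-trans (+-cong (≈-refl {fromℚᴿ u}) (neg-cong x≈p)) (pointwise λ _ → refl)) x<u))

  cubicᴿ-cong : ∀ b c d {x y} → x ≈ᴿ y → cubicᴿ b c d x ≈ᴿ cubicᴿ b c d y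
  cubicᴿ-cong b c d h = +-cong (+-cong (+-cong (*-cong (*-cong h h) h) (*-cong (≈-refl {fromℚᴿ b}) (*-cong h h)))
    (*-cong (≈-refl {fromℚᴿ c}) h)) (≈-refl {fromℚᴿ d})

  cubicᴿ-fromℚ : ∀ b c d {x p} → x ≈ᴿ fromℚᴿ p → cubicᴿ b c d x ≈ᴿ fromℚᴿ (cubicℚ b c d p)
  cubicᴿ-fromℚ b c d h = ≈-trans (cubicᴿ-cong b c d h) (pointwise λ _ → refl)

  -- The values are enumerated because each needs its own shifts, and because the traces and the
  -- values of `δ` and `ε` compute at numerals.
  data SmallCoefficient : ℤ → Set where
    b≡0  : SmallCoefficient (+ 0)
    b≡-1 : SmallCoefficient -[1+ 0 ]
    b≡-2 : SmallCoefficient -[1+ 1 ]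
    b≡-3 : SmallCoefficient -[1+ 2 ]

  b≤0 : ∀ {b} → SmallCoefficient b → 0ℚ ≤ - fromℤ b
  b≤0 b≡0 = toWitness {a? = 0ℚ ≤? - fromℤ (+ 0)} _
  b≤0 b≡-1 = toWitness {a? = 0ℚ ≤? - fromℤ -[1+ 0 ]} _
  b≤0 b≡-2 = toWitness {a? = 0ℚ ≤? - fromℤ -[1+ 1 ]} _
  b≤0 b≡-3 = toWitness {a? = 0ℚ ≤? - fromℤ -[1+ 2 ]} _

  -3≤b : ∀ {b} → SmallCoefficient b → 0ℚ ≤ + 3 / 1 + fromℤ b
  -3≤b b≡0 = toWitness {a? = 0ℚ ≤? + 3 / 1 + fromℤ (+ 0)} _
  -3≤b b≡-1 = toWitness {a? = 0ℚ ≤? + 3 / 1 + fromℤ -[1+ 0 ]} _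
  -3≤b b≡-2 = toWitness {a? = 0ℚ ≤? + 3 / 1 + fromℤ -[1+ 1 ]} _
  -3≤b b≡-3 = toWitness {a? = 0ℚ ≤? + 3 / 1 + fromℤ -[1+ 2 ]} _

  0≤-b-3-c : ∀ b c → c ℤ.≤ ℤ.- b ℤ.- + 3 → 0ℚ ≤ - fromℤ b - + 3 / 1 - fromℤ c
  0≤-b-3-c b c c≤ = subst (_≤ - fromℤ b - + 3 / 1 - fromℤ c) (+-inverseʳ (fromℤ c))
    (+-monoˡ-≤ (- fromℤ c) (subst (fromℤ c ≤_) (trans (fromℤ-+ (ℤ.- b) (ℤ.- + 3)) (cong (_+ - (+ 3 / 1)) (fromℤ-neg b))) (fromℤ-mono-≤ c≤)))

  slopeᴿ : (b y z : ℚ) → ℝ → ℝ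
  slopeᴿ b y z a = fromℚᴿ y ⊖ fromℚᴿ z *ᴿ (fromℚᴿ b +ᴿ a)

  module Pair (b c d d′ : ℤ) (b-range : SmallCoefficient b) (c≤ : c ℤ.≤ ℤ.- b ℤ.- + 3)
    (no-root : ∀ x → ¬ cubicℚ (fromℤ b) (fromℤ c) (fromℤ d) x ≡ 0ℚ)
    (α : ℝ) (0<α : Pos α) (α<1 : Pos (1ᴿ ⊖ α)) (root : cubicᴿ (fromℤ b) (fromℤ c) (fromℤ d) α ≈ᴿ 0ᴿ)
    (p q r : ℚ) where

    private
      β : ℝ
      β = ev p q r α
      B C E E′ : ℚ
      B = fromℤ b
      C = fromℤ c
      E = fromℤ d
      E′ = fromℤ d′

    module Conjugate (0<β : Pos β) (β<1 : Pos (1ᴿ ⊖ β)) (root′ : cubicᴿ B C E′ β ≈ᴿ 0ᴿ) (α≉β : ¬ α ≈ᴿ β) where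

      open Rootless B C E no-root
      open Lattice b c d d′ α β no-root root root′ p q r ≈-refl

      0≤e : 0ℚ ≤ - B - + 3 / 1 - C
      0≤e = 0≤-b-3-c b c c≤

      -- A rational root of a monic integer polynomial is an integer, and (0, 1) contains none.
      β-irrational : ¬ (q ≡ 0ℚ × r ≡ 0ℚ)
      β-irrational (q≡0 , r≡0) = p-not-integer (rational-root b c d′ p (fromℚ-injective (≈-trans
          (≈-sym (cubicᴿ-fromℚ B C E′ β≈p)) root′)))
        where
        β≈p : β ≈ᴿ fromℚᴿ p
        β≈p = pointwise λ n → trans (cong₂ (λ q r → evℚ p q r (seq α n)) q≡0 r≡0)
          (solve 2 (λ p a → :ev p (con 0ℚ) (con 0ℚ) a := p) refl p (seq α n))
        p-not-integer : ¬ IsInteger p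
        p-not-integer (m , p≡m) = no-integer-in-unit-interval m
          (fromℤ-cancel-< {+ 0} {m} (subst (0ℚ <_) p≡m (pos-fromℚ⁻¹ (pos-resp β≈p 0<β))))
          (fromℤ-cancel-< {m} {+ 1} (subst (_< 1ℚ) p≡m (below-rational β≈p β<1)))

      tr≡ : tr B C E p q r ≡ - B
      tr≡ = proj₁ (characteristic-unique B C E no-root α root p q r β-irrational B C E′ root′)

      e₂≡ : e₂ B C E p q r ≡ C
      e₂≡ = proj₁ (proj₂ (characteristic-unique B C E no-root α root p q r β-irrational B C E′ root′))

      Dα : ℝ
      Dα = discᴿ B C α

      slope : (y z : ℚ) → ℝ
      slope y z = slopeᴿ B y z α

      adjugate-disc : ∀ x y z → let t = fromℚᴿ (tr B C E x y z) ⊖ ev x y z α in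
        fromℚᴿ four *ᴿ adjugate α root x y z ≈ᴿ t *ᴿ t ⊖ Dα *ᴿ (slope y z *ᴿ slope y z)
      adjugate-disc x y z = modulo root
        (fromℚᴿ four *ᴿ (fromℚᴿ z *ᴿ fromℚᴿ y ⊖ fromℚᴿ z *ᴿ (fromℚᴿ z *ᴿ (α +ᴿ fromℚᴿ B))))
        λ n → ev-disc B C E x y z (seq α n)

      -- Two numbers have four times their product equal to the square of their sum minus the square
      -- of their difference; here they are the two other conjugates, with sum `t` and squared
      -- difference `Dα · slope²`.
      norm-disc : ∀ x y z → let t = fromℚᴿ (tr B C E x y z) ⊖ ev x y z α in
        fromℚᴿ (four * norm B C E x y z) ≈ᴿ ev x y z α *ᴿ (t *ᴿ t ⊖ Dα *ᴿ (slope y z *ᴿ slope y z))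
      norm-disc x y z = modulo₂ (-≈0 (ev-adjugate α root x y z)) (-ᴿ fromℚᴿ four) (-≈0 (adjugate-disc x y z)) (ev x y z α) λ n →
        solve 4 (λ γ A N T → con four :* N := γ :* T :+ :- con four :* (γ :* A :- N) :+ γ :* (con four :* A :- T)) refl
          (seq (ev x y z α) n) (seq (adjugate α root x y z) n) (norm B C E x y z)
          (seq (let t = fromℚᴿ (tr B C E x y z) ⊖ ev x y z α in t *ᴿ t ⊖ Dα *ᴿ (slope y z *ᴿ slope y z)) n)

      ρ : ℝ
      ρ = slope q r

      -- Two computations of `(β′ - β″)²`: from the equation of β, whose trace and second symmetric
      -- function are `-B` and `C`, and from the coordinates of β.
      disc-β : discᴿ B C β ≈ᴿ Dα *ᴿ (ρ *ᴿ ρ)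
      disc-β = modulo₂ (-≈0 (adjugate-disc p q r)) (-ᴿ 1ᴿ) (-≈0 (e₂-adjugate B C E no-root α root p q r)) (fromℚᴿ four) λ n →
          subst₂ (λ t e → let β = seq β n ; A = seq (adjugate α root p q r) n ; D = seq (Dα *ᴿ (ρ *ᴿ ρ)) n in
              disc B C β ≡ D + - 1ℚ * (four * A - ((t - β) * (t - β) - D)) + four * (A + β * (t - β) - e))
            (sym tr≡) (sym e₂≡)
            (solve 5 (λ B C A β D → :disc B C β := D :+ :- con 1ℚ :* (con four :* A :- ((:- B :- β) :* (:- B :- β) :- D)) :+ con four :* (A :+ β :* (:- B :- β) :- C))
              refl B C (seq (adjugate α root p q r) n) (seq β n) (seq (Dα *ᴿ (ρ *ᴿ ρ)) n))

      -- The square of `ρ Dα` is the product of the two positive discriminants.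
      ρDα≉0 : ¬ ρ *ᴿ Dα ≈ᴿ 0ᴿ
      ρDα≉0 h = pos⇒≉0 (pos-* (disc>0 B C α 0≤e 0<α α<1) (disc>0 B C β 0≤e 0<β β<1)) (modulo₂ h (ρ *ᴿ Dα) (-≈0 disc-β) Dα λ n →
        solve 3 (λ D D′ ρ → D :* D′ := con 0ℚ :+ ρ :* D :* (ρ :* D) :+ D :* (D′ :- D :* (ρ :* ρ))) refl
          (seq Dα n) (seq (discᴿ B C β) n) (seq ρ n))

      module _ (σ k : ℤ) where

        private
          S L : ℚ
          S = fromℤ σ
          L = fromℤ k

        combination : ℝ
        combination = β +ᴿ fromℚᴿ S *ᴿ α +ᴿ fromℚᴿ L

        combination-norm : ℚ
        combination-norm = norm B C E (p + L) (q + S) r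

        order-combination* : ∀ {u} → InOrder u → InOrder (ev (p + L) (q + S) r α *ᴿ u)
        order-combination* {u} u∈ = order-resp
          (pointwise λ n → solve 7 (λ p q r S L a u → :ev (p :+ L) (q :+ S) r a :* u := :ev p q r a :* u :+ S :* a :* u :+ L :* u)
            refl p q r S L (seq α n) (seq u n))
          (order-+ (order-+ (order-β* u∈) (order-integral* (integral-* (integral-fromℤ σ) integral-α) u∈)) (order-integral* (integral-fromℤ k) u∈))

        module _ (irrational : ¬ (q + S ≡ 0ℚ × r ≡ 0ℚ)) where

          combination-norm-integer : IsInteger combination-norm
          combination-norm-integer = norm-integer (p + L) (q + S) r order-combination* irrational

          combination-norm≢0 : ¬ combination-norm ≡ 0ℚ
          combination-norm≢0 h = irrational (proj₂ (norm≡0 α root (p + L) (q + S) r h))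

        combination-norm-disc : ∀ τ → - B + (L + L + L) - B * S ≡ τ →
          let t = fromℚᴿ τ ⊖ combination ; s = ρ +ᴿ fromℚᴿ S in
          fromℚᴿ (four * combination-norm) ≈ᴿ combination *ᴿ (t *ᴿ t ⊖ Dα *ᴿ (s *ᴿ s))
        combination-norm-disc τ τ≡ = ≈-trans (norm-disc (p + L) (q + S) r) (pointwise λ n →
          trans (cong (λ t → let γ = evℚ (p + L) (q + S) r (seq α n) ; s = q + S - r * (B + seq α n) in
              γ * ((t - γ) * (t - γ) - seq Dα n * (s * s))) trace)
            (solve 9 (λ B p q r S L a D τ → let
                γ = :ev (p :+ L) (q :+ S) r a
                γ′ = :ev p q r a :+ S :* a :+ L
                s = q :+ S :- r :* (B :+ a)
                s′ = q :- r :* (B :+ a) :+ S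
              in γ :* ((τ :- γ) :* (τ :- γ) :- D :* (s :* s)) := γ′ :* ((τ :- γ′) :* (τ :- γ′) :- D :* (s′ :* s′)))
              refl B p q r S L (seq α n) (seq Dα n) τ))
          where
          trace : tr B C E (p + L) (q + S) r ≡ τ
          trace = trans (solve 8 (λ B C E p q r S L → :tr B C E (p :+ L) (q :+ S) r := :tr B C E p q r :+ (L :+ L :+ L) :- B :* S) refl B C E p q r S L)
            (trans (cong (λ t → t + (L + L + L) - B * S) tr≡) τ≡)

      -- Otherwise `β - α` is the rational `p`; the equal traces of α and β give `3p = 0`, and β =
      -- α.
      difference-irrational : ¬ (q + fromℤ -[1+ 0 ] ≡ 0ℚ × r ≡ 0ℚ)
      difference-irrational (q-1≡0 , r≡0) = α≉β (≈-sym (pointwise λ n → begin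
          evℚ p q r (seq α n)        ≡⟨ cong₂ (λ q r → evℚ p q r (seq α n)) q≡1 r≡0 ⟩
          evℚ p 1ℚ 0ℚ (seq α n)      ≡⟨ cong (λ p → evℚ p 1ℚ 0ℚ (seq α n)) p≡0 ⟩
          evℚ 0ℚ 1ℚ 0ℚ (seq α n)     ≡⟨ solve 1 (λ a → :ev (con 0ℚ) (con 1ℚ) (con 0ℚ) a := a) refl (seq α n) ⟩
          seq α n ∎))
        where
        open ≡-Reasoning
        q≡1 : q ≡ 1ℚ
        q≡1 = trans (solve 1 (λ q → q := q :+ con (fromℤ -[1+ 0 ]) :+ con 1ℚ) refl q) (cong (_+ 1ℚ) q-1≡0)
        3p≡0 : (1ℚ + 1ℚ + 1ℚ) * p ≡ 0ℚ
        3p≡0 = begin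
          (1ℚ + 1ℚ + 1ℚ) * p      ≡⟨ solve 4 (λ B C E p → (con 1ℚ :+ con 1ℚ :+ con 1ℚ) :* p := :tr B C E p (con 1ℚ) (con 0ℚ) :+ B) refl B C E p ⟩
          tr B C E p 1ℚ 0ℚ + B    ≡⟨ cong (_+ B) (cong₂ (tr B C E p) q≡1 r≡0) ⟨
          tr B C E p q r + B      ≡⟨ cong (_+ B) tr≡ ⟩
          - B + B                 ≡⟨ +-inverseˡ B ⟩
          0ℚ ∎
        p≡0 : p ≡ 0ℚ
        p≡0 = ℚ-zero-product {1ℚ + 1ℚ + 1ℚ} {p} 3p≡0 λ ()

      -- Otherwise α + β = p would be an integer root of x³ + bx² + cx + d + d′, but
      -- 3p = -2b and 0 < p < 2.
      sum-irrational : ¬ (q + fromℤ (+ 1) ≡ 0ℚ × r ≡ 0ℚ)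
      sum-irrational (q+1≡0 , r≡0) = impossible (rational-root b c (d ℤ.+ d′) p p-root)
        where
        open ≡-Reasoning
        q≡-1 : q ≡ - 1ℚ
        q≡-1 = trans (solve 1 (λ q → q := q :+ con 1ℚ :+ con (- 1ℚ)) refl q) (cong (_+ - 1ℚ) q+1≡0)
        3p+2B : p + p + p + (B + B) ≡ 0ℚ
        3p+2B = begin
          p + p + p + (B + B)          ≡⟨ solve 4 (λ B C E p → p :+ p :+ p :+ (B :+ B) := :tr B C E p (con (- 1ℚ)) (con 0ℚ) :+ B) refl B C E p ⟩
          tr B C E p (- 1ℚ) 0ℚ + B     ≡⟨ cong (_+ B) (cong₂ (tr B C E p) q≡-1 r≡0) ⟨
          tr B C E p q r + B           ≡⟨ cong (_+ B) tr≡ ⟩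
          - B + B                      ≡⟨ +-inverseˡ B ⟩
          0ℚ ∎
        β≈p-α : β ≈ᴿ fromℚᴿ p ⊖ α
        β≈p-α = pointwise λ n → trans (cong₂ (λ q r → evℚ p q r (seq α n)) q≡-1 r≡0)
          (solve 2 (λ p a → :ev p (con (- 1ℚ)) (con 0ℚ) a := p :- a) refl p (seq α n))
        p≈ : α +ᴿ β ≈ᴿ fromℚᴿ p
        p≈ = ≈-trans (+-cong (≈-refl {α}) β≈p-α) (pointwise λ n → solve 2 (λ p a → a :+ (p :- a) := p) refl p (seq α n))
        shifted-root : cubicᴿ B C E′ (fromℚᴿ p ⊖ α) ≈ᴿ 0ᴿ
        shifted-root = ≈-trans (≈-sym (cubicᴿ-cong B C E′ β≈p-α)) root′
        p-root : p * p * p + B * (p * p) + C * p + fromℤ (d ℤ.+ d′) ≡ 0ℚ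
        p-root = trans (cong (λ s → p * p * p + B * (p * p) + C * p + s) (fromℤ-+ d d′)) (fromℚ-injective
          -- The sum of the cubic of α at `α` and that of β at `p - α` differs from the new cubic at
          -- `p` by a multiple of `3p + 2B`.
          (modulo₂ root 1ᴿ shifted-root 1ᴿ λ n → begin
            p * p * p + B * (p * p) + C * p + (E + E′)
              ≡⟨ solve 6 (λ B C E E′ p a → p :* p :* p :+ B :* (p :* p) :+ C :* p :+ (E :+ E′) :=
                   (p :+ p :+ p :+ (B :+ B)) :* (a :* (p :- a)) :+ con 1ℚ :* :cubic B C E a :+ con 1ℚ :* :cubic B C E′ (p :- a)) refl B C E E′ p (seq α n) ⟩
            (p + p + p + (B + B)) * (seq α n * (p - seq α n)) + 1ℚ * cubicℚ B C E (seq α n) + 1ℚ * cubicℚ B C E′ (p - seq α n)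
              ≡⟨ cong (λ z → z * (seq α n * (p - seq α n)) + 1ℚ * cubicℚ B C E (seq α n) + 1ℚ * cubicℚ B C E′ (p - seq α n)) 3p+2B ⟩
            0ℚ * (seq α n * (p - seq α n)) + 1ℚ * cubicℚ B C E (seq α n) + 1ℚ * cubicℚ B C E′ (p - seq α n)
              ≡⟨ cong (λ z → z + 1ℚ * cubicℚ B C E (seq α n) + 1ℚ * cubicℚ B C E′ (p - seq α n)) (*-zeroˡ (seq α n * (p - seq α n))) ⟩
            0ℚ + 1ℚ * cubicℚ B C E (seq α n) + 1ℚ * cubicℚ B C E′ (p - seq α n) ∎))
        impossible : ¬ IsInteger p
        impossible (m , p≡m) = odd b-range m m≡1 (fromℤ-injective (begin
            fromℤ (m ℤ.+ m ℤ.+ m ℤ.+ (b ℤ.+ b))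
              ≡⟨ trans (fromℤ-+ (m ℤ.+ m ℤ.+ m) (b ℤ.+ b)) (cong₂ _+_ (trans (fromℤ-+ (m ℤ.+ m) m) (cong (_+ fromℤ m) (fromℤ-+ m m))) (fromℤ-+ b b)) ⟩
            fromℤ m + fromℤ m + fromℤ m + (B + B)
              ≡⟨ cong (λ p → p + p + p + (B + B)) p≡m ⟨
            p + p + p + (B + B)  ≡⟨ 3p+2B ⟩
            0ℚ ∎))
          where
          0<m : + 0 ℤ.< m
          0<m = fromℤ-cancel-< {+ 0} {m} (subst (0ℚ <_) p≡m (pos-fromℚ⁻¹ (pos-resp p≈ (pos-+ 0<α 0<β))))
          m<2 : m ℤ.< + 2
          m<2 = fromℤ-cancel-< {m} {+ 2} (subst (_< fromℤ (+ 2)) p≡m (below-rational p≈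
            (pos-resp (pointwise λ n → solve 2 (λ a b → con 1ℚ :- a :+ (con 1ℚ :- b) := con (fromℤ (+ 2)) :- (a :+ b)) refl (seq α n) (seq β n)) (pos-+ α<1 β<1))))
          m≡1 : m ≡ + 1
          m≡1 = go m 0<m m<2
            where
            go : ∀ m → + 0 ℤ.< m → m ℤ.< + 2 → m ≡ + 1
            go (+ 1) _ _ = refl
            go (+ suc (suc n)) _ (ℤ.+<+ (ℕ.s≤s (ℕ.s≤s ())))
            go (+ zero) (ℤ.+<+ ()) _
          odd : ∀ {b} → SmallCoefficient b → ∀ m → m ≡ + 1 → ¬ m ℤ.+ m ℤ.+ m ℤ.+ (b ℤ.+ b) ≡ + 0
          odd b≡0 _ refl ()
          odd b≡-1 _ refl ()
          odd b≡-2 _ refl ()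
          odd b≡-3 _ refl ()

      -- The difference `x = β - α` has trace 0, so its other conjugates sum to `-x`. Their squared
      -- difference `Dα(ρ - 1)²` is the `W` belonging to `-ρ`, which makes four times the norm
      -- `x(x² - W)`.
      same-orientation : ¬ Pos (ρ *ᴿ Dα)
      same-orientation ρDα>0 = combination-norm≢0 -[1+ 0 ] (+ 0) difference-irrational
          (small-integer {combination-norm -[1+ 0 ] (+ 0)} four (x *ᴿ (x *ᴿ x ⊖ W)) 0<four
            (combination-norm-integer -[1+ 0 ] (+ 0) difference-irrational)
            (≈-trans (combination-norm-disc -[1+ 0 ] (+ 0) 0ℚ (solve 1 (λ B → :- B :+ (con 0ℚ :+ con 0ℚ :+ con 0ℚ) :- B :* con (fromℤ -[1+ 0 ]) := con 0ℚ) refl B))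
              (pointwise λ n → solve 4 (λ a b D ρ → let
                  γ = b :+ con (fromℤ -[1+ 0 ]) :* a :+ con 0ℚ
                  t = con 0ℚ :- γ
                  s = ρ :+ con (fromℤ -[1+ 0 ])
                  x = b :- a
                in γ :* (t :* t :- D :* (s :* s)) := x :* (x :* x :- D :* ((:- ρ :+ con 1ℚ) :* (:- ρ :+ con 1ℚ))))
                refl (seq α n) (seq β n) (seq Dα n) (seq ρ n)))
            (difference-bound x W x<1 -1<x 0≤W (4W≤9x² (b≤0 b-range) (-3≤b b-range))))
        where
        open ConjugateDifference B C α β (-ᴿ ρ) 0≤e 0<α α<1 0<β β<1
          (≈-trans disc-β (pointwise λ n → solve 2 (λ D ρ → D :* (ρ :* ρ) := D :* (:- ρ :* :- ρ)) refl (seq Dα n) (seq ρ n)))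
          (pos-resp (pointwise λ n → solve 2 (λ D ρ → ρ :* D := :- (:- ρ :* D)) refl (seq Dα n) (seq ρ n)) ρDα>0)

      module _ (N₀ N₁ : ℚ) (M₀ M₁ : ℝ) (N₀-integer : IsInteger N₀) (N₁-integer : IsInteger N₁)
        (N₀≢0 : ¬ N₀ ≡ 0ℚ) (N₁≢0 : ¬ N₁ ≡ 0ℚ) (N₀≈ : fromℚᴿ (four * N₀) ≈ᴿ M₀) (N₁≈ : fromℚᴿ (four * N₁) ≈ᴿ M₁) where

        -- A product of two nonzero integers is a nonzero integer, so it cannot be smaller than 1 in
        -- absolute value; 256 is `16²` with `16 = four * four`.
        product-bound : ∀ M → M₀ *ᴿ M₁ ≈ᴿ M → ¬ Pos (fromℚᴿ (+ 256 / 1) ⊖ M *ᴿ M)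
        product-bound M M≈ bound = N₁≢0 (ℚ-zero-product
          (small-integer {N₀ * N₁} (+ 16 / 1) M (toWitness {a? = 0ℚ <? + 16 / 1} _) (integer-* N₀-integer N₁-integer)
            (≈-trans (≈-trans
              (pointwise λ _ → solve 2 (λ m n → con (+ 16 / 1) :* (m :* n) := con four :* m :* (con four :* n)) refl N₀ N₁)
              (*-cong N₀≈ N₁≈)) M≈)
            bound)
          N₀≢0)

  opposite-orientation : ∀ {b} c d d′ (b-range : SmallCoefficient b) (c≤ : c ℤ.≤ ℤ.- b ℤ.- + 3)
    (no-root : ∀ x → ¬ cubicℚ (fromℤ b) (fromℤ c) (fromℤ d) x ≡ 0ℚ)
    (α : ℝ) (0<α : Pos α) (α<1 : Pos (1ᴿ ⊖ α)) (root : cubicᴿ (fromℤ b) (fromℤ c) (fromℤ d) α ≈ᴿ 0ᴿ)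
    (p q r : ℚ) (0<β : Pos (ev p q r α)) (β<1 : Pos (1ᴿ ⊖ ev p q r α))
    (root′ : cubicᴿ (fromℤ b) (fromℤ c) (fromℤ d′) (ev p q r α) ≈ᴿ 0ᴿ) (α≉β : ¬ α ≈ᴿ ev p q r α) →
    ¬ Pos (-ᴿ (slopeᴿ (fromℤ b) q r α *ᴿ discᴿ (fromℤ b) (fromℤ c) α))
  opposite-orientation c d d′ b≡0 c≤ no-root α 0<α α<1 root p q r 0<β β<1 root′ α≉β ρDα<0 =
      product-bound (norm₁ (+ 0)) (norm₁ (+ 1)) (u *ᴿ (u *ᴿ u ⊖ W)) ((u +ᴿ 1ᴿ) *ᴿ ((two ⊖ u) *ᴿ (two ⊖ u) ⊖ W))
        (combination-norm-integer (+ 1) (+ 0) sum-irrational) (combination-norm-integer (+ 1) (+ 1) sum-irrational)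
        (combination-norm≢0 (+ 1) (+ 0) sum-irrational) (combination-norm≢0 (+ 1) (+ 1) sum-irrational)
        (≈-trans (combination-norm-disc (+ 1) (+ 0) 0ℚ refl) (pointwise λ n → solve 4 (λ a b D ρ → let
            γ = b :+ con 1ℚ :* a :+ con 0ℚ
            t = con 0ℚ :- γ
            s = ρ :+ con 1ℚ
            u = a :+ b
          in γ :* (t :* t :- D :* (s :* s)) := u :* (u :* u :- D :* (s :* s))) refl (seq α n) (seq β n) (seq Dα n) (seq ρ n)))
        (≈-trans (combination-norm-disc (+ 1) (+ 1) (+ 3 / 1) refl) (pointwise λ n → solve 4 (λ a b D ρ → let
            γ = b :+ con 1ℚ :* a :+ con 1ℚ
            t = con (+ 3 / 1) :- γ
            s = ρ :+ con 1ℚ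
            u = a :+ b
          in γ :* (t :* t :- D :* (s :* s)) := (u :+ con 1ℚ) :* ((con (+ 2 / 1) :- u) :* (con (+ 2 / 1) :- u) :- D :* (s :* s)))
          refl (seq α n) (seq β n) (seq Dα n) (seq ρ n)))
        (u *ᴿ (u *ᴿ u ⊖ W) *ᴿ ((u +ᴿ 1ᴿ) *ᴿ ((two ⊖ u) *ᴿ (two ⊖ u) ⊖ W))) ≈-refl
        (sum-product-bound u x W 0<α+β α+β<2 0≤W
          -- For b = 0 the factor `K` is `3u`, so the bound on `W` improves where `u` is small.
          (nonNeg-resp (pointwise λ n → solve 3 (λ a b W → let x = b :- a ; K = con 0ℚ :+ con 0ℚ :+ con (+ 3 / 1) :* (a :+ b) in
              x :* x :* (K :* K) :- con (+ 16 / 1) :* W := con (+ 9 / 1) :* (x :* x :* ((a :+ b) :* (a :+ b))) :- con (+ 16 / 1) :* W)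
            refl (seq α n) (seq β n) (seq W n)) 16W≤x²K²)
          x²≤1
          (nonNeg-resp (pointwise λ n → solve 2 (λ a b → con (+ 4 / 1) :* ((con 1ℚ :- a) :* (con 1ℚ :- b))
              := (con (+ 2 / 1) :- (a :+ b)) :* (con (+ 2 / 1) :- (a :+ b)) :- (b :- a) :* (b :- a)) refl (seq α n) (seq β n))
            (nonNeg-* (nonNeg-const 4) (nonNeg-* (pos⇒nonNeg α<1) (pos⇒nonNeg β<1)))))
    where
    open Pair (+ 0) c d d′ b≡0 c≤ no-root α 0<α α<1 root p q r
    open Conjugate 0<β β<1 root′ α≉β
    β u : ℝ
    β = ev p q r α
    u = α +ᴿ β
    open ConjugateDifference (fromℤ (+ 0)) (fromℤ c) α β ρ 0≤e 0<α α<1 0<β β<1 disc-β ρDα<0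
    norm₁ : ℤ → ℚ
    norm₁ k = combination-norm (+ 1) k
  opposite-orientation c d d′ b≡-1 c≤ no-root α 0<α α<1 root p q r 0<β β<1 root′ α≉β ρDα<0 =
      combination-norm≢0 (+ 1) -[1+ 0 ] sum-irrational
        (small-integer {combination-norm (+ 1) -[1+ 0 ]} four (γ *ᴿ (u *ᴿ u ⊖ W)) 0<four
          (combination-norm-integer (+ 1) -[1+ 0 ] sum-irrational)
          (≈-trans (combination-norm-disc (+ 1) -[1+ 0 ] (- 1ℚ) refl) (pointwise λ n → solve 4 (λ a b D ρ → let
              γ = b :+ con 1ℚ :* a :+ con (- 1ℚ)
              t = con (- 1ℚ) :- γ
              s = ρ :+ con 1ℚ
              u = a :+ b
            in γ :* (t :* t :- D :* (s :* s)) := (u :- con 1ℚ) :* (u :* u :- D :* (s :* s))) refl (seq α n) (seq β n) (seq Dα n) (seq ρ n)))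
          (sum-bound γ (u *ᴿ u) W
            α+β-1<1
            -1<α+β-1
            (nonNeg-square u) 0≤W
            (nonNeg-resp (pointwise λ n → solve 1 (λ u → (con (+ 2 / 1) :- u) :* (con (+ 2 / 1) :+ u) := con (+ 4 / 1) :- u :* u) refl (seq u n))
              (nonNeg-* (pos⇒nonNeg α+β<2) (nonNeg-+ (nonNeg-const 2) (pos⇒nonNeg 0<α+β))))
            (W≤4 (b≤0 b≡-1) (-3≤b b≡-1))))
    where
    open Pair -[1+ 0 ] c d d′ b≡-1 c≤ no-root α 0<α α<1 root p q r
    open Conjugate 0<β β<1 root′ α≉β
    β u γ : ℝ
    β = ev p q r α
    u = α +ᴿ β
    γ = u ⊖ 1ᴿ
    open ConjugateDifference (fromℤ -[1+ 0 ]) (fromℤ c) α β ρ 0≤e 0<α α<1 0<β β<1 disc-β ρDα<0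
  opposite-orientation c d d′ b≡-2 c≤ no-root α 0<α α<1 root p q r 0<β β<1 root′ α≉β ρDα<0 =
      combination-norm≢0 (+ 1) -[1+ 0 ] sum-irrational
        (small-integer {combination-norm (+ 1) -[1+ 0 ]} four (γ *ᴿ (v *ᴿ v ⊖ W)) 0<four
          (combination-norm-integer (+ 1) -[1+ 0 ] sum-irrational)
          (≈-trans (combination-norm-disc (+ 1) -[1+ 0 ] 1ℚ refl) (pointwise λ n → solve 4 (λ a b D ρ → let
              γ = b :+ con 1ℚ :* a :+ con (- 1ℚ)
              t = con 1ℚ :- γ
              s = ρ :+ con 1ℚ
              v = con 1ℚ :- a :+ (con 1ℚ :- b)
            in γ :* (t :* t :- D :* (s :* s)) := (a :+ b :- con 1ℚ) :* (v :* v :- D :* (s :* s))) refl (seq α n) (seq β n) (seq Dα n) (seq ρ n)))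
          (sum-bound γ (v *ᴿ v) W
            α+β-1<1
            -1<α+β-1
            (nonNeg-square v) 0≤W
            (nonNeg-resp (pointwise λ n → solve 2 (λ a b → let v = con 1ℚ :- a :+ (con 1ℚ :- b) in
                (a :+ b) :* (con (+ 2 / 1) :+ v) := con (+ 4 / 1) :- v :* v) refl (seq α n) (seq β n))
              (nonNeg-* (nonNeg-+ (pos⇒nonNeg 0<α) (pos⇒nonNeg 0<β)) (nonNeg-+ (nonNeg-const 2) (nonNeg-+ (pos⇒nonNeg α<1) (pos⇒nonNeg β<1)))))
            (W≤4 (b≤0 b≡-2) (-3≤b b≡-2))))
    where
    open Pair -[1+ 1 ] c d d′ b≡-2 c≤ no-root α 0<α α<1 root p q r
    open Conjugate 0<β β<1 root′ α≉β
    β v γ : ℝ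
    β = ev p q r α
    v = (1ᴿ ⊖ α) +ᴿ (1ᴿ ⊖ β)
    γ = α +ᴿ β ⊖ 1ᴿ
    open ConjugateDifference (fromℤ -[1+ 1 ]) (fromℤ c) α β ρ 0≤e 0<α α<1 0<β β<1 disc-β ρDα<0
  opposite-orientation c d d′ b≡-3 c≤ no-root α 0<α α<1 root p q r 0<β β<1 root′ α≉β ρDα<0 =
      product-bound (norm₁ -[1+ 1 ]) (norm₁ -[1+ 2 ]) (-ᴿ (v *ᴿ (v *ᴿ v ⊖ W))) (-ᴿ ((v +ᴿ 1ᴿ) *ᴿ ((two ⊖ v) *ᴿ (two ⊖ v) ⊖ W)))
        (combination-norm-integer (+ 1) -[1+ 1 ] sum-irrational) (combination-norm-integer (+ 1) -[1+ 2 ] sum-irrational)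
        (combination-norm≢0 (+ 1) -[1+ 1 ] sum-irrational) (combination-norm≢0 (+ 1) -[1+ 2 ] sum-irrational)
        (≈-trans (combination-norm-disc (+ 1) -[1+ 1 ] 0ℚ refl) (pointwise λ n → solve 4 (λ a b D ρ → let
            γ = b :+ con 1ℚ :* a :+ con (fromℤ -[1+ 1 ])
            t = con 0ℚ :- γ
            s = ρ :+ con 1ℚ
            v = con 1ℚ :- a :+ (con 1ℚ :- b)
          in γ :* (t :* t :- D :* (s :* s)) := :- (v :* (v :* v :- D :* (s :* s)))) refl (seq α n) (seq β n) (seq Dα n) (seq ρ n)))
        (≈-trans (combination-norm-disc (+ 1) -[1+ 2 ] (fromℤ -[1+ 2 ]) refl) (pointwise λ n → solve 4 (λ a b D ρ → let
            γ = b :+ con 1ℚ :* a :+ con (fromℤ -[1+ 2 ])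
            t = con (fromℤ -[1+ 2 ]) :- γ
            s = ρ :+ con 1ℚ
            v = con 1ℚ :- a :+ (con 1ℚ :- b)
          in γ :* (t :* t :- D :* (s :* s)) := :- ((v :+ con 1ℚ) :* ((con (+ 2 / 1) :- v) :* (con (+ 2 / 1) :- v) :- D :* (s :* s))))
          refl (seq α n) (seq β n) (seq Dα n) (seq ρ n)))
        (v *ᴿ (v *ᴿ v ⊖ W) *ᴿ ((v +ᴿ 1ᴿ) *ᴿ ((two ⊖ v) *ᴿ (two ⊖ v) ⊖ W)))
        (pointwise λ n → solve 2 (λ m n → :- m :* :- n := m :* n) refl
          (seq (v *ᴿ (v *ᴿ v ⊖ W)) n) (seq ((v +ᴿ 1ᴿ) *ᴿ ((two ⊖ v) *ᴿ (two ⊖ v) ⊖ W)) n))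
        (sum-product-bound v x W (pos-+ α<1 β<1)
          (pos-resp (pointwise λ n → solve 2 (λ a b → a :+ b := con (+ 2 / 1) :- (con 1ℚ :- a :+ (con 1ℚ :- b))) refl (seq α n) (seq β n)) (pos-+ 0<α 0<β))
          0≤W
          -- For b = -3 the factor `K` is `-3v`, the mirror image of `3u` for b = 0.
          (nonNeg-resp (pointwise λ n → solve 3 (λ a b W → let
                x = b :- a
                K = con (fromℤ -[1+ 2 ]) :+ con (fromℤ -[1+ 2 ]) :+ con (+ 3 / 1) :* (a :+ b)
                v = con 1ℚ :- a :+ (con 1ℚ :- b)
              in x :* x :* (K :* K) :- con (+ 16 / 1) :* W := con (+ 9 / 1) :* (x :* x :* (v :* v)) :- con (+ 16 / 1) :* W)
            refl (seq α n) (seq β n) (seq W n)) 16W≤x²K²)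
          x²≤1
          (nonNeg-resp (pointwise λ n → solve 2 (λ a b → let v = con 1ℚ :- a :+ (con 1ℚ :- b) in
              con (+ 4 / 1) :* (a :* b) := (con (+ 2 / 1) :- v) :* (con (+ 2 / 1) :- v) :- (b :- a) :* (b :- a)) refl (seq α n) (seq β n))
            (nonNeg-* (nonNeg-const 4) (nonNeg-* (pos⇒nonNeg 0<α) (pos⇒nonNeg 0<β)))))
    where
    open Pair -[1+ 2 ] c d d′ b≡-3 c≤ no-root α 0<α α<1 root p q r
    open Conjugate 0<β β<1 root′ α≉β
    β v : ℝ
    β = ev p q r α
    v = (1ᴿ ⊖ α) +ᴿ (1ᴿ ⊖ β)
    open ConjugateDifference (fromℤ -[1+ 2 ]) (fromℤ c) α β ρ 0≤e 0<α α<1 0<β β<1 disc-β ρDα<0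
    norm₁ : ℤ → ℚ
    norm₁ k = combination-norm (+ 1) k

  -- If α and β differed, `ρ Dα` could be neither positive nor negative, hence would vanish, which
  -- `ρDα≉0` excludes.
  not-in-field : ∀ {b} c d d′ (b-range : SmallCoefficient b) (c≤ : c ℤ.≤ ℤ.- b ℤ.- + 3)
    (no-root : ∀ x → ¬ cubicℚ (fromℤ b) (fromℤ c) (fromℤ d) x ≡ 0ℚ)
    (α : ℝ) (0<α : Pos α) (α<1 : Pos (1ᴿ ⊖ α)) (root : cubicᴿ (fromℤ b) (fromℤ c) (fromℤ d) α ≈ᴿ 0ᴿ)
    (p q r : ℚ) (0<β : Pos (ev p q r α)) (β<1 : Pos (1ᴿ ⊖ ev p q r α))
    (root′ : cubicᴿ (fromℤ b) (fromℤ c) (fromℤ d′) (ev p q r α) ≈ᴿ 0ᴿ) → α ≈ᴿ ev p q r α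
  not-in-field {b} c d d′ b-range c≤ no-root α 0<α α<1 root p q r 0<β β<1 root′ = ≈-stable λ α≉β →
    let open Pair b c d d′ b-range c≤ no-root α 0<α α<1 root p q r
        open Conjugate 0<β β<1 root′ α≉β
    in ρDα≉0 (trichotomy same-orientation
         (opposite-orientation c d d′ b-range c≤ no-root α 0<α α<1 root p q r 0<β β<1 root′ α≉β))

-- Real conjugates and uniqueness of the root in (0, 1).

module TotallyReal where
  open RationalArithmetic
  open Conjugates
  open CubicField
  open CubicForms
  open Inequalities
  open Reals

  re-cubic im-cubic : (b c d : ℚ) (u v : ℝ) → ℝ
  re-cubic b c d u v = cubicᴿ b c d u ⊖ (fromℚᴿ (+ 3 / 1) *ᴿ u +ᴿ fromℚᴿ b) *ᴿ (v *ᴿ v)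
  im-cubic b c d u v = v *ᴿ (fromℚᴿ (+ 3 / 1) *ᴿ (u *ᴿ u) ⊖ v *ᴿ v +ᴿ fromℚᴿ (+ 2 / 1) *ᴿ (fromℚᴿ b *ᴿ u) +ᴿ fromℚᴿ c)

  re-eval : ∀ b c d w → re (eval (d ∷ c ∷ b ∷ []) w) ≈ᴿ re-cubic b c d (re w) (im w)
  re-eval b c d w = pointwise λ n → solve 5 (λ b c d u v → let
        r₁ = b :+ (u :* con 1ℚ :+ :- (v :* con 0ℚ))
        i₁ = con 0ℚ :+ (u :* con 0ℚ :+ v :* con 1ℚ)
        r₂ = c :+ (u :* r₁ :+ :- (v :* i₁))
        i₂ = con 0ℚ :+ (u :* i₁ :+ v :* r₁)
      in d :+ (u :* r₂ :+ :- (v :* i₂)) := :cubic b c d u :- (con (+ 3 / 1) :* u :+ b) :* (v :* v))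
    refl b c d (seq (re w) n) (seq (im w) n)

  im-eval : ∀ b c d w → im (eval (d ∷ c ∷ b ∷ []) w) ≈ᴿ im-cubic b c d (re w) (im w)
  im-eval b c d w = pointwise λ n → solve 5 (λ b c d u v → let
        r₁ = b :+ (u :* con 1ℚ :+ :- (v :* con 0ℚ))
        i₁ = con 0ℚ :+ (u :* con 0ℚ :+ v :* con 1ℚ)
        r₂ = c :+ (u :* r₁ :+ :- (v :* i₁))
        i₂ = con 0ℚ :+ (u :* i₁ :+ v :* r₁)
      in con 0ℚ :+ (u :* i₂ :+ v :* r₂) :=
        v :* (con (+ 3 / 1) :* (u :* u) :- v :* v :+ con (+ 2 / 1) :* (b :* u) :+ c))
    refl b c d (seq (re w) n) (seq (im w) n)

  real-root : ∀ {b c d x} → ι x IsRootOf (d ∷ c ∷ b ∷ []) → cubicᴿ b c d x ≈ᴿ 0ᴿ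
  real-root {b} {c} {d} {x} h = ≈-trans (≈-trans
      (pointwise λ n → solve 4 (λ b c d x → :cubic b c d x := :cubic b c d x :- (con (+ 3 / 1) :* x :+ b) :* (con 0ℚ :* con 0ℚ)) refl b c d (seq x n))
      (≈-sym (re-eval b c d (ι x)))) (re≈ h)

  ι-root : ∀ {b c d x} → cubicᴿ b c d x ≈ᴿ 0ᴿ → ι x IsRootOf (d ∷ c ∷ b ∷ [])
  ι-root {b} {c} {d} {x} h =
    ≈-trans (≈-trans (re-eval b c d (ι x))
      (pointwise λ n → solve 4 (λ b c d x → :cubic b c d x :- (con (+ 3 / 1) :* x :+ b) :* (con 0ℚ :* con 0ℚ) := :cubic b c d x) refl b c d (seq x n))) h
    +i≈ ≈-trans (im-eval b c d (ι x)) (pointwise λ n →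
      *-zeroˡ (seq (fromℚᴿ (+ 3 / 1) *ᴿ (x *ᴿ x) ⊖ 0ᴿ *ᴿ 0ᴿ +ᴿ fromℚᴿ (+ 2 / 1) *ᴿ (fromℚᴿ b *ᴿ x) +ᴿ fromℚᴿ c) n))

  re-eval₂ : ∀ p q x → re (eval (q ∷ p ∷ []) (ι x)) ≈ᴿ ev q p 1ℚ x
  re-eval₂ p q x = pointwise λ n → solve 3 (λ p q x →
      q :+ (x :* (p :+ (x :* con 1ℚ :+ :- (con 0ℚ :* con 0ℚ))) :+ :- (con 0ℚ :* (con 0ℚ :+ (x :* con 0ℚ :+ con 0ℚ :* con 1ℚ)))) := :ev q p (con 1ℚ) x)
    refl p q (seq x n)

  ι-root₂ : ∀ {p q x} → ev q p 1ℚ x ≈ᴿ 0ᴿ → ι x IsRootOf (q ∷ p ∷ [])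
  ι-root₂ {p} {q} {x} h = ≈-trans (re-eval₂ p q x) h +i≈ pointwise λ n → solve 2 (λ p x →
      con 0ℚ :+ (x :* (con 0ℚ :+ (x :* con 0ℚ :+ con 0ℚ :* con 1ℚ)) :+ con 0ℚ :* (p :+ (x :* con 1ℚ :+ :- (con 0ℚ :* con 0ℚ)))) := con 0ℚ)
    refl p (seq x n)

  re-eval₁ : ∀ q x → re (eval (q ∷ []) (ι x)) ≈ᴿ fromℚᴿ q +ᴿ fromℚᴿ 1ℚ *ᴿ x
  re-eval₁ q x = pointwise λ n → solve 2 (λ q x → q :+ (x :* con 1ℚ :+ :- (con 0ℚ :* con 0ℚ)) := q :+ con 1ℚ :* x) refl q (seq x n)

  root-resp : ∀ {b c d b′ c′ d′} w → d′ ≡ d × c′ ≡ c × b′ ≡ b →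
    w IsRootOf (d′ ∷ c′ ∷ b′ ∷ []) → w IsRootOf (d ∷ c ∷ b ∷ [])
  root-resp w (refl , refl , refl) h = h

  no-root₀ : ∀ {z} → ¬ z IsRootOf []
  no-root₀ h = 1≢0 (fromℚ-injective {1ℚ} {0ℚ} (re≈ h))

  module _ (b c d : ℚ) (0≤e : 0ℚ ≤ - b - + 3 / 1 - c) (no-root : ∀ x → ¬ cubicℚ b c d x ≡ 0ℚ)
    (α : ℝ) (0<α : Pos α) (α<1 : Pos (1ᴿ ⊖ α)) (root : cubicᴿ b c d α ≈ᴿ 0ᴿ) where

    open Rootless b c d no-root

    cubic-minimal : ∀ {m} (q : Monic m) → ι α IsRootOf q → 3 ℕ.≤ m
    cubic-minimal [] h = contradiction h (no-root₀ {ι α})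
    cubic-minimal (q ∷ []) h = contradiction (proj₂ (independent₁ α root q 1ℚ (≈-trans (≈-sym (re-eval₁ q α)) (re≈ h)))) 1≢0
    cubic-minimal (q ∷ p ∷ []) h = contradiction (proj₂ (proj₂ (independent α root q p 1ℚ (≈-trans (≈-sym (re-eval₂ p q α)) (re≈ h))))) 1≢0
    cubic-minimal (_ ∷ _ ∷ _ ∷ _) _ = s≤s (s≤s (s≤s z≤n))

    cubic-unique : ∀ {b′ c′ d′} → ι α IsRootOf (d′ ∷ c′ ∷ b′ ∷ []) → d′ ≡ d × c′ ≡ c × b′ ≡ b
    cubic-unique {b′} {c′} {d′} h = coordinates-unique α root {d′} {c′} {b′} {d} {c} {b}
      (modulo₂ (real-root h) 1ᴿ root (-ᴿ 1ᴿ) λ n →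
        solve 7 (λ b c d b′ c′ d′ a → :ev d′ c′ b′ a := :ev d c b a :+ con 1ℚ :* :cubic b′ c′ d′ a :+ :- con 1ℚ :* :cubic b c d a) refl b c d b′ c′ d′ (seq α n))

    -- If u + iv is a root with v ≠ 0, the third root is x = -2u - b, and
    -- disc x = -4v².  But disc x ≥ 0 both when x = α and, as disc x is then the
    -- square of 2α + b + x, when x ≠ α.
    real-roots : ∀ w → w IsRootOf (d ∷ c ∷ b ∷ []) → IsReal w
    real-roots w h = ≈0-stable λ v≉0 →
      let F≈0 = integral-domain (≈-trans (≈-sym (im-eval b c d w)) (im≈ h)) v≉0
          v²>0 : ¬ ¬ Pos (v *ᴿ v)
          v²>0 v²≯0 = v≉0 (integral-domain (trichotomy v²≯0 (NonNeg.not-neg (nonNeg-square v))) v≉0)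
          re≈0 = ≈-trans (≈-sym (re-eval b c d w)) (re≈ h)
          x-root : cubicᴿ b c d x ≈ᴿ 0ᴿ
          x-root = modulo₂ re≈0 1ᴿ F≈0 (-ᴿ (fromℚᴿ (+ 3 / 1) *ᴿ u +ᴿ fromℚᴿ b)) λ n →
            solve 5 (λ b c d u v → let s = con (+ 3 / 1) :* u :+ b in
              :cubic b c d (:- (u :+ u) :- b) := con 0ℚ :+ con 1ℚ :* (:cubic b c d u :- s :* (v :* v))
                :+ :- s :* (con (+ 3 / 1) :* (u :* u) :- v :* v :+ con (+ 2 / 1) :* (b :* u) :+ c)) refl b c d (seq u n) (seq v n)
          disc-x : discᴿ b c x ≈ᴿ -ᴿ (fromℚᴿ four *ᴿ (v *ᴿ v))
          disc-x = modulo F≈0 (-ᴿ fromℚᴿ four) λ n →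
            solve 4 (λ b c u v → :disc b c (:- (u :+ u) :- b) := :- (con four :* (v :* v))
              :+ :- con four :* (con (+ 3 / 1) :* (u :* u) :- v :* v :+ con (+ 2 / 1) :* (b :* u) :+ c)) refl b c (seq u n) (seq v n)
          x≉α : ¬ x ⊖ α ≈ᴿ 0ᴿ
          x≉α x-α≈0 = v²>0 λ pos-v² → ¬pos-0
            (modulo₂ (-≈0 disc-x) 1ᴿ x-α≈0 (-ᴿ (fromℚᴿ b +ᴿ fromℚᴿ b +ᴿ fromℚᴿ (+ 3 / 1) *ᴿ (x +ᴿ α)) *ᴿ -ᴿ 1ᴿ) λ n →
              solve 5 (λ b c α v x → con four :* (v :* v) :+ :disc b c α
                := con 0ℚ :+ con 1ℚ :* (:disc b c x :- :- (con four :* (v :* v))) :+ :- (b :+ b :+ con (+ 3 / 1) :* (x :+ α)) :* :- con 1ℚ :* (x :- α))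
                refl b c (seq α n) (seq v n) (seq x n))
            (pos-+ (pos-* (pos-fromℚ 0<four) pos-v²) (disc>0 b c α 0≤e 0<α α<1))
          Q≈0 : Q ≈ᴿ 0ᴿ
          Q≈0 = integral-domain (modulo₂ x-root 1ᴿ root (-ᴿ 1ᴿ) λ n →
            solve 5 (λ b c d α x → (x :- α) :* (x :* x :+ α :* x :+ α :* α :+ b :* (x :+ α) :+ c)
              := con 0ℚ :+ con 1ℚ :* :cubic b c d x :+ :- con 1ℚ :* :cubic b c d α) refl b c d (seq α n) (seq x n)) x≉α
      in v²>0 λ pos-v² → ¬pos-0
        (modulo₂ (-≈0 disc-x) 1ᴿ Q≈0 (fromℚᴿ four) λ n →
          solve 5 (λ b c α v x → con four :* (v :* v) :+ (α :+ α :+ b :+ x) :* (α :+ α :+ b :+ x)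
            := con 0ℚ :+ con 1ℚ :* (:disc b c x :- :- (con four :* (v :* v))) :+ con four :* (x :* x :+ α :* x :+ α :* α :+ b :* (x :+ α) :+ c))
            refl b c (seq α n) (seq v n) (seq x n))
        (pos-nonNeg-+ (pos-* (pos-fromℚ 0<four) pos-v²) (nonNeg-square (α +ᴿ α +ᴿ fromℚᴿ b +ᴿ x)))
      where
      u v x Q : ℝ
      u = re w
      v = im w
      x = -ᴿ (u +ᴿ u) ⊖ fromℚᴿ b
      Q = x *ᴿ x +ᴿ α *ᴿ x +ᴿ α *ᴿ α +ᴿ fromℚᴿ b *ᴿ (x +ᴿ α) +ᴿ fromℚᴿ c

    totally-real-cubic : TotallyRealCubic (ι α)
    totally-real-cubic = (d ∷ c ∷ b ∷ [] , is-min-poly) , conjugates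
      where
      is-min-poly : IsMinPoly (d ∷ c ∷ b ∷ []) (ι α)
      is-min-poly = ι-root root , cubic-minimal
      conjugates : ∀ w → w IsConjugateOf (ι α) → IsReal w
      -- Minimality in both directions gives any minimal polynomial of α degree 3, and by
      -- `cubic-unique` it is the given cubic.
      conjugates w (n , p , (p-root , p-min) , w-root) = go p (ℕₚ.≤-antisym (p-min (d ∷ c ∷ b ∷ []) (ι-root root)) (cubic-minimal p p-root)) p-root w-root
        where
        go : ∀ {n} (p : Monic n) → n ≡ 3 → ι α IsRootOf p → w IsRootOf p → IsReal w
        go (d′ ∷ c′ ∷ b′ ∷ []) refl p-root w-root =
          real-roots w (root-resp w (cubic-unique p-root) w-root)

  module _ (b c d : ℚ) (0≤e : 0ℚ ≤ - b - + 3 / 1 - c) (b≤0 : 0ℚ ≤ - b) (-3≤b : 0ℚ ≤ + 3 / 1 + b) where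

    private
      3-quadratic>0 : ∀ x y → Pos x → Pos (1ᴿ ⊖ x) → Pos y → Pos (1ᴿ ⊖ y) →
        Pos (fromℚᴿ (+ 3 / 1) ⊖ (x *ᴿ x +ᴿ x *ᴿ y +ᴿ y *ᴿ y))
      3-quadratic>0 x y 0<x x<1 0<y y<1 = pos-resp
        (pointwise λ n → solve 2 (λ x y →
          (con 1ℚ :- x) :+ x :* (con 1ℚ :- x) :+ ((con 1ℚ :- y) :+ y :* (con 1ℚ :- y)) :+ ((con 1ℚ :- x) :+ x :* (con 1ℚ :- y))
          := con (+ 3 / 1) :- (x :* x :+ x :* y :+ y :* y)) refl (seq x n) (seq y n))
        (pos-+ (pos-+ (pos-+ x<1 (pos-* 0<x x<1)) (pos-+ y<1 (pos-* 0<y y<1))) (pos-+ x<1 (pos-* 0<x y<1)))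

    -- The slope of the cubic between α and β is `-Q`. Being affine in b, `Q` is a mean of its shape
    -- `P₁` at b = 0 and the reflected `P₂` at b = -3, with weights `(3 + b)/3` and `-b/3`, plus the
    -- slack `-b - 3 - c`.
    unit-root-unique : ∀ α β → Pos α → Pos (1ᴿ ⊖ α) → Pos β → Pos (1ᴿ ⊖ β) →
      cubicᴿ b c d α ≈ᴿ 0ᴿ → cubicᴿ b c d β ≈ᴿ 0ᴿ → α ≈ᴿ β
    unit-root-unique α β 0<α α<1 0<β β<1 root-α root-β = modulo α-β≈0 1ᴿ λ n →
        solve 2 (λ a b → a := b :+ con 1ℚ :* (a :- b)) refl (seq α n) (seq β n)
      where
      Q P₁ P₂ α′ β′ : ℝ
      Q = -ᴿ (α *ᴿ α +ᴿ α *ᴿ β +ᴿ β *ᴿ β +ᴿ fromℚᴿ b *ᴿ (α +ᴿ β) +ᴿ fromℚᴿ c)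
      α′ = 1ᴿ ⊖ α
      β′ = 1ᴿ ⊖ β
      P₁ = fromℚᴿ (+ 3 / 1) ⊖ (α *ᴿ α +ᴿ α *ᴿ β +ᴿ β *ᴿ β)
      P₂ = fromℚᴿ (+ 3 / 1) ⊖ (α′ *ᴿ α′ +ᴿ α′ *ᴿ β′ +ᴿ β′ *ᴿ β′)
      involutive : ∀ {x} → Pos x → Pos (1ᴿ ⊖ (1ᴿ ⊖ x))
      involutive {x} = pos-resp (pointwise λ n → solve 1 (λ x → x := con 1ℚ :- (con 1ℚ :- x)) refl (seq x n))
      P₁>0 : Pos P₁
      P₁>0 = 3-quadratic>0 α β 0<α α<1 0<β β<1
      P₂>0 : Pos P₂
      P₂>0 = 3-quadratic>0 α′ β′ α<1 (involutive 0<α) β<1 (involutive 0<β)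
      -- The weights are nonnegative with sum 3, so at least one is positive.
      combination>0 : Pos (fromℚᴿ (+ 3 / 1 + b) *ᴿ P₁ +ᴿ fromℚᴿ (- b) *ᴿ P₂)
      combination>0 with 0ℚ <? - b
      ... | yes 0<-b = pos-resp (pointwise λ n → +-comm (- b * seq P₂ n) ((+ 3 / 1 + b) * seq P₁ n))
              (pos-nonNeg-+ (pos-* (pos-fromℚ 0<-b) P₂>0) (nonNeg-* (nonNeg-fromℚ -3≤b) (pos⇒nonNeg P₁>0)))
      ... | no 0≮-b = pos-nonNeg-+ (pos-* (pos-fromℚ 0<3+b) P₁>0) (nonNeg-* (nonNeg-fromℚ b≤0) (pos⇒nonNeg P₂>0))
        where
        0<3+b : 0ℚ < + 3 / 1 + b
        0<3+b = <-≤-trans (toWitness {a? = 0ℚ <? + 3 / 1} _) (subst (+ 3 / 1 ≤_)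
          (solve 1 (λ b → con (+ 3 / 1) :+ :- (:- b) := con (+ 3 / 1) :+ b) refl b)
          (subst (_≤ + 3 / 1 + - (- b)) (+-identityʳ (+ 3 / 1)) (+-monoʳ-≤ (+ 3 / 1) (neg-antimono-≤ (≮⇒≥ 0≮-b)))))
      Q>0 : Pos Q
      Q>0 = pos-resp (pointwise λ n → solve 4 (λ b c x y → let
            x′ = con 1ℚ :- x
            y′ = con 1ℚ :- y
          in con (+ 1 / 3) :* ((con (+ 3 / 1) :+ b) :* (con (+ 3 / 1) :- (x :* x :+ x :* y :+ y :* y))
              :+ :- b :* (con (+ 3 / 1) :- (x′ :* x′ :+ x′ :* y′ :+ y′ :* y′)) :+ con (+ 3 / 1) :* (:- b :- con (+ 3 / 1) :- c))
            := :- (x :* x :+ x :* y :+ y :* y :+ b :* (x :+ y) :+ c)) refl b c (seq α n) (seq β n))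
        (pos-* (pos-fromℚ {+ 1 / 3} (toWitness {a? = 0ℚ <? + 1 / 3} _)) (pos-nonNeg-+ combination>0 (nonNeg-* (nonNeg-const 3) (nonNeg-fromℚ 0≤e))))
      α-β≈0 : α ⊖ β ≈ᴿ 0ᴿ
      α-β≈0 = integral-domain {x = Q} (modulo₂ root-α (-ᴿ 1ᴿ) root-β 1ᴿ λ n →
        solve 5 (λ b c d x y → :- (x :* x :+ x :* y :+ y :* y :+ b :* (x :+ y) :+ c) :* (x :- y)
          := con 0ℚ :+ :- con 1ℚ :* :cubic b c d x :+ con 1ℚ :* :cubic b c d y) refl b c d (seq α n) (seq β n)) (pos⇒≉0 Q>0)

-- Roots of quadratics by bisection.

module Bisection where
  open import Data.Nat using (_⊔_)
  open RationalArithmetic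
  open CubicField
  open CubicForms
  open Inequalities
  open Integrality
  open Reals

  0≤-* : ∀ {p q} → 0ℚ ≤ p → 0ℚ ≤ q → 0ℚ ≤ p * q
  0≤-* {p} {q} hp hq = nonNegative⁻¹ (p * q) {{nonNeg*nonNeg⇒nonNeg p {{nonNegative hp}} q {{nonNegative hq}}}}

  -- Eventually `y` stays below some `B`, so `q < x y` forces `x` above `q / B`.
  pos-factor : ∀ x y → (∀ n → 0ℚ ≤ seq x n) → Pos (x *ᴿ y) → Pos x
  pos-factor x y 0≤x (mkPos q 0<q (M , h)) =
    let B , 0<B , N , y<B = eventually-bounded y
        δ , 0<δ , Bδ≡q = fraction 0<B 0<q
    in mkPos δ 0<δ (M ⊔ N , λ n p → ≰⇒> λ x≤δ → <-irrefl refl (<-≤-trans (h n (ℕₚ.m⊔n≤o⇒m≤o M N p))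
        (≤-trans (subst (_≤ B * seq x n) (*-comm (seq y n) (seq x n))
            (*-monoʳ-≤-nonNeg (seq x n) {{nonNegative (0≤x n)}} (<⇒≤ (∣p∣<-upper (y<B n (ℕₚ.m⊔n≤o⇒n≤o M N p))))))
          (subst (B * seq x n ≤_) Bδ≡q (*-monoˡ-≤-nonNeg B {{nonNegative (<⇒≤ 0<B)}} x≤δ)))))

  width : ℕ → ℚ
  width zero = 1ℚ
  width (suc n) = ½ * width n

  0<width : ∀ n → 0ℚ < width n
  0<width zero = toWitness {a? = 0ℚ <? 1ℚ} _
  0<width (suc n) = 0<½* (0<width n)

  fromℕ : ℕ → ℚ
  fromℕ n = fromℤ (+ n)

  fromℕ-suc : ∀ n → fromℕ (suc n) ≡ 1ℚ + fromℕ n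
  fromℕ-suc n = fromℤ-+ (+ 1) (+ n)

  0≤fromℕ : ∀ n → 0ℚ ≤ fromℕ n
  0≤fromℕ n = fromℤ-mono-≤ {+ 0} {+ n} (ℤ.+≤+ ℕ.z≤n)

  width-bound : ∀ n → (1ℚ + fromℕ n) * width n ≤ 1ℚ
  width-bound zero = ≤-refl
  width-bound (suc n) = ≤-trans (0≤q-p⇒p≤q (subst (0ℚ ≤_) eq (0≤-* (0≤-* (<⇒≤ (toWitness {a? = 0ℚ <? ½} _)) (0≤fromℕ n)) (<⇒≤ (0<width n)))))
      (width-bound n)
    where
    eq : ½ * fromℕ n * width n ≡ (1ℚ + fromℕ n) * width n - (1ℚ + fromℕ (suc n)) * (½ * width n)
    eq = trans (solve 2 (λ c w → con ½ :* c :* w := (con 1ℚ :+ c) :* w :- (con 1ℚ :+ (con 1ℚ :+ c)) :* (con ½ :* w)) refl (fromℕ n) (width n))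
      (cong (λ c → (1ℚ + fromℕ n) * width n - (1ℚ + c) * (½ * width n)) (sym (fromℕ-suc n)))

  width-null : ∀ ε → 0ℚ < ε → ∃[ N ] (∀ n → N ℕ.≤ n → width n < ε)
  -- The denominator of `ε` serves as modulus: `ε` is at least its reciprocal, while `width n` is at
  -- most `1/(1 + n)`.
  width-null ε 0<ε = ℚ.denominatorℕ ε , λ n N≤n → *-cancelˡ-<-nonNeg (1ℚ + fromℕ n) {{nonNegative (<⇒≤ (0<1+ n))}}
      (≤-<-trans (width-bound n) (1<cε n N≤n))
    where
    0<1+ : ∀ n → 0ℚ < 1ℚ + fromℕ n
    0<1+ n = +-mono-<-≤ (toWitness {a? = 0ℚ <? 1ℚ} _) (0≤fromℕ n)
    1≤↥ε : 1ℚ ≤ fromℤ (↥ ε)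
    1≤↥ε = fromℤ-mono-≤ {+ 1} {↥ ε} (1≤ (↥ ε) (fromℤ-cancel-< {+ 0} {↥ ε} (subst (0ℚ <_) (denominator-clears ε)
        (0<-* (<-≤-trans (toWitness {a? = 0ℚ <? 1ℚ} _) (fromℤ-mono-≤ {+ 1} {↧ ε} (ℤ.+≤+ (ℕ.s≤s ℕ.z≤n)))) 0<ε))))
      where
      1≤ : ∀ z → + 0 ℤ.< z → + 1 ℤ.≤ z
      1≤ (+ suc n) _ = ℤ.+≤+ (ℕ.s≤s ℕ.z≤n)
      1≤ (+ zero) (ℤ.+<+ ())
    1<cε : ∀ n → ℚ.denominatorℕ ε ℕ.≤ n → 1ℚ < (1ℚ + fromℕ n) * ε
    1<cε n N≤n = begin-strict
        1ℚ                       ≤⟨ 1≤↥ε ⟩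
        fromℤ (↥ ε)              ≡⟨ denominator-clears ε ⟨
        fromℤ (↧ ε) * ε          ≤⟨ *-monoʳ-≤-nonNeg ε {{nonNegative (<⇒≤ 0<ε)}} (fromℤ-mono-≤ {↧ ε} {+ n} (ℤ.+≤+ N≤n)) ⟩
        fromℕ n * ε              <⟨ 0<q-p⇒p<q (subst (0ℚ <_) (solve 2 (λ c e → e := (con 1ℚ :+ c) :* e :- c :* e) refl (fromℕ n) ε) 0<ε) ⟩
        (1ℚ + fromℕ n) * ε       ∎
      where open ≤-Reasoning

  -- The leading coefficient is free, so that a monic quadratic positive at 0 and negative at 1 can
  -- be negated first.
  module Bisect (a b c : ℚ) (c<0 : c < 0ℚ) (0<s : 0ℚ < c + b + a) where

    value : ℚ → ℚ
    value x = evℚ c b a x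

    step : ℚ → ℚ → ℚ
    step x h with value (x + h) <? 0ℚ
    ... | yes _ = x + h
    ... | no  _ = x

    lower : ℕ → ℚ
    lower zero = 0ℚ
    lower (suc n) = step (lower n) (width (suc n))

    halves : ∀ n → width (suc n) + width (suc n) ≡ width n
    halves n = solve 1 (λ w → con ½ :* w :+ con ½ :* w := w) refl (width n)

    step-lower : ∀ x h → value x < 0ℚ → value (step x h) < 0ℚ
    step-lower x h v with value (x + h) <? 0ℚ
    ... | yes v′ = v′
    ... | no  _  = v

    step-upper : ∀ x h → 0ℚ ≤ value (x + (h + h)) → 0ℚ ≤ value (step x h + h)
    step-upper x h v with value (x + h) <? 0ℚ
    ... | yes _ = subst (λ z → 0ℚ ≤ value z) (sym (+-assoc x h h)) v
    ... | no v≮ = ≮⇒≥ v≮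

    step-increases : ∀ x h → 0ℚ < h → x ≤ step x h
    step-increases x h 0<h with value (x + h) <? 0ℚ
    ... | yes _ = 0≤q-p⇒p≤q (subst (0ℚ ≤_) (solve 2 (λ x h → h := x :+ h :- x) refl x h) (<⇒≤ 0<h))
    ... | no  _ = ≤-refl

    step-decreases : ∀ x h → 0ℚ < h → step x h + h ≤ x + (h + h)
    step-decreases x h 0<h with value (x + h) <? 0ℚ
    ... | yes _ = ≤-reflexive (+-assoc x h h)
    ... | no  _ = 0≤q-p⇒p≤q (subst (0ℚ ≤_) (solve 2 (λ x h → h := x :+ (h :+ h) :- (x :+ h)) refl x h) (<⇒≤ 0<h))

    value-lower : ∀ n → value (lower n) < 0ℚ
    value-lower zero = subst (_< 0ℚ) (solve 3 (λ a b c → c := :ev c b a (con 0ℚ)) refl a b c) c<0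
    value-lower (suc n) = step-lower (lower n) (width (suc n)) (value-lower n)

    value-upper : ∀ n → 0ℚ ≤ value (lower n + width n)
    value-upper zero = subst (0ℚ ≤_) (solve 3 (λ a b c → c :+ b :+ a := :ev c b a (con 0ℚ :+ con 1ℚ)) refl a b c) (<⇒≤ 0<s)
    value-upper (suc n) = step-upper (lower n) (width (suc n)) (subst (λ w → 0ℚ ≤ value (lower n + w)) (sym (halves n)) (value-upper n))

    lower-≤ : ∀ k j → lower k ≤ lower (j ℕ.+ k)
    lower-≤ k zero = ≤-refl
    lower-≤ k (suc j) = ≤-trans (lower-≤ k j) (step-increases (lower (j ℕ.+ k)) (width (suc (j ℕ.+ k))) (0<width (suc (j ℕ.+ k))))

    upper-≥ : ∀ k j → lower (j ℕ.+ k) + width (j ℕ.+ k) ≤ lower k + width k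
    upper-≥ k zero = ≤-refl
    upper-≥ k (suc j) = ≤-trans (subst (λ w → lower (suc (j ℕ.+ k)) + width (suc (j ℕ.+ k)) ≤ lower (j ℕ.+ k) + w) (halves (j ℕ.+ k))
        (step-decreases (lower (j ℕ.+ k)) (width (suc (j ℕ.+ k))) (0<width (suc (j ℕ.+ k)))))
      (upper-≥ k j)

    nested : ∀ {k m} → k ℕ.≤ m → lower k ≤ lower m × lower m < lower k + width k
    nested {k} {m} k≤m = subst (λ m → lower k ≤ lower m × lower m < lower k + width k) (ℕₚ.m∸n+n≡m k≤m)
      (lower-≤ k j , <-≤-trans (0<q-p⇒p<q (subst (0ℚ <_) (solve 2 (λ x w → w := x :+ w :- x) refl (lower (j ℕ.+ k)) (width (j ℕ.+ k))) (0<width (j ℕ.+ k)))) (upper-≥ k j))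
      where j = m ℕ.∸ k

    lower-cauchy : Cauchy lower
    lower-cauchy ε 0<ε =
      let N , h = width-null ε 0<ε
      in N , λ m n N≤m N≤n → within N (h N ℕₚ.≤-refl) m n (nested N≤m) (nested N≤n)
      where
      within : ∀ N → width N < ε → ∀ m n → lower N ≤ lower m × lower m < lower N + width N →
        lower N ≤ lower n × lower n < lower N + width N → ∣ lower m - lower n ∣ < ε
      within N w<ε m n (l≤m , m<u) (l≤n , n<u) = ∣p∣<-intro
        (0<q-p⇒p<q (subst (0ℚ <_) (solve 5 (λ l w ε x y → (l :+ w :- y) :+ (x :- l) :+ (ε :- w) := (x :- y) :- :- ε) refl (lower N) (width N) ε (lower m) (lower n))
          (0<-+ (+-mono-<-≤ (p<q⇒0<q-p n<u) (p≤q⇒0≤q-p l≤m)) (p<q⇒0<q-p w<ε))))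
        (0<q-p⇒p<q (subst (0ℚ <_) (solve 5 (λ l w ε x y → (l :+ w :- x) :+ (y :- l) :+ (ε :- w) := ε :- (x :- y)) refl (lower N) (width N) ε (lower m) (lower n))
          (0<-+ (+-mono-<-≤ (p<q⇒0<q-p m<u) (p≤q⇒0≤q-p l≤n)) (p<q⇒0<q-p w<ε))))

    root : ℝ
    root = mkℝ lower lower-cauchy

    0≤lower : ∀ n → 0ℚ ≤ lower n
    0≤lower n = proj₁ (nested {0} {n} ℕ.z≤n)

    lower≤1 : ∀ n → lower n ≤ 1ℚ
    lower≤1 n = <⇒≤ (proj₂ (nested {0} {n} ℕ.z≤n))

    width-real : ℝ
    width-real = mkℝ width λ ε 0<ε → let N , h = width-null ε 0<ε in N , λ m n N≤m N≤n →
      ∣p∣<-intro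
        (0<q-p⇒p<q (subst (0ℚ <_) (solve 3 (λ x y ε → x :+ (ε :- y) := x :- y :- :- ε) refl (width m) (width n) ε) (0<-+ (0<width m) (p<q⇒0<q-p (h n N≤n)))))
        (0<q-p⇒p<q (subst (0ℚ <_) (solve 3 (λ x y ε → y :+ (ε :- x) := ε :- (x :- y)) refl (width m) (width n) ε) (0<-+ (0<width n) (p<q⇒0<q-p (h m N≤m)))))

    width≈0 : width-real ≈ᴿ 0ᴿ
    width≈0 = mk≈ λ ε 0<ε → let N , h = width-null ε 0<ε in N , λ n N≤n →
      ∣p∣<-intro
        (0<q-p⇒p<q (subst (0ℚ <_) (solve 2 (λ x ε → x :+ ε := x :- con 0ℚ :- :- ε) refl (width n) ε) (0<-+ (0<width n) 0<ε)))
        (subst (_< ε) (sym (+-identityʳ (width n))) (h n N≤n))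

    nonNeg-pointwise : ∀ {x} → (∀ n → 0ℚ ≤ seq x n) → NonNeg x
    nonNeg-pointwise h = mkNonNeg λ where
      (mkPos q 0<q (N , g)) → <-irrefl refl (<-≤-trans 0<q (≤-trans (<⇒≤ (g N ℕₚ.≤-refl)) (neg-antimono-≤ (h N))))

    -- The value at the root is the limit of the values at the lower ends, which
    -- are negative, and also of those at the upper ends, which are nonnegative.
    is-root : ev c b a root ≈ᴿ 0ᴿ
    is-root = trichotomy
      (λ p → NonNeg.not-neg -value≥0 (pos-resp (≈-sym (neg-neg (ev c b a root))) p))
      (NonNeg.not-neg (nonNeg-resp upper≈ (nonNeg-pointwise {ev c b a (root +ᴿ width-real)} value-upper)))
      where
      -value≥0 : NonNeg (-ᴿ ev c b a root)
      -value≥0 = nonNeg-pointwise λ n → neg-antimono-≤ (<⇒≤ (value-lower n))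
      upper≈ : ev c b a (root +ᴿ width-real) ≈ᴿ ev c b a root
      upper≈ = modulo width≈0 (fromℚᴿ b +ᴿ fromℚᴿ a *ᴿ (root +ᴿ root +ᴿ width-real)) λ n →
        solve 5 (λ a b c x w → :ev c b a (x :+ w) := :ev c b a x :+ (b :+ a :* (x :+ x :+ w)) :* w) refl a b c (lower n) (width n)

    -- The approximations may stay at 0 for long, so the positive lower bound comes from the
    -- equation: `root · (b + a · root) = -c`, which is positive.
    0<root : Pos root
    0<root = pos-factor root (fromℚᴿ b +ᴿ fromℚᴿ a *ᴿ root) 0≤lower (pos-resp
      (≈-sym (modulo is-root 1ᴿ λ n → solve 4 (λ a b c x → x :* (b :+ a :* x) := :- c :+ con 1ℚ :* :ev c b a x) refl a b c (lower n)))
      (pos-fromℚ {q = - c} (neg-antimono-< c<0)))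

    root<1 : Pos (1ᴿ ⊖ root)
    root<1 = pos-factor (1ᴿ ⊖ root) (fromℚᴿ b +ᴿ fromℚᴿ a *ᴿ (1ᴿ +ᴿ root)) (λ n → p≤q⇒0≤q-p (lower≤1 n)) (pos-resp
      (≈-sym (modulo is-root (-ᴿ 1ᴿ) λ n → solve 4 (λ a b c x → (con 1ℚ :- x) :* (b :+ a :* (con 1ℚ :+ x)) := c :+ b :+ a :+ :- con 1ℚ :* :ev c b a x) refl a b c (lower n)))
      (pos-fromℚ {q = c + b + a} 0<s))

-- Integer roots and the location of c among the special forms.

module IntegerRoots where
  open import Data.Integer hiding (suc)
  open import Data.Integer.Properties
  open import Data.Integer.Solver using (module +-*-Solver)
  open +-*-Solver using (solve; con; _:+_; _:*_; _:-_; :-_; _:=_)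
  open FieldRigidity using (SmallCoefficient; b≡0; b≡-1; b≡-2; b≡-3)

  f g e : (b c n : ℤ) → ℤ
  f b c n = - (n * n) + (b - + 1) * n - + 1
  g b c n = - (n * n) + b * n
  e b c n = c + n * n - b * n

  -- x³ + bx² + cx - (n - b)e = (x - (n - b))(x² + nx + e), with e = c - g and
  -- 1 + n + e = c - f of opposite signs.
  data Split (b c n : ℤ) : Set where
    right : + 2 ≤ n - b → f b c n < c → c < g b c n → Split b c n
    left  : n - b ≤ -1ℤ → g b c n < c → c < f b c n → Split b c n

  i-j<0⇒i<j : ∀ {i j} → i - j < + 0 → i < j
  i-j<0⇒i<j {i} {j} h = subst₂ _<_ (solve 2 (λ i j → i :- j :+ j := i) refl i j) (+-identityˡ j) (+-monoˡ-< j h)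

  0<j-i⇒i<j : ∀ {i j} → + 0 < j - i → i < j
  0<j-i⇒i<j {i} {j} h = subst₂ _<_ (+-identityˡ i) (solve 2 (λ i j → j :- i :+ i := j) refl i j) (+-monoˡ-< i h)

  i<j⇒i-j<0 : ∀ {i j} → i < j → i - j < + 0
  i<j⇒i-j<0 {i} {j} h = subst (i - j <_) (+-inverseʳ j) (+-monoˡ-< (- j) h)

  i<j⇒0<j-i : ∀ {i j} → i < j → + 0 < j - i
  i<j⇒0<j-i {i} {j} h = subst (_< j - i) (+-inverseʳ i) (+-monoˡ-< (- i) h)

  pos*neg : ∀ {i j} → + 0 < i → j < + 0 → i * j < + 0
  pos*neg {i} {j} 0<i j<0 = subst (i * j <_) (*-zeroʳ i) (*-monoˡ-<-pos i {{positive 0<i}} j<0)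

  pos*neg⁻¹ : ∀ {i j} → + 0 < i → i * j < + 0 → j < + 0
  pos*neg⁻¹ {i} {j} 0<i h = *-cancelˡ-<-nonNeg i {{nonNegative (<⇒≤ 0<i)}} (subst (i * j <_) (sym (*-zeroʳ i)) h)

  neg<0⇒0< : ∀ {i} → - i < + 0 → + 0 < i
  neg<0⇒0< {i} h = subst (+ 0 <_) (neg-involutive i) (neg-mono-< h)

  integer-root-splits : ∀ b c d m → + 1 ≤ d → d ≤ - b - c - + 2 →
    m * m * m + b * (m * m) + c * m + d ≡ + 0 → Split b c (m + b) × d ≡ - ((m + b - b) * e b c (m + b))
  integer-root-splits b c d m 1≤d d≤ root = split m me<0 [1-m]s<0 , d≡
    where
    open ≡-Reasoning
    0<d : + 0 < d
    0<d = <-≤-trans (+<+ (s≤s z≤n)) 1≤d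
    d≡ : d ≡ - ((m + b - b) * e b c (m + b))
    d≡ = begin
      d ≡⟨ solve 4 (λ b c d m → let n = m :+ b in d := (m :* m :* m :+ b :* (m :* m) :+ c :* m :+ d) :+ :- ((n :- b) :* (c :+ n :* n :- b :* n))) refl b c d m ⟩
      (m * m * m + b * (m * m) + c * m + d) + - ((m + b - b) * e b c (m + b)) ≡⟨ cong (_+ - ((m + b - b) * e b c (m + b))) root ⟩
      + 0 + - ((m + b - b) * e b c (m + b)) ≡⟨ +-identityˡ _ ⟩
      - ((m + b - b) * e b c (m + b)) ∎
    -- m e = -d
    me<0 : m * (c - g b c (m + b)) < + 0
    me<0 = subst (_< + 0) (begin
        - d ≡⟨ cong -_ d≡ ⟩
        - - ((m + b - b) * e b c (m + b))
          ≡⟨ solve 3 (λ b c m → let n = m :+ b in :- (:- ((n :- b) :* (c :+ n :* n :- b :* n))) := m :* (c :- (:- (n :* n) :+ b :* n))) refl b c m ⟩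
        m * (c - g b c (m + b)) ∎)
      (neg-mono-< 0<d)
    -- (1 - m)(1 + n + e) = 1 + b + c + d
    [1-m]s<0 : (+ 1 - m) * (c - f b c (m + b)) < + 0
    [1-m]s<0 = <-≤-trans (subst (_< + 1 + b + c + d + + 1) eq (i<i+1 (+ 1 + b + c + d))) (subst (+ 1 + b + c + d + + 1 ≤_)
        (solve 3 (λ b c k → con (+ 1) :+ b :+ c :+ (:- b :- c :- con (+ 2)) :+ con (+ 1) := con (+ 0)) refl b c (+ 0))
        (+-monoˡ-≤ (+ 1) (+-monoʳ-≤ (+ 1 + b + c) d≤)))
      where
      i<i+1 : ∀ i → i < i + + 1
      i<i+1 i = subst (_< i + + 1) (+-identityʳ i) (+-monoʳ-< i (+<+ (s≤s z≤n)))
      eq : + 1 + b + c + d ≡ (+ 1 - m) * (c - f b c (m + b))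
      eq = begin
        + 1 + b + c + d
          ≡⟨ solve 4 (λ b c d m → let n = m :+ b in con (+ 1) :+ b :+ c :+ d :=
               (m :* m :* m :+ b :* (m :* m) :+ c :* m :+ d) :+ (con (+ 1) :- m) :* (c :- (:- (n :* n) :+ (b :- con (+ 1)) :* n :- con (+ 1)))) refl b c d m ⟩
        (m * m * m + b * (m * m) + c * m + d) + (+ 1 - m) * (c - f b c (m + b))
          ≡⟨ cong (_+ (+ 1 - m) * (c - f b c (m + b))) root ⟩
        + 0 + (+ 1 - m) * (c - f b c (m + b)) ≡⟨ +-identityˡ _ ⟩
        (+ 1 - m) * (c - f b c (m + b)) ∎
    n-b≡m : ∀ m → m + b - b ≡ m
    n-b≡m m = solve 2 (λ b m → m :+ b :- b := m) refl b m
    split : ∀ m → m * (c - g b c (m + b)) < + 0 → (+ 1 - m) * (c - f b c (m + b)) < + 0 → Split b c (m + b)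
    -- For m = 0 or m = 1 a factor of a product that should be negative vanishes.
    split (+ 0) h _ = contradiction h (<-irrefl refl)
    split (+ 1) _ h = contradiction h (<-irrefl refl)
    split m@(+ suc (suc k)) h h′ = right (subst (+ 2 ≤_) (sym (n-b≡m m)) (+≤+ (s≤s (s≤s z≤n))))
      (0<j-i⇒i<j (neg<0⇒0< (pos*neg⁻¹ {+ suc k} (+<+ (s≤s z≤n)) (subst (_< + 0) (neg-distribʳ (+ suc k) (c - f b c (m + b))) h′))))
      (i-j<0⇒i<j (pos*neg⁻¹ {m} (+<+ (s≤s z≤n)) h))
      where
      neg-distribʳ : ∀ i j → - i * j ≡ i * - j
      neg-distribʳ i j = solve 2 (λ i j → :- i :* j := i :* :- j) refl i j
    split m@(-[1+ k ]) h h′ = left (subst (_≤ -1ℤ) (sym (n-b≡m m)) (-≤- z≤n))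
      (0<j-i⇒i<j (neg<0⇒0< (pos*neg⁻¹ {+ suc k} (+<+ (s≤s z≤n)) (subst (_< + 0) (neg-distribʳ (+ suc k) (c - g b c (m + b))) h))))
      (i-j<0⇒i<j (pos*neg⁻¹ {+ 1 - m} (+<+ (s≤s z≤n)) h′))
      where
      neg-distribʳ : ∀ i j → - i * j ≡ i * - j
      neg-distribʳ i j = solve 2 (λ i j → :- i :* j := i :* :- j) refl i j

  -- The two products in `signs` are `-d` and `1 + b + c + d`, the value of the cubic at 1; both are
  -- negative.
  split-range : ∀ b c n → Split b c n → let d = - ((n - b) * e b c n) in + 1 ≤ d × d ≤ - b - c - + 2
  split-range b c n s = i<j⇒suc[i]≤j (subst (+ 0 <_) (cong -_ (eq₁ b c n)) (neg-mono-< (proj₁ (signs s)))) ,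
      subst₂ _≤_ (solve 3 (λ b c d → con (+ 1) :+ (con (+ 1) :+ b :+ c :+ d) :+ (:- b :- c :- con (+ 2)) := d) refl b c (- ((n - b) * e b c n)))
        (+-identityˡ (- b - c - + 2))
        (+-monoˡ-≤ (- b - c - + 2) (i<j⇒suc[i]≤j (subst (_< + 0) (eq₂ b c n) (proj₂ (signs s)))))
    where
    signs : Split b c n → (n - b) * (c - g b c n) < + 0 × (+ 1 - (n - b)) * (c - f b c n) < + 0
    signs (right 2≤m f<c c<g) = pos*neg (<-≤-trans (+<+ (s≤s z≤n)) 2≤m) (i<j⇒i-j<0 c<g) ,
      subst (_< + 0) (*-comm (c - f b c n) (+ 1 - (n - b))) (pos*neg (i<j⇒0<j-i f<c) (i<j⇒i-j<0 (<-≤-trans (+<+ (s≤s (s≤s z≤n))) 2≤m)))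
    signs (left m≤-1 g<c c<f) = subst (_< + 0) (*-comm (c - g b c n) (n - b)) (pos*neg (i<j⇒0<j-i g<c) (≤-<-trans m≤-1 -<+)) ,
      pos*neg (i<j⇒0<j-i (≤-<-trans m≤-1 -<+)) (i<j⇒i-j<0 c<f)
    eq₁ : ∀ b c n → (n - b) * (c - g b c n) ≡ (n - b) * e b c n
    eq₁ = solve 3 (λ b c n → (n :- b) :* (c :- (:- (n :* n) :+ b :* n)) := (n :- b) :* (c :+ n :* n :- b :* n)) refl
    eq₂ : ∀ b c n → (+ 1 - (n - b)) * (c - f b c n) ≡ + 1 + b + c + - ((n - b) * e b c n)
    eq₂ = solve 3 (λ b c n → (con (+ 1) :- (n :- b)) :* (c :- (:- (n :* n) :+ (b :- con (+ 1)) :* n :- con (+ 1)))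
      := con (+ 1) :+ b :+ c :+ :- ((n :- b) :* (c :+ n :* n :- b :* n))) refl

  neg-<⇒> : ∀ {m n} → - + m < - + n → n ℕ.< m
  neg-<⇒> h = drop‿+<+ (neg-cancel-< h)

  >⇒neg-< : ∀ {m n} → n ℕ.< m → - + m < - + n
  >⇒neg-< h = neg-mono-< (+<+ h)

  -- Put b = -B and c = -v.  The numbers s k = -g k and 1 + t k = -f k satisfy
  -- s k ≤ t k < s (1 + k).  A cubic splits to the right with n = k iff
  -- s k < v ≤ t k, and to the left with n = -(B + k + 1) iff 1 + t k < v < s (1 + k);
  -- the remaining v are the special forms.
  module _ (B : ℕ) where

    s t : ℕ → ℕ
    s k = k ℕ.* (k ℕ.+ B)
    t k = k ℕ.* (k ℕ.+ suc B)

    s≤t : ∀ k → s k ℕ.≤ t k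
    s≤t k = ℕₚ.*-monoʳ-≤ k (ℕₚ.+-monoʳ-≤ k (ℕₚ.n≤1+n B))

    t<s-suc : ∀ k → t k ℕ.< s (suc k)
    t<s-suc k = ℕₚ.≤-trans (s≤s (ℕₚ.≤-reflexive (cong (k ℕ.*_) (ℕₚ.+-suc k B)))) (s≤s (ℕₚ.m≤n+m (k ℕ.* suc (k ℕ.+ B)) (k ℕ.+ B)))

    s-mono : ∀ {j k} → j ℕ.≤ k → s j ℕ.≤ s k
    s-mono j≤k = ℕₚ.*-mono-≤ j≤k (ℕₚ.+-monoˡ-≤ B j≤k)

    bracket : ∀ v → ∃[ k ] s k ℕ.≤ v × v ℕ.< s (suc k)
    bracket zero = 0 , z≤n , s≤s z≤n
    bracket (suc v) with k , sk≤v , v<s ← bracket v with suc v ℕ.<? s (suc k)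
    ... | yes v+1<s = k , ℕₚ.m≤n⇒m≤1+n sk≤v , v+1<s
    ... | no  v+1≮s = suc k , ℕₚ.≮⇒≥ v+1≮s , ℕₚ.≤-<-trans v<s (ℕₚ.≤-<-trans (s≤t (suc k)) (t<s-suc (suc k)))

    Right Left : (v k : ℕ) → Set
    Right v k = s k ℕ.< v × v ℕ.≤ t k
    Left  v k = suc (t k) ℕ.< v × v ℕ.< s (suc k)

    private
      b : ℤ
      b = - + B

    +s : ∀ k → + s k ≡ + k * (+ k + + B)
    +s k = pos-* k (k ℕ.+ B)

    +t : ∀ k → + t k ≡ + k * (+ k + (+ 1 + + B))
    +t k = pos-* k (k ℕ.+ suc B)

    g-right : ∀ c k → g b c (+ k) ≡ - + s k
    g-right c k = trans (solve 2 (λ B k → :- (k :* k) :+ :- B :* k := :- (k :* (k :+ B))) refl (+ B) (+ k)) (cong -_ (sym (+s k)))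

    f-right : ∀ c k → f b c (+ k) ≡ - + suc (t k)
    f-right c k = trans (solve 2 (λ B k → :- (k :* k) :+ (:- B :- con (+ 1)) :* k :- con (+ 1) := :- (con (+ 1) :+ k :* (k :+ (con (+ 1) :+ B)))) refl (+ B) (+ k))
      (cong (λ u → - (+ 1 + u)) (sym (+t k)))

    g-left : ∀ c k → g b c (- + (B ℕ.+ suc k)) ≡ - + s (suc k)
    g-left c k = trans (solve 2 (λ B k → let n = :- (B :+ k) in :- (n :* n) :+ :- B :* n := :- (k :* (k :+ B))) refl (+ B) (+ suc k)) (cong -_ (sym (+s (suc k))))

    f-left : ∀ c k → f b c (- + (B ℕ.+ suc k)) ≡ - + suc (t k)
    f-left c k = trans (solve 2 (λ B k → let n = :- (B :+ (con (+ 1) :+ k)) in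
        :- (n :* n) :+ (:- B :- con (+ 1)) :* n :- con (+ 1) := :- (con (+ 1) :+ k :* (k :+ (con (+ 1) :+ B)))) refl (+ B) (+ k))
      (cong (λ u → - (+ 1 + u)) (sym (+t k)))

    Located : (v : ℕ) (n : ℤ) → Set
    Located v n = ∃[ k ] (n ≡ + k × Right v k ⊎ n ≡ - + (B ℕ.+ suc k) × Left v k)

    locate : ∀ v n → Split b (- + v) n → Located v n
    locate v (+ k) (right _ f<c c<g) = k , inj₁ (refl ,
      neg-<⇒> (subst (- + v <_) (g-right (- + v) k) c<g) , ℕₚ.≤-pred (neg-<⇒> (subst (_< - + v) (f-right (- + v) k) f<c)))
    -- Since `g - f = n + 1`, the interval is empty for negative `n`.
    locate v -[1+ k ] (right _ f<c c<g) = contradiction (subst (+ 0 <_) eq (i<j⇒0<j-i (<-trans f<c c<g))) (not-pos k)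
      where
      eq : g b (- + v) -[1+ k ] - f b (- + v) -[1+ k ] ≡ -[1+ k ] + + 1
      eq = solve 2 (λ b n → (:- (n :* n) :+ b :* n) :- (:- (n :* n) :+ (b :- con (+ 1)) :* n :- con (+ 1)) := n :+ con (+ 1)) refl b -[1+ k ]
      not-pos : ∀ k → ¬ + 0 < -[1+ k ] + + 1
      not-pos zero = <-irrefl refl
      not-pos (suc k) ()
    locate v n (left m≤-1 g<c c<f) = go (n - b) (solve 2 (λ n b → n := n :- b :+ b) refl n b) m≤-1
      where
      go : ∀ m → n ≡ m + b → m ≤ -1ℤ → Located v n
      go (+ _) _ ()
      go -[1+ k ] n≡ _ = k , inj₂ (n≡′ ,
          neg-<⇒> (subst (- + v <_) (trans (cong (f b (- + v)) n≡′) (f-left (- + v) k)) c<f) ,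
          neg-<⇒> (subst (_< - + v) (trans (cong (g b (- + v)) n≡′) (g-left (- + v) k)) g<c))
        where
        n≡′ : n ≡ - + (B ℕ.+ suc k)
        n≡′ = trans n≡ (solve 2 (λ B k → :- k :+ :- B := :- (B :+ k)) refl (+ B) (+ suc k))

    Bracket : (v k : ℕ) → Set
    Bracket v k = s k ℕ.≤ v × v ℕ.< s (suc k)

    right-bracket : ∀ v k → Right v k → Bracket v k
    right-bracket v k (lo , hi) = ℕₚ.<⇒≤ lo , ℕₚ.≤-<-trans hi (t<s-suc k)

    left-bracket : ∀ v k → Left v k → Bracket v k
    left-bracket v k (lo , hi) = ℕₚ.≤-trans (s≤t k) (ℕₚ.<⇒≤ (ℕₚ.<-trans (ℕₚ.n<1+n (t k)) lo)) , hi

    bracket-unique : ∀ v j k → Bracket v j → Bracket v k → j ≡ k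
    bracket-unique v j k (sj≤v , v<sj) (sk≤v , v<sk) with ℕₚ.<-cmp j k
    ... | tri< j<k _ _ = contradiction (ℕₚ.≤-trans v<sj (ℕₚ.≤-trans (s-mono j<k) sk≤v)) (ℕₚ.<-irrefl refl)
    ... | tri≈ _ j≡k _ = j≡k
    ... | tri> _ _ k<j = contradiction (ℕₚ.≤-trans v<sk (ℕₚ.≤-trans (s-mono k<j) sj≤v)) (ℕₚ.<-irrefl refl)

    disjoint : ∀ v j k → Right v j → ¬ Left v k
    disjoint v j k r l = ℕₚ.<-irrefl refl (ℕₚ.<-trans (ℕₚ.n<1+n (t k)) (ℕₚ.<-≤-trans (proj₁ l)
      (subst (λ j → v ℕ.≤ t j) (bracket-unique v j k (right-bracket v j r) (left-bracket v k l)) (proj₂ r))))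

    split-unique : ∀ v {n n′} → Split b (- + v) n → Split b (- + v) n′ → n ≡ n′
    split-unique v {n} {n′} p p′ with locate v n p | locate v n′ p′
    ... | j , inj₁ (n≡ , r) | k , inj₁ (n′≡ , r′) =
      trans n≡ (trans (cong +_ (bracket-unique v j k (right-bracket v j r) (right-bracket v k r′))) (sym n′≡))
    ... | j , inj₁ (_ , r) | k , inj₂ (_ , l) = contradiction l (disjoint v j k r)
    ... | j , inj₂ (_ , l) | k , inj₁ (_ , r) = contradiction l (disjoint v k j r)
    ... | j , inj₂ (n≡ , l) | k , inj₂ (n′≡ , l′) =
      trans n≡ (trans (cong (λ k → - + (B ℕ.+ suc k)) (bracket-unique v j k (left-bracket v j l) (left-bracket v k l′))) (sym n′≡))

    s-not-split : ∀ k n → ¬ Split b (- + s k) n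
    s-not-split k n p with locate (s k) n p
    ... | j , inj₁ (_ , r) = ℕₚ.<-irrefl (cong s (bracket-unique (s k) j k (right-bracket (s k) j r) (ℕₚ.≤-refl , ℕₚ.≤-<-trans (s≤t k) (t<s-suc k)))) (proj₁ r)
    ... | j , inj₂ (_ , l) = ℕₚ.<-irrefl refl (ℕₚ.<-trans (ℕₚ.<-≤-trans (proj₁ l)
            (subst (λ j → s k ℕ.≤ t j) (sym (bracket-unique (s k) j k (left-bracket (s k) j l) (ℕₚ.≤-refl , ℕₚ.≤-<-trans (s≤t k) (t<s-suc k)))) (s≤t k)))
            (ℕₚ.n<1+n (t j)))

    1+t-not-split : ∀ k n → ¬ Split b (- + suc (t k)) n
    1+t-not-split k n p with suc (t k) ℕ.<? s (suc k)
    -- As `s (1 + k) = t k + (1 + k + B)`, this occurs only for k = B = 0, where the two kinds of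
    -- special values coincide.
    ... | no 1+t≮s = s-not-split (suc k) n (subst (λ v → Split b (- + v) n) (ℕₚ.≤-antisym (t<s-suc k) (ℕₚ.≮⇒≥ 1+t≮s)) p)
    ... | yes 1+t<s with locate (suc (t k)) n p
    ...   | j , inj₁ (_ , r) = ℕₚ.<-irrefl refl (subst (λ j → suc (t k) ℕ.≤ t j)
              (bracket-unique (suc (t k)) j k (right-bracket (suc (t k)) j r) (ℕₚ.m≤n⇒m≤1+n (s≤t k) , 1+t<s)) (proj₂ r))
    ...   | j , inj₂ (_ , l) = ℕₚ.<-irrefl (cong (λ j → suc (t j))
              (bracket-unique (suc (t k)) j k (left-bracket (suc (t k)) j l) (ℕₚ.m≤n⇒m≤1+n (s≤t k) , 1+t<s))) (proj₁ l)

  SpecialForm Interval : (b c : ℤ) → Set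
  SpecialForm b c = (∃[ n ] δ b ≤ n × c ≡ f b c n) ⊎ (∃[ n ] + 1 + ε b - ε (- + 3 - b) ≤ n × c ≡ g b c n)
  Interval b c = ∃[ n ] ((+ 1 + ε b ≤ n × f b c n < c × c < g b c n) ⊎ (n ≤ - + 3 - ε (- + 3 - b) × g b c n < c × c < f b c n))

  -- Both coefficients are nonpositive, since `c ≤ -b - 3 ≤ 0`; passing to their absolute values
  -- moves the interval arguments to ℕ.
  data Magnitude : (b c : ℤ) → Set where
    magnitude : ∀ B v → B ℕ.≤ 3 → 3 ℕ.≤ v ℕ.+ B → Magnitude (- + B) (- + v)

  magnitudes : ∀ b c → - + 3 ≤ b → b ≤ + 0 → c ≤ - b - + 3 → Magnitude b c
  magnitudes b c -3≤b b≤0 c≤ = subst₂ Magnitude (neg-involutive b) (neg-involutive c)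
      (from (- b) (- c) (neg-mono-≤ b≤0) (subst (- b ≤_) refl (neg-mono-≤ -3≤b))
        (subst₂ _≤_ (solve 1 (λ b → :- (:- b :- con (+ 3)) :+ :- b := con (+ 3)) refl b) refl (+-monoˡ-≤ (- b) (neg-mono-≤ c≤))))
    where
    from : ∀ x y → + 0 ≤ x → x ≤ + 3 → + 3 ≤ y + x → Magnitude (- x) (- y)
    from (+ B) (+ v) _ (+≤+ B≤3) (+≤+ 3≤v+B) = magnitude B v B≤3 3≤v+B
    from (+ B) -[1+ v ] _ (+≤+ B≤3) h = contradiction (<-≤-trans (+<+ (s≤s B≤3)) (i<j⇒suc[i]≤j (≤-<-trans h (i+neg<i B v)))) (<-irrefl refl)
      where
      i+neg<i : ∀ B v → -[1+ v ] + + B < + B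
      i+neg<i B v = subst (-[1+ v ] + + B <_) (+-identityˡ (+ B)) (+-monoˡ-< (+ B) -<+)

  small-coefficient : ∀ {B} → B ℕ.≤ 3 → SmallCoefficient (- + B)
  small-coefficient {0} _ = b≡0
  small-coefficient {1} _ = b≡-1
  small-coefficient {2} _ = b≡-2
  small-coefficient {3} _ = b≡-3
  small-coefficient {suc (suc (suc (suc _)))} (s≤s (s≤s (s≤s ())))

  magnitude-small : ∀ {b c} → Magnitude b c → SmallCoefficient b
  magnitude-small (magnitude B v B≤3 _) = small-coefficient B≤3

  splits-agree : ∀ {b c} → Magnitude b c → ∀ {n n′} → Split b c n → Split b c n′ → n ≡ n′
  splits-agree (magnitude B v _ _) = split-unique B v

  -- The terms in `ε` tighten the bounds on `n` at b = 0 and b = -3 so that the integer root `n - b`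
  -- is at least 2 or at most -1 in every case.
  interval-splits : ∀ {b} c n → SmallCoefficient b →
    (+ 1 + ε b ≤ n × f b c n < c × c < g b c n) ⊎ (n ≤ - + 3 - ε (- + 3 - b) × g b c n < c × c < f b c n) → Split b c n
  interval-splits {b} c n small (inj₁ (h , f<c , c<g)) = right (go small h) f<c c<g
    where
    go : ∀ {b} → SmallCoefficient b → + 1 + ε b ≤ n → + 2 ≤ n - b
    go b≡0 h = +-monoˡ-≤ (+ 0) h
    go b≡-1 h = +-monoˡ-≤ (+ 1) h
    go b≡-2 h = ≤-trans (+≤+ (s≤s (s≤s z≤n))) (+-monoˡ-≤ (+ 2) h)
    go b≡-3 h = ≤-trans (+≤+ (s≤s (s≤s z≤n))) (+-monoˡ-≤ (+ 3) h)
  interval-splits {b} c n small (inj₂ (h , g<c , c<f)) = left (go small h) g<c c<f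
    where
    go : ∀ {b} → SmallCoefficient b → n ≤ - + 3 - ε (- + 3 - b) → n - b ≤ -1ℤ
    go b≡0 h = ≤-trans (+-monoˡ-≤ (+ 0) h) (-≤- z≤n)
    go b≡-1 h = ≤-trans (+-monoˡ-≤ (+ 1) h) (-≤- z≤n)
    go b≡-2 h = +-monoˡ-≤ (+ 2) h
    go b≡-3 h = +-monoˡ-≤ (+ 3) h

  special-form-not-split : ∀ {b c} → Magnitude b c → SpecialForm b c → ∀ n → ¬ Split b c n
  special-form-not-split (magnitude B v B≤3 _) (inj₁ (n₀ , δ≤n₀ , c≡)) n p = go n₀ (≤-trans (0≤δ (small-coefficient B≤3)) δ≤n₀) c≡
    where
    0≤δ : ∀ {b} → SmallCoefficient b → + 0 ≤ δ b
    0≤δ b≡0 = +≤+ z≤n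
    0≤δ b≡-1 = +≤+ z≤n
    0≤δ b≡-2 = +≤+ z≤n
    0≤δ b≡-3 = +≤+ z≤n
    go : ∀ n₀ → + 0 ≤ n₀ → - + v ≡ f (- + B) (- + v) n₀ → _
    go (+ k) _ c≡ = 1+t-not-split B k n (subst (λ c → Split (- + B) c n) (trans c≡ (f-right B (- + v) k)) p)
  special-form-not-split (magnitude B v B≤3 _) (inj₂ (n₀ , ε≤n₀ , c≡)) n p = go n₀ (≤-trans (0≤ε (small-coefficient B≤3)) ε≤n₀) c≡
    where
    0≤ε : ∀ {b} → SmallCoefficient b → + 0 ≤ + 1 + ε b - ε (- + 3 - b)
    0≤ε b≡0 = +≤+ z≤n
    0≤ε b≡-1 = +≤+ z≤n
    0≤ε b≡-2 = +≤+ z≤n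
    0≤ε b≡-3 = +≤+ z≤n
    go : ∀ n₀ → + 0 ≤ n₀ → - + v ≡ g (- + B) (- + v) n₀ → _
    go (+ k) _ c≡ = s-not-split B k n (subst (λ c → Split (- + B) c n) (trans c≡ (g-right B (- + v) k)) p)

  -- The lower bounds imposed on n hold automatically because v ≥ 3 - B.
  interval-exists : ∀ {b c} → Magnitude b c → ¬ SpecialForm b c → Interval b c
  interval-exists (magnitude B v B≤3 3≤v+B) ¬special with bracket B v
  ... | k , sk≤v , v<s with ℕₚ.m≤n⇒m<n∨m≡n sk≤v
  ...   | inj₂ sk≡v = contradiction (inj₂ (+ k , bound B k B≤3 3≤v+B sk≡v , trans (cong (λ v → - + v) (sym sk≡v)) (sym (g-right B (- + v) k)))) ¬special
    where
    bound : ∀ B k → B ℕ.≤ 3 → 3 ℕ.≤ v ℕ.+ B → s B k ≡ v → + 1 + ε (- + B) - ε (- + 3 - - + B) ≤ + k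
    bound 0 0 _ h refl = contradiction h λ ()
    bound 0 1 _ (s≤s ()) refl
    bound 0 (suc (suc k)) _ _ _ = +≤+ (s≤s (s≤s z≤n))
    bound 1 0 _ (s≤s ()) refl
    bound 1 (suc k) _ _ _ = +≤+ (s≤s z≤n)
    bound 2 0 _ (s≤s (s≤s ())) refl
    bound 2 (suc k) _ _ _ = +≤+ (s≤s z≤n)
    bound 3 k _ _ _ = +≤+ z≤n
    bound (suc (suc (suc (suc _)))) _ (s≤s (s≤s (s≤s ())))
  ...   | inj₁ sk<v with ℕₚ.<-cmp v (suc (t B k))
  ...     | tri< v<1+t _ _ = + k , inj₁ (bound B k B≤3 3≤v+B sk<v (ℕₚ.≤-pred v<1+t) ,
              subst (_< - + v) (sym (f-right B (- + v) k)) (>⇒neg-< v<1+t) ,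
              subst (- + v <_) (sym (g-right B (- + v) k)) (>⇒neg-< sk<v))
    where
    bound : ∀ B k → B ℕ.≤ 3 → 3 ℕ.≤ v ℕ.+ B → s B k ℕ.< v → v ℕ.≤ t B k → + 1 + ε (- + B) ≤ + k
    bound B 0 _ _ s<v v≤t = contradiction (ℕₚ.<-≤-trans s<v v≤t) (ℕₚ.<-irrefl refl)
    bound 0 1 _ h _ v≤t = contradiction (ℕₚ.≤-trans (subst (3 ℕ.≤_) (ℕₚ.+-identityʳ v) h) v≤t) λ { (s≤s (s≤s ())) }
    bound 0 (suc (suc k)) _ _ _ _ = +≤+ (s≤s (s≤s z≤n))
    bound (suc B) (suc k) _ _ _ _ = +≤+ (s≤s z≤n)
  ...     | tri≈ _ v≡1+t _ = contradiction (inj₁ (+ k , bound B k B≤3 3≤v+B v≡1+t , trans (cong (λ v → - + v) v≡1+t) (sym (f-right B (- + v) k)))) ¬special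
    where
    bound : ∀ B k → B ℕ.≤ 3 → 3 ℕ.≤ v ℕ.+ B → v ≡ suc (t B k) → δ (- + B) ≤ + k
    bound 0 0 _ (s≤s ()) refl
    bound 0 (suc k) _ _ _ = +≤+ (s≤s z≤n)
    bound 1 0 _ (s≤s (s≤s ())) refl
    bound 1 (suc k) _ _ _ = +≤+ (s≤s z≤n)
    bound (suc (suc B)) k _ _ _ = +≤+ z≤n
  ...     | tri> _ _ 1+t<v = - + (B ℕ.+ suc k) , inj₂ (bound B k B≤3 1+t<v v<s ,
              subst (_< - + v) (sym (g-left B (- + v) k)) (>⇒neg-< v<s) ,
              subst (- + v <_) (sym (f-left B (- + v) k)) (>⇒neg-< 1+t<v))
    where
    bound : ∀ B k → B ℕ.≤ 3 → suc (t B k) ℕ.< v → v ℕ.< s B (suc k) → - + (B ℕ.+ suc k) ≤ - + 3 - ε (- + 3 - - + B)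
    bound 0 0 _ lo hi = contradiction (ℕₚ.<-trans lo hi) (ℕₚ.<-irrefl refl)
    bound 0 1 _ lo hi = contradiction (ℕₚ.<-≤-trans hi lo) (ℕₚ.<-irrefl refl)
    bound 0 (suc (suc k)) _ _ _ = -≤- (s≤s (s≤s z≤n))
    bound 1 0 _ lo hi = contradiction (ℕₚ.<-≤-trans hi lo) (ℕₚ.<-irrefl refl)
    bound 1 (suc k) _ _ _ = -≤- (s≤s (s≤s z≤n))
    bound 2 k _ _ _ = -≤- (s≤s (s≤s z≤n))
    bound 3 k _ _ _ = -≤- (s≤s (s≤s (s≤s z≤n)))
    bound (suc (suc (suc (suc _)))) _ (s≤s (s≤s (s≤s ())))

-- Distinct fields, total reality and the quadratic exception.

module Assembly where
  import Data.Integer.Solver as ℤ-Solver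
  open RationalArithmetic
  open Bisection
  open FieldRigidity
  open CubicField
  open CubicForms
  open FieldElements
  open Inequalities
  open IntegerRoots
  open Integrality
  open Reals
  open TotallyReal

  fromℤ-cubic : ∀ b c d m → cubicℚ (fromℤ b) (fromℤ c) (fromℤ d) (fromℤ m)
    ≡ fromℤ (m ℤ.* m ℤ.* m ℤ.+ b ℤ.* (m ℤ.* m) ℤ.+ c ℤ.* m ℤ.+ d)
  fromℤ-cubic b c d m = sym (begin
      fromℤ (m ℤ.* m ℤ.* m ℤ.+ b ℤ.* (m ℤ.* m) ℤ.+ c ℤ.* m ℤ.+ d)
        ≡⟨ trans (fromℤ-+ (m ℤ.* m ℤ.* m ℤ.+ b ℤ.* (m ℤ.* m) ℤ.+ c ℤ.* m) d)
             (cong (_+ fromℤ d) (trans (fromℤ-+ (m ℤ.* m ℤ.* m ℤ.+ b ℤ.* (m ℤ.* m)) (c ℤ.* m))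
               (cong (_+ fromℤ (c ℤ.* m)) (fromℤ-+ (m ℤ.* m ℤ.* m) (b ℤ.* (m ℤ.* m)))))) ⟩
      fromℤ (m ℤ.* m ℤ.* m) + fromℤ (b ℤ.* (m ℤ.* m)) + fromℤ (c ℤ.* m) + fromℤ d
        ≡⟨ cong (_+ fromℤ d) (cong₂ _+_ (cong₂ _+_
             (trans (fromℤ-* (m ℤ.* m) m) (cong (_* fromℤ m) (fromℤ-* m m)))
             (trans (fromℤ-* b (m ℤ.* m)) (cong (fromℤ b *_) (fromℤ-* m m)))) (fromℤ-* c m)) ⟩
      cubicℚ (fromℤ b) (fromℤ c) (fromℤ d) (fromℤ m) ∎)
    where open ≡-Reasoning

  rational-root-splits : ∀ b c d x → + 1 ℤ.≤ d → d ℤ.≤ ℤ.- b ℤ.- c ℤ.- + 2 →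
    cubicℚ (fromℤ b) (fromℤ c) (fromℤ d) x ≡ 0ℚ → ∃[ n ] Split b c n × d ≡ ℤ.- ((n ℤ.- b) ℤ.* e b c n)
  rational-root-splits b c d x 1≤d d≤ x-root = integral (rational-root b c d x x-root)
    where
    integral : IsInteger x → ∃[ n ] Split b c n × d ≡ ℤ.- ((n ℤ.- b) ℤ.* e b c n)
    integral (m , x≡m) = m ℤ.+ b , integer-root-splits b c d m 1≤d d≤
      (fromℤ-injective {m ℤ.* m ℤ.* m ℤ.+ b ℤ.* (m ℤ.* m) ℤ.+ c ℤ.* m ℤ.+ d} {+ 0}
        (trans (sym (fromℤ-cubic b c d m)) (trans (cong (cubicℚ (fromℤ b) (fromℤ c) (fromℤ d)) (sym x≡m)) x-root)))

  0<⇒pos : ∀ {α} → 0ᴿ <ᴿ α → Pos α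
  0<⇒pos {α} h = pos-resp (pointwise λ n → solve 1 (λ x → x :- con 0ℚ := x) refl (seq α n)) (<⇒Pos h)

  pos⇒0< : ∀ {α} → Pos α → 0ᴿ <ᴿ α
  pos⇒0< {α} h = Pos⇒< (pos-resp (pointwise λ n → solve 1 (λ x → x := x :- con 0ℚ) refl (seq α n)) h)

  private
    module ℤS = ℤ-Solver.+-*-Solver

  c-g : ∀ b c n → c ℤ.- g b c n ≡ e b c n
  c-g = ℤS.solve 3 (λ b c n → c ℤS.:- (ℤS.:- (n ℤS.:* n) ℤS.:+ b ℤS.:* n) ℤS.:= c ℤS.:+ n ℤS.:* n ℤS.:- b ℤS.:* n) refl

  c≡ : ∀ b c n → c ≡ e b c n ℤ.- n ℤ.* (n ℤ.- b)
  c≡ = ℤS.solve 3 (λ b c n → c ℤS.:= c ℤS.:+ n ℤS.:* n ℤS.:- b ℤS.:* n ℤS.:- n ℤS.:* (n ℤS.:- b)) refl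

  1+n+e : ∀ b c n → fromℤ (c ℤ.- f b c n) ≡ fromℤ (e b c n) + fromℤ n + 1ℚ
  1+n+e b c n = trans (cong fromℤ (identity b c n)) (trans (fromℤ-+ (e b c n ℤ.+ n) (+ 1)) (cong (_+ 1ℚ) (fromℤ-+ (e b c n) n)))
    where
    identity : ∀ b c n → c ℤ.- f b c n ≡ e b c n ℤ.+ n ℤ.+ + 1
    identity = ℤS.solve 3 (λ b c n → c ℤS.:- (ℤS.:- (n ℤS.:* n) ℤS.:+ (b ℤS.:- ℤS.con (+ 1)) ℤS.:* n ℤS.:- ℤS.con (+ 1))
      ℤS.:= c ℤS.:+ n ℤS.:* n ℤS.:- b ℤS.:* n ℤS.:+ n ℤS.:+ ℤS.con (+ 1)) refl

  -- The values e at 0 and 1 + n + e at 1 are nonzero and have opposite signs.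
  quadratic-unit-root : ∀ {b c n} → Split b c n →
    Σ[ α ∈ ℝ ] Pos α × Pos (1ᴿ ⊖ α) × ev (fromℤ (e b c n)) (fromℤ n) 1ℚ α ≈ᴿ 0ᴿ
  quadratic-unit-root {b} {c} {n} (right _ f<c c<g) = root , 0<root , root<1 , is-root
    where
    e<0 : fromℤ (e b c n) < 0ℚ
    e<0 = fromℤ-mono-< {e b c n} {+ 0} (subst (ℤ._< + 0) (c-g b c n) (i<j⇒i-j<0 c<g))
    0<s : 0ℚ < fromℤ (e b c n) + fromℤ n + 1ℚ
    0<s = subst (0ℚ <_) (1+n+e b c n) (fromℤ-mono-< {+ 0} (i<j⇒0<j-i f<c))
    open Bisect 1ℚ (fromℤ n) (fromℤ (e b c n)) e<0 0<s
  quadratic-unit-root {b} {c} {n} (left _ g<c c<f) = root , 0<root , root<1 , modulo is-root (-ᴿ 1ᴿ) λ i →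
      solve 3 (λ e n a → :ev e n (con 1ℚ) a := con 0ℚ :+ :- con 1ℚ :* :ev (:- e) (:- n) (:- con 1ℚ) a) refl (fromℤ (e b c n)) (fromℤ n) (seq root i)
    where
    -e<0 : - fromℤ (e b c n) < 0ℚ
    -e<0 = neg-antimono-< (fromℤ-mono-< {+ 0} {e b c n} (subst (+ 0 ℤ.<_) (c-g b c n) (i<j⇒0<j-i g<c)))
    0<-s : 0ℚ < - fromℤ (e b c n) + - fromℤ n + - 1ℚ
    0<-s = subst (0ℚ <_) (solve 2 (λ e n → :- (e :+ n :+ con 1ℚ) := :- e :+ :- n :+ :- con 1ℚ) refl (fromℤ (e b c n)) (fromℤ n))
      (neg-antimono-< (subst (_< 0ℚ) (1+n+e b c n) (fromℤ-mono-< {c ℤ.- f b c n} {+ 0} (i<j⇒i-j<0 c<f))))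
    open Bisect (- 1ℚ) (- fromℤ n) (- fromℤ (e b c n)) -e<0 0<-s

  module _ (b c : ℤ) (small : SmallCoefficient b) (c≤ : c ℤ.≤ ℤ.- b ℤ.- + 3) where

    private
      B C : ℚ
      B = fromℤ b
      C = fromℤ c

    membership : ∀ {α d} → Pos α → Pos (1ᴿ ⊖ α) → + 1 ℤ.≤ d → d ℤ.≤ ℤ.- b ℤ.- c ℤ.- + 2 →
      cubicᴿ B C (fromℤ d) α ≈ᴿ 0ᴿ → α ∈ I³ʳ b c
    membership 0<α α<1 1≤d d≤ α-root = pos⇒0< 0<α , Pos⇒< α<1 , _ , 1≤d , d≤ , ι-root α-root

    rootless-totally-real : ∀ {α} d → Pos α → Pos (1ᴿ ⊖ α) → cubicᴿ B C (fromℤ d) α ≈ᴿ 0ᴿ →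
      (∀ x → ¬ cubicℚ B C (fromℤ d) x ≡ 0ℚ) → TotallyRealCubic (ι α)
    rootless-totally-real {α} d 0<α α<1 α-root no-root = totally-real-cubic B C (fromℤ d) (0≤-b-3-c b c c≤) no-root α 0<α α<1 α-root

    unsplit-totally-real : (∀ n → ¬ Split b c n) → ∀ α → α ∈ I³ʳ b c → TotallyRealCubic (ι α)
    unsplit-totally-real unsplit α (0<α , α<1 , d , 1≤d , d≤ , α-root) =
      rootless-totally-real d (0<⇒pos 0<α) (<⇒Pos α<1) (real-root α-root) λ x x-root →
        let n , split , _ = rational-root-splits b c d x 1≤d d≤ x-root in unsplit n split

    module _ (unique : ∀ {n n′} → Split b c n → Split b c n′ → n ≡ n′) where

      rational-roots-agree : ∀ d d′ x x′ → + 1 ℤ.≤ d → d ℤ.≤ ℤ.- b ℤ.- c ℤ.- + 2 → + 1 ℤ.≤ d′ → d′ ℤ.≤ ℤ.- b ℤ.- c ℤ.- + 2 →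
        cubicℚ B C (fromℤ d) x ≡ 0ℚ → cubicℚ B C (fromℤ d′) x′ ≡ 0ℚ → d ≡ d′
      rational-roots-agree d d′ x x′ 1≤d d≤ 1≤d′ d′≤ x-root x′-root =
        let n , s , d≡ = rational-root-splits b c d x 1≤d d≤ x-root
            n′ , s′ , d′≡ = rational-root-splits b c d′ x′ 1≤d′ d′≤ x′-root
        in trans d≡ (trans (cong (λ n → ℤ.- ((n ℤ.- b) ℤ.* e b c n)) (unique s s′)) (sym d′≡))

      equal-constants : ∀ {α β d d′} → Pos α → Pos (1ᴿ ⊖ α) → Pos β → Pos (1ᴿ ⊖ β) →
        cubicᴿ B C (fromℤ d) α ≈ᴿ 0ᴿ → cubicᴿ B C (fromℤ d′) β ≈ᴿ 0ᴿ → d ≡ d′ → α ≈ᴿ β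
      equal-constants {α} {β} {d} 0<α α<1 0<β β<1 α-root β-root refl =
        unit-root-unique B C (fromℤ d) (0≤-b-3-c b c c≤) (b≤0 small) (-3≤b small) α β 0<α α<1 0<β β<1 α-root β-root

      field-determines : ∀ d d′ {α β} → Pos α → Pos (1ᴿ ⊖ α) → Pos β → Pos (1ᴿ ⊖ β) →
        cubicᴿ B C (fromℤ d) α ≈ᴿ 0ᴿ → cubicᴿ B C (fromℤ d′) β ≈ᴿ 0ᴿ →
        (∀ x → ¬ cubicℚ B C (fromℤ d) x ≡ 0ℚ) → ι β ∈ ℚ⟮ ι α ⟯ → α ≈ᴿ β
      field-determines d d′ {α} {β} 0<α α<1 0<β β<1 α-root β-root no-root β∈ =
        let p , q , r , β≈ = proj₁ (Rootless.field-element B C (fromℤ d) no-root α α-root β∈)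
        in ≈-trans (not-in-field c d d′ small c≤ no-root α 0<α α<1 α-root p q r
             (pos-resp β≈ 0<β) (pos-resp (+-cong (≈-refl {1ᴿ}) (neg-cong β≈)) β<1)
             (≈-trans (≈-sym (cubicᴿ-cong B C (fromℤ d′) β≈)) β-root))
           (≈-sym β≈)

      -- If one cubic has no rational root, its root generates a field to which rigidity applies. If
      -- both have one, they share `d`, hence the root in (0, 1). The goal is absurd, so the
      -- existence of a rational root is used only through its double negation.
      distinct-fields : ∀ α β → α ∈ I³ʳ b c → β ∈ I³ʳ b c → ¬ (α ≈ᴿ β) → ¬ (ℚ⟮ ι α ⟯ ≐ ℚ⟮ ι β ⟯)
      distinct-fields α β (0<α , α<1 , d , 1≤d , d≤ , α-root) (0<β , β<1 , d′ , 1≤d′ , d′≤ , β-root) α≉β (α⊆β , β⊆α) =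
        rational-root-α λ x x-root → rational-root-β λ x′ x′-root →
          α≉β (equal-constants pα pα′ pβ pβ′ rα rβ (rational-roots-agree d d′ x x′ 1≤d d≤ 1≤d′ d′≤ x-root x′-root))
        where
        pα = 0<⇒pos 0<α
        pα′ = <⇒Pos α<1
        pβ = 0<⇒pos 0<β
        pβ′ = <⇒Pos β<1
        rα = real-root α-root
        rβ = real-root β-root
        rational-root-α : ¬ (∀ x → ¬ cubicℚ B C (fromℤ d) x ≡ 0ℚ)
        rational-root-α no-root = α≉β (field-determines d d′ pα pα′ pβ pβ′ rα rβ no-root (β⊆α gen))
        rational-root-β : ¬ (∀ x → ¬ cubicℚ B C (fromℤ d′) x ≡ 0ℚ)
        rational-root-β no-root = α≉β (≈-sym (field-determines d′ d pβ pβ′ pα pα′ rβ rα no-root (α⊆β gen)))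

      exceptional : ∀ n → Split b c n → ∃[ α ] IsSoleException b c α
        × ι α IsRootOf cubic b c (ℤ.- ((n ℤ.- b) ℤ.* e b c n)) × IsMinPoly (quadratic n (e b c n)) (ι α)
      exceptional n split = α , (membership 0<α α<1 1≤d d≤ α-root , not-cubic , (≈-refl , quadratic n (e b c n) , min-poly) , others) , ι-root α-root , min-poly
        where
        N E D : ℚ
        N = fromℤ n
        E = fromℤ (e b c n)
        d : ℤ
        d = ℤ.- ((n ℤ.- b) ℤ.* e b c n)
        D = fromℤ d
        α : ℝ
        α = proj₁ (quadratic-unit-root split)
        0<α = proj₁ (proj₂ (quadratic-unit-root split))
        α<1 = proj₁ (proj₂ (proj₂ (quadratic-unit-root split)))
        quadratic-root : ev E N 1ℚ α ≈ᴿ 0ᴿ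
        quadratic-root = proj₂ (proj₂ (proj₂ (quadratic-unit-root split)))
        1≤d = proj₁ (split-range b c n split)
        d≤ = proj₂ (split-range b c n split)
        D≡ : D ≡ - ((N - B) * E)
        D≡ = trans (fromℤ-neg ((n ℤ.- b) ℤ.* e b c n)) (cong -_ (trans (fromℤ-* (n ℤ.- b) (e b c n))
          (cong (_* E) (trans (fromℤ-+ n (ℤ.- b)) (cong (λ z → N + z) (fromℤ-neg b))))))
        C≡ : C ≡ E - N * (N - B)
        C≡ = trans (cong fromℤ (c≡ b c n)) (trans (fromℤ-+ (e b c n) (ℤ.- (n ℤ.* (n ℤ.- b)))) (cong (λ z → E + z)
          (trans (fromℤ-neg (n ℤ.* (n ℤ.- b))) (cong -_ (trans (fromℤ-* n (n ℤ.- b)) (cong (N *_) (trans (fromℤ-+ n (ℤ.- b)) (cong (λ z → N + z) (fromℤ-neg b)))))))))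
        α-root : cubicᴿ B C D α ≈ᴿ 0ᴿ
        α-root = modulo quadratic-root (α ⊖ fromℚᴿ (N - B)) λ i →
          trans (cong₂ (λ C D → cubicℚ B C D (seq α i)) C≡ D≡)
            (solve 4 (λ B N E a → :cubic B (E :- N :* (N :- B)) (:- ((N :- B) :* E)) a := con 0ℚ :+ (a :- (N :- B)) :* :ev E N (con 1ℚ) a) refl B N E (seq α i))
        quadratic-minimal : ∀ {m} (q : Monic m) → ι α IsRootOf q → 2 ℕ.≤ m
        quadratic-minimal [] h = contradiction h (no-root₀ {ι α})
        -- Multiplied by x, the quadratic becomes a cubic to which `rational-root` applies, and a
        -- rational α would be an integer in (0, 1).
        quadratic-minimal (q ∷ []) h = contradiction (rational-root n (e b c n) (+ 0) (- q) cubic-root) not-integer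
          where
          α≈-q : α ≈ᴿ fromℚᴿ (- q)
          α≈-q = modulo (≈-trans (≈-sym (re-eval₁ q α)) (re≈ h)) 1ᴿ λ i →
            solve 2 (λ q a → a := :- q :+ con 1ℚ :* (q :+ con 1ℚ :* a)) refl q (seq α i)
          cubic-root : cubicℚ N E 0ℚ (- q) ≡ 0ℚ
          cubic-root = fromℚ-injective {q = 0ℚ} (≈-trans (≈-sym (cubicᴿ-fromℚ N E 0ℚ α≈-q))
            (modulo quadratic-root α λ i → solve 3 (λ N E a → :cubic N E (con 0ℚ) a := con 0ℚ :+ a :* :ev E N (con 1ℚ) a) refl N E (seq α i)))
          not-integer : ¬ IsInteger (- q)
          not-integer (m , -q≡m) = no-integer-in-unit-interval m
            (fromℤ-cancel-< {+ 0} {m} (subst (0ℚ <_) -q≡m (pos-fromℚ⁻¹ (pos-resp α≈-q 0<α))))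
            (fromℤ-cancel-< {m} {+ 1} (subst (_< 1ℚ) -q≡m (below-rational α≈-q α<1)))
        quadratic-minimal (_ ∷ _ ∷ _) _ = s≤s (s≤s z≤n)
        min-poly : IsMinPoly (quadratic n (e b c n)) (ι α)
        min-poly = ι-root₂ {N} {E} {α} quadratic-root , quadratic-minimal
        not-cubic : ¬ TotallyRealCubic (ι α)
        not-cubic ((p , _ , minimal) , _) = 3≰2 (minimal (quadratic n (e b c n)) (ι-root₂ {N} {E} {α} quadratic-root))
          where
          3≰2 : ¬ 3 ℕ.≤ 2
          3≰2 (s≤s (s≤s ()))
        -- A rational root of the cubic of β would give it the same constant term as the cubic of α,
        -- and then β = α.
        others : ∀ β → β ∈ I³ʳ b c → ¬ (β ≈ᴿ α) → TotallyRealCubic (ι β)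
        others β (0<β , β<1 , d′ , 1≤d′ , d′≤ , β-root) β≉α =
          rootless-totally-real d′ (0<⇒pos 0<β) (<⇒Pos β<1) (real-root β-root) λ x x-root →
            let n′ , split′ , d′≡ = rational-root-splits b c d′ x 1≤d′ d′≤ x-root
            in β≉α (equal-constants (0<⇒pos 0<β) (<⇒Pos β<1) 0<α α<1 (real-root β-root) α-root
                 (trans d′≡ (cong (λ n → ℤ.- ((n ℤ.- b) ℤ.* e b c n)) (unique split′ split))))

open import Data.Integer using (ℤ; +_; -[1+_]; -_; _+_; _-_; _*_; _≤_; _<_)

theorem14 : ∀ (b c : ℤ) → - + 3 ≤ b → b ≤ + 0 → c ≤ - b - + 3 →
  let f = λ (n : ℤ) → - (n * n) + (b - + 1) * n - + 1
      g = λ (n : ℤ) → - (n * n) + b * n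
      e = λ (n : ℤ) → c + n * n - b * n
      OfSpecialForm = (∃[ n ] δ b ≤ n × c ≡ f n)
                    ⊎ (∃[ n ] + 1 + ε b - ε (- + 3 - b) ≤ n × c ≡ g n)
  in
    (∀ α β → α ∈ I³ʳ b c → β ∈ I³ʳ b c → ¬ (α ≈ᴿ β) → ¬ (ℚ⟮ ι α ⟯ ≐ ℚ⟮ ι β ⟯))
  × (OfSpecialForm → ∀ α → α ∈ I³ʳ b c → TotallyRealCubic (ι α))
  × (¬ OfSpecialForm → ∃[ α ] IsSoleException b c α)
  × (∀ n → (+ 1 + ε b ≤ n × f n < c × c < g n)
         ⊎ (n ≤ - + 3 - ε (- + 3 - b) × g n < c × c < f n) →
     ∃[ α ] IsSoleException b c α
          × ι α IsRootOf cubic b c (- ((n - b) * e n))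
          × IsMinPoly (quadratic n (e n)) (ι α))
theorem14 b c -3≤b b≤0 c≤-b-3 =
    distinct-fields b c small c≤-b-3 unique ,
    (λ special → unsplit-totally-real b c small c≤-b-3 (special-form-not-split size special)) ,
    (λ ¬special → let n , interval = interval-exists size ¬special
                      α , sole , _ = exceptional b c small c≤-b-3 unique n (interval-splits c n small interval)
                  in α , sole) ,
    λ n interval → exceptional b c small c≤-b-3 unique n (interval-splits c n small interval)
  where
  open IntegerRoots
  open Assembly
  size : Magnitude b c
  size = magnitudes b c -3≤b b≤0 c≤-b-3
  small : FieldRigidity.SmallCoefficient b
  small = magnitude-small size
  unique : ∀ {n n′} → Split b c n → Split b c n′ → n ≡ n′
  unique = splits-agree size
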